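{- For every $m\geq1$, $$\rho(p_m)=\delta^mE=\delta^{m-1}\mathcal G_1 .$$ Consequently, if $\lambda\vdash n$, then $\rho(p_\lambda)=\delta^nE^{\ell(\lambda)}$. Moreover, $$\ker\rho=\bigl\langle\, p_ip_{j+1}-p_{i+1}p_j:\ 1\leq i<j\,\bigr\rangle ,$$ the ideal of $\Lambda$ generated by these elements. In particular, for $n\geq1$, $$\rho(\Lambda_n)=\delta^n\,\mathrm{span}_{\mathbb Q}\{E,E^2,\ldots,E^n\},\qquad \dim\ker(\rho|_{\Lambda_n})=p(n)-n,$$ where $p(n)$ is the number of partitions of $n$.
   Context: Work over $\mathbb Q$. With $D=\partial_x+\partial_y$, put $\mathcal G_0=\mathrm{id}$ and $\mathcal G_r=y^r\sum_{j=1}^{r}\binom{r-1}{j-1}\frac{x^j}{j!}D^j$ for $r\geq1$, operators on $\mathbb Q[x,y]$; they commute pairwise. $\Lambda=\mathbb Q[h_1,h_2,\ldots]$ is the ring of symmetric functions over $\mathbb Q$ in variables $z_1,z_2,\ldots$, freely generated by the complete homogeneous functions $h_r$, and $\Lambda_n$ is its degree-$n$ component. $\rho:\Lambda\to\mathrm{End}_{\mathbb Q}(\mathbb Q[x,y])$ is the unique unital algebra homomorphism with $\rho(h_r)=\mathcal G_r$ (the product in the endomorphism algebra is composition). The power sums are $p_m=\sum_{i\geq1}z_i^m$, and for a partition $\lambda=(\lambda_1,\ldots,\lambda_\ell)$, $p_\lambda=p_{\lambda_1}\cdots p_{\lambda_\ell}$, $\ell(\lambda)=\ell$. Put $\delta=y-x$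 and $u=x/y$, so that $\mathbb Q(x,y)=\mathbb Q(\delta,u)$; $E=u\partial_u$ is the $\mathbb Q$-derivation of $\mathbb Q(\delta,u)$ with $E(\delta)=0$, $E(u)=u$. $\delta$ also denotes multiplication by $y-x$. One has $\delta E=xyD=\mathcal G_1$, and for $1\le\ell\leq n$ the operator $\delta^nE^\ell=(y-x)^{n-\ell}(xyD)^\ell$ maps $\mathbb Q[x,y]$ to itself; it is in this sense that $\delta^nE^\ell$ is regarded as an element of $\mathrm{End}_{\mathbb Q}(\mathbb Q[x,y])$. -}

module Defs where

open import Algebra.Bundles using (RawRing; CommutativeRing)
open import Algebra.Module.Bundles.Raw using (RawLeftModule)
open import Algebra.Module.Morphism.Structures using (module LeftModuleMorphisms)
open import Algebra.Morphism.Structures using (module RingMorphisms)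
import Algebra.Definitions.RawSemiring as RawSemiringOps
import Algebra.Properties.CommutativeSemigroup as CommutativeSemigroupProperties
import Algebra.Properties.Group as GroupProperties
import Algebra.Properties.Ring as RingProperties
import Algebra.Solver.Ring as Solver
open import Algebra.Solver.Ring.AlmostCommutativeRing
  using (fromCommutativeRing; _-Raw-AlmostCommutative⟶_)
open import Data.Fin.Base using (Fin; zero; suc; toℕ)
open import Data.Fin.Properties using () renaming (_≟_ to _≟ᶠ_)
open import Data.Integer.Base using (+_)
open import Data.List.Base as List using (List; []; _∷_; length; allFin)
open import Data.List.Relation.Unary.All using (All)
open import Data.List.Relation.Unary.Linked using (Linked)
open import Data.Maybe.Base using (Maybe; just; nothing)
open import Data.Nat.Base using (ℕ; zero; suc; _≤_; _<_; _≥_; _!)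
open import Data.Nat.Combinatorics using (_C_)
open import Data.Nat.GeneralisedArithmetic using (fold)
import Data.Nat.ListAction as ListAction
open import Data.Nat.Properties using (_!≢0)
open import Data.Product.Base using (∃; ∃₂; _×_; _,_)
open import Data.Rational.Base using (ℚ; 0ℚ; 1ℚ)
import Data.Rational as ℚ
import Data.Rational.Properties as ℚ
open import Function.Base using (_∘_; id)
open import Level using (0ℓ)
open import Relation.Binary.PropositionalEquality as ≡ using (_≡_; refl)
open import Relation.Nullary using (yes; no)
open import Relation.Unary using (Pred)
import Relation.Binary.Reasoning.Setoid as SetoidReasoning

infixl 6 _+_
infixl 7 _*_
infix  8 -_
infix  4 _≈_

-- The polynomial ring over ℚ in a set X of variables, as the free commutative
-- ℚ-algebra on X: terms, modulo the congruence generated by the axioms.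

data ℚ[_] (X : Set) : Set where
  con : ℚ → ℚ[ X ]
  var : X → ℚ[ X ]
  _+_ : ℚ[ X ] → ℚ[ X ] → ℚ[ X ]
  _*_ : ℚ[ X ] → ℚ[ X ] → ℚ[ X ]
  -_  : ℚ[ X ] → ℚ[ X ]

data _≈_ {X : Set} : ℚ[ X ] → ℚ[ X ] → Set where
  ≈-refl      : ∀ {f} → f ≈ f
  ≈-sym       : ∀ {f g} → f ≈ g → g ≈ f
  ≈-trans     : ∀ {f g h} → f ≈ g → g ≈ h → f ≈ h
  +-cong      : ∀ {f f′ g g′} → f ≈ f′ → g ≈ g′ → f + g ≈ f′ + g′
  *-cong      : ∀ {f f′ g g′} → f ≈ f′ → g ≈ g′ → f * g ≈ f′ * g′
  -‿cong      : ∀ {f f′} → f ≈ f′ → - f ≈ - f′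
  +-assoc     : ∀ f g h → (f + g) + h ≈ f + (g + h)
  +-comm      : ∀ f g → f + g ≈ g + f
  +-identityˡ : ∀ f → con 0ℚ + f ≈ f
  -‿inverseˡ  : ∀ f → (- f) + f ≈ con 0ℚ
  *-assoc     : ∀ f g h → (f * g) * h ≈ f * (g * h)
  *-comm      : ∀ f g → f * g ≈ g * f
  *-identityˡ : ∀ f → con 1ℚ * f ≈ f
  distribˡ    : ∀ f g h → f * (g + h) ≈ f * g + f * h
  con-+       : ∀ a b → con (a ℚ.+ b) ≈ con a + con b
  con-*       : ∀ a b → con (a ℚ.* b) ≈ con a * con b

polynomialRing : Set → CommutativeRing 0ℓ 0ℓ
polynomialRing X = record
  { Carrier = ℚ[ X ] ; _≈_ = _≈_ ; _+_ = _+_ ; _*_ = _*_ ; -_ = -_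
  ; 0# = con 0ℚ ; 1# = con 1ℚ
  ; isCommutativeRing = record
    { isRing = record
      { +-isAbelianGroup = record
        { isGroup = record
          { isMonoid = record
            { isSemigroup = record
              { isMagma = record
                { isEquivalence = record { refl = ≈-refl ; sym = ≈-sym ; trans = ≈-trans }
                ; ∙-cong = +-cong }
              ; assoc = +-assoc }
            ; identity = +-identityˡ , λ f → ≈-trans (+-comm _ _) (+-identityˡ f) }
          ; inverse = -‿inverseˡ , λ f → ≈-trans (+-comm _ _) (-‿inverseˡ f)
          ; ⁻¹-cong = -‿cong }
        ; comm = +-comm }
      ; *-cong = *-cong
      ; *-assoc = *-assoc
      ; *-identity = *-identityˡ , λ f → ≈-trans (*-comm _ _) (*-identityˡ f)
      ; distrib = distribˡ , λ f g h → ≈-trans (*-comm _ _)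
          (≈-trans (distribˡ f g h) (+-cong (*-comm _ _) (*-comm _ _))) }
    ; *-comm = *-comm } }

module _ {X : Set} where
  open RawRing (CommutativeRing.rawRing (polynomialRing X)) using (rawSemiring)
  open RawSemiringOps rawSemiring public using (_^_; sum)

infixl 6 _-_
infixr 7 _·_

_-_ : ∀ {X} → ℚ[ X ] → ℚ[ X ] → ℚ[ X ]
f - g = f + (- g)

_·_ : ∀ {X} → ℚ → ℚ[ X ] → ℚ[ X ]
c · f = con c * f

polynomialModule : Set → RawLeftModule ℚ 0ℓ 0ℓ
polynomialModule X = record
  { Carrierᴹ = ℚ[ X ] ; _≈ᴹ_ = _≈_ ; _+ᴹ_ = _+_ ; _*ₗ_ = _·_ ; 0ᴹ = con 0ℚ ; -ᴹ_ = -_ }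

∏ : ∀ {X} → List ℚ[ X ] → ℚ[ X ]
∏ = List.foldr _*_ (con 1ℚ)

substitute : ∀ {X Y} → (X → ℚ[ Y ]) → ℚ[ X ] → ℚ[ Y ]
substitute σ (con c) = con c
substitute σ (var i) = σ i
substitute σ (f + g) = substitute σ f + substitute σ g
substitute σ (f * g) = substitute σ f * substitute σ g
substitute σ (- f)   = - substitute σ f

∂ : ∀ {n} → Fin n → ℚ[ Fin n ] → ℚ[ Fin n ]
∂ i (con c) = con 0ℚ
∂ i (var j) with i ≟ᶠ j
... | yes _ = con 1ℚ
... | no  _ = con 0ℚ
∂ i (f + g) = ∂ i f + ∂ i g
∂ i (f * g) = ∂ i f * g + f * ∂ i g
∂ i (- f)   = - ∂ i f

substitute-cong : ∀ {X Y} (σ : X → ℚ[ Y ]) {f g} → f ≈ g → substitute σ f ≈ substitute σ g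
substitute-cong σ ≈-refl = ≈-refl
substitute-cong σ (≈-sym p) = ≈-sym (substitute-cong σ p)
substitute-cong σ (≈-trans p q) = ≈-trans (substitute-cong σ p) (substitute-cong σ q)
substitute-cong σ (+-cong p q) = +-cong (substitute-cong σ p) (substitute-cong σ q)
substitute-cong σ (*-cong p q) = *-cong (substitute-cong σ p) (substitute-cong σ q)
substitute-cong σ (-‿cong p) = -‿cong (substitute-cong σ p)
substitute-cong σ (+-assoc f g h) = +-assoc _ _ _
substitute-cong σ (+-comm f g) = +-comm _ _
substitute-cong σ (+-identityˡ f) = +-identityˡ _
substitute-cong σ (-‿inverseˡ f) = -‿inverseˡ _
substitute-cong σ (*-assoc f g h) = *-assoc _ _ _
substitute-cong σ (*-comm f g) = *-comm _ _
substitute-cong σ (*-identityˡ f) = *-identityˡ _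
substitute-cong σ (distribˡ f g h) = distribˡ _ _ _
substitute-cong σ (con-+ a b) = con-+ a b
substitute-cong σ (con-* a b) = con-* a b

data Span {X : Set} (S : Pred ℚ[ X ] 0ℓ) : Pred ℚ[ X ] 0ℓ where
  gen  : ∀ {f} → S f → Span S f
  0∈   : Span S (con 0ℚ)
  _+∈_ : ∀ {f g} → Span S f → Span S g → Span S (f + g)
  _·∈_ : ∀ c {f} → Span S f → Span S (c · f)
  resp : ∀ {f g} → f ≈ g → Span S f → Span S g

data Ideal {X : Set} (S : Pred ℚ[ X ] 0ℓ) : Pred ℚ[ X ] 0ℓ where
  gen  : ∀ {f} → S f → Ideal S f
  0∈   : Ideal S (con 0ℚ)
  _+∈_ : ∀ {f g} → Ideal S f → Ideal S g → Ideal S (f + g)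
  _*∈_ : ∀ g {f} → Ideal S f → Ideal S (g * f)
  resp : ∀ {f g} → f ≈ g → Ideal S f → Ideal S g

record IsBasis {X : Set} (V : Pred ℚ[ X ] 0ℓ) {d : ℕ} (b : Fin d → ℚ[ X ]) : Set where
  field
    member      : ∀ i → V (b i)
    independent : ∀ (c : Fin d → ℚ) → sum (λ i → c i · b i) ≈ con 0ℚ → ∀ i → c i ≡ 0ℚ
    spanning    : ∀ f → V f → ∃ λ (c : Fin d → ℚ) → f ≈ sum (λ i → c i · b i)

HasDimension : {X : Set} → Pred ℚ[ X ] 0ℓ → ℕ → Set
HasDimension V d = ∃ λ (b : Fin d → ℚ[ _ ]) → IsBasis V b

ℚ[x,y] : Set
ℚ[x,y] = ℚ[ Fin 2 ]

x y δ : ℚ[x,y]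
x = var zero
y = var (suc zero)
δ = y - x

module LinearMaps = LeftModuleMorphisms (polynomialModule (Fin 2)) (polynomialModule (Fin 2))

record End : Set where
  field
    apply    : ℚ[x,y] → ℚ[x,y]
    isLinear : LinearMaps.IsLeftModuleHomomorphism apply

  open LinearMaps.IsLeftModuleHomomorphism isLinear public

open End public using (apply)

module P {X : Set} where
  open CommutativeRing (polynomialRing X) public
    using (ring; zeroˡ; zeroʳ; -‿inverseʳ; +-identityʳ; *-identityʳ; distribʳ; setoid)
  open RingProperties ring public
    using (-‿distribʳ-*; -‿distribˡ-*; -‿+-comm)
  open GroupProperties (CommutativeRing.+-group (polynomialRing X)) public
    using (x∙y⁻¹≈ε⇒x≈y) renaming (∙-cancelˡ to +-cancelˡ)
  open CommutativeSemigroupProperties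
    (CommutativeRing.+-commutativeSemigroup (polynomialRing X)) public
    using () renaming (interchange to +-interchange)
  open CommutativeSemigroupProperties
    (CommutativeRing.*-commutativeSemigroup (polynomialRing X)) public
    using () renaming (x∙yz≈y∙xz to *-leftComm; interchange to *-interchange)

  con-neg : ∀ a → con {X} (ℚ.- a) ≈ - con a
  con-neg a = +-cancelˡ (con a) _ _
    (≈-trans (≈-sym (con-+ a (ℚ.- a)))
    (≈-trans (≡⇒≈ (≡.cong con (ℚ.+-inverseʳ a))) (≈-sym (-‿inverseʳ (con a)))))
    where
    ≡⇒≈ : ∀ {f g : ℚ[ X ]} → f ≡ g → f ≈ g
    ≡⇒≈ refl = ≈-refl

  constants : ℚ.+-*-rawRing -Raw-AlmostCommutative⟶ fromCommutativeRing (polynomialRing X)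
  constants = record
    { ⟦_⟧ = con ; +-homo = con-+ ; *-homo = con-* ; -‿homo = con-neg
    ; 0-homo = ≈-refl ; 1-homo = ≈-refl }

  _≟_ : ∀ a b → Maybe (con {X} a ≈ con b)
  a ≟ b with a ℚ.≟ b
  ... | yes refl = just ≈-refl
  ... | no  _    = nothing

module R {X : Set} =
  Solver ℚ.+-*-rawRing (fromCommutativeRing (polynomialRing X)) P.constants P._≟_

linear : (φ : ℚ[x,y] → ℚ[x,y]) →
         (∀ {f g} → f ≈ g → φ f ≈ φ g) →
         (∀ f g → φ (f + g) ≈ φ f + φ g) →
         (∀ c f → φ (c · f) ≈ c · φ f) →
         End
linear φ φ-cong φ-+ φ-· = record
  { apply = φ
  ; isLinear = record
    { +ᴹ-isGroupHomomorphism = record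
      { isMonoidHomomorphism = record
        { isMagmaHomomorphism = record
          { isRelHomomorphism = record { cong = φ-cong }
          ; homo = φ-+ }
        ; ε-homo = φ-0 }
      ; ⁻¹-homo = φ-neg }
    ; *ₗ-homo = φ-· } }
  where
  φ-0 : φ (con 0ℚ) ≈ con 0ℚ
  φ-0 = ≈-trans (φ-cong (≈-sym (P.zeroˡ (con 0ℚ)))) (≈-trans (φ-· 0ℚ _) (P.zeroˡ _))

  φ-neg : ∀ f → φ (- f) ≈ - φ f
  φ-neg f = P.+-cancelˡ (φ f) _ _
    (≈-trans (≈-sym (φ-+ f (- f)))
    (≈-trans (φ-cong (P.-‿inverseʳ f))
    (≈-trans φ-0 (≈-sym (P.-‿inverseʳ (φ f))))))

infix  4 _≈ᴱ_
infixl 6 _+ᴱ_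
infixl 7 _∘ᴱ_
infixr 7 _·ᴱ_
infix  8 -ᴱ_

_≈ᴱ_ : End → End → Set
S ≈ᴱ T = ∀ f → apply S f ≈ apply T f

0ᴱ idᴱ : End
0ᴱ  = linear (λ _ → con 0ℚ) (λ _ → ≈-refl)
        (λ _ _ → ≈-sym (+-identityˡ _)) (λ _ _ → ≈-sym (P.zeroʳ _))
idᴱ = linear id id (λ _ _ → ≈-refl) (λ _ _ → ≈-refl)

_+ᴱ_ _∘ᴱ_ : End → End → End
S +ᴱ T = linear (λ f → apply S f + apply T f)
  (λ p → +-cong (S.⟦⟧-cong p) (T.⟦⟧-cong p))
  (λ f g → ≈-trans (+-cong (S.+ᴹ-homo f g) (T.+ᴹ-homo f g)) (P.+-interchange _ _ _ _))
  (λ c f → ≈-trans (+-cong (S.*ₗ-homo c f) (T.*ₗ-homo c f)) (≈-sym (distribˡ _ _ _)))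
  where
  module S = End S
  module T = End T
S ∘ᴱ T = linear (apply S ∘ apply T)
  (S.⟦⟧-cong ∘ T.⟦⟧-cong)
  (λ f g → ≈-trans (S.⟦⟧-cong (T.+ᴹ-homo f g)) (S.+ᴹ-homo _ _))
  (λ c f → ≈-trans (S.⟦⟧-cong (T.*ₗ-homo c f)) (S.*ₗ-homo c _))
  where
  module S = End S
  module T = End T

-ᴱ_ : End → End
-ᴱ T = linear (λ f → - apply T f)
  (-‿cong ∘ T.⟦⟧-cong)
  (λ f g → ≈-trans (-‿cong (T.+ᴹ-homo f g)) (≈-sym (P.-‿+-comm _ _)))
  (λ c f → ≈-trans (-‿cong (T.*ₗ-homo c f)) (P.-‿distribʳ-* _ _))
  where module T = End T

mul : ℚ[x,y] → End
mul h = linear (h *_) (*-cong ≈-refl) (distribˡ h) (λ c f → P.*-leftComm h (con c) f)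

_·ᴱ_ : ℚ → End → End
c ·ᴱ T = mul (con c) ∘ᴱ T

endRing : RawRing 0ℓ 0ℓ
endRing = record
  { Carrier = End ; _≈_ = _≈ᴱ_ ; _+_ = _+ᴱ_ ; _*_ = _∘ᴱ_ ; -_ = -ᴱ_ ; 0# = 0ᴱ ; 1# = idᴱ }

endModule : RawLeftModule ℚ 0ℓ 0ℓ
endModule = record
  { Carrierᴹ = End ; _≈ᴹ_ = _≈ᴱ_ ; _+ᴹ_ = _+ᴱ_ ; _*ₗ_ = _·ᴱ_ ; 0ᴹ = 0ᴱ ; -ᴹ_ = -ᴱ_ }

open RawSemiringOps (RawRing.rawSemiring endRing) public
  using () renaming (_^_ to _^ᴱ_; sum to sumᴱ)

∂-cong : ∀ {n} (i : Fin n) {f g} → f ≈ g → ∂ i f ≈ ∂ i g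
∂-cong i ≈-refl = ≈-refl
∂-cong i (≈-sym p) = ≈-sym (∂-cong i p)
∂-cong i (≈-trans p q) = ≈-trans (∂-cong i p) (∂-cong i q)
∂-cong i (+-cong p q) = +-cong (∂-cong i p) (∂-cong i q)
∂-cong i (*-cong p q) = +-cong (*-cong (∂-cong i p) q) (*-cong p (∂-cong i q))
∂-cong i (-‿cong p) = -‿cong (∂-cong i p)
∂-cong i (+-assoc f g h) = +-assoc _ _ _
∂-cong i (+-comm f g) = +-comm _ _
∂-cong i (+-identityˡ f) = +-identityˡ _
∂-cong i (-‿inverseˡ f) = -‿inverseˡ _
∂-cong i (*-assoc f g h) =
  R.solve 6 (λ f g h f′ g′ h′ →
    ((f′ R.:* g R.:+ f R.:* g′) R.:* h R.:+ f R.:* g R.:* h′) R.:=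
    (f′ R.:* (g R.:* h) R.:+ f R.:* (g′ R.:* h R.:+ g R.:* h′)))
    ≈-refl f g h (∂ i f) (∂ i g) (∂ i h)
∂-cong i (*-comm f g) =
  ≈-trans (+-comm _ _) (+-cong (*-comm _ _) (*-comm _ _))
∂-cong i (*-identityˡ f) =
  ≈-trans (+-cong (P.zeroˡ _) (*-identityˡ _)) (+-identityˡ _)
∂-cong i (distribˡ f g h) =
  R.solve 6 (λ f g h f′ g′ h′ →
    (f′ R.:* (g R.:+ h) R.:+ f R.:* (g′ R.:+ h′)) R.:=
    ((f′ R.:* g R.:+ f R.:* g′) R.:+ (f′ R.:* h R.:+ f R.:* h′)))
    ≈-refl f g h (∂ i f) (∂ i g) (∂ i h)
∂-cong i (con-+ a b) = ≈-sym (+-identityˡ _)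
∂-cong i (con-* a b) =
  ≈-sym (≈-trans (+-cong (P.zeroˡ _) (P.zeroʳ _)) (+-identityˡ _))

∂ᴱ : Fin 2 → End
∂ᴱ i = linear (∂ i) (∂-cong i) (λ _ _ → ≈-refl)
  (λ c f → ≈-trans (+-cong (P.zeroˡ f) ≈-refl) (+-identityˡ _))

D : End
D = ∂ᴱ zero +ᴱ ∂ᴱ (suc zero)

-- The sum over 1 ≤ j ≤ r is indexed by i = j - 1.

𝒢 : ℕ → End
𝒢 zero = idᴱ
𝒢 (suc r) = mul (y ^ suc r) ∘ᴱ sumᴱ {suc r} (λ i → let j = suc (toℕ i) in
  ((r C (toℕ i)) /! j) ·ᴱ (mul (x ^ j) ∘ᴱ (D ^ᴱ j)))
  where
  _/!_ : ℕ → ℕ → ℚ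
  a /! j = (+ a ℚ./ (j !)) {{j !≢0}}

-- Λ = ℚ[h₁, h₂, …], the variable r being h_{r+1}.

Λ : Set
Λ = ℚ[ ℕ ]

h : ℕ → Λ
h zero    = con 1ℚ
h (suc r) = var r

-- The complete homogeneous polynomial of degree r in a list of variables: the
-- monomials containing the first variable z, then those that do not.

complete : ∀ {X} → ℕ → List X → ℚ[ X ]
complete zero    zs       = con 1ℚ
complete (suc r) []       = con 0ℚ
complete (suc r) (z ∷ zs) = var z * complete r (z ∷ zs) + complete (suc r) zs

-- A symmetric function in z₁, z₂, … is determined by its restrictions to
-- finitely many variables z₁, …, z_N (the others being set to 0).

restrict : ∀ N → Λ → ℚ[ Fin N ]
restrict N = substitute (λ r → complete (suc r) (allFin N))

IsPowerSum : ℕ → Λ → Set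
IsPowerSum m f = ∀ N → restrict N f ≈ sum (λ (i : Fin N) → var i ^ m)

record Partition (n : ℕ) : Set where
  field
    parts      : List ℕ
    decreasing : Linked _≥_ parts
    positive   : All (1 ≤_) parts
    sums-to    : ListAction.sum parts ≡ n

  ℓ : ℕ
  ℓ = length parts

open Partition public using (parts; ℓ)

_⟦_⟧ : ∀ {n} → (ℕ → Λ) → Partition n → Λ
f ⟦ lam ⟧ = ∏ (List.map f (parts lam))

-- The degree-n component, h_r having degree r.

Λ⟨_⟩ : ℕ → Pred Λ 0ℓ
Λ⟨ n ⟩ = Span (λ f → ∃ λ (lam : Partition n) → f ≡ h ⟦ lam ⟧)

-- The generators pᵢpⱼ₊₁ - pᵢ₊₁pⱼ with 1 ≤ i < j.

Relation : (ℕ → Λ) → Pred Λ 0ℓ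
Relation p f = ∃₂ λ i j → 1 ≤ i × i < j × f ≡ p i * p (suc j) - p (suc i) * p j

record IsAlgebraHomomorphism (ρ : Λ → End) : Set where
  field
    isRingHomomorphism :
      RingMorphisms.IsRingHomomorphism (CommutativeRing.rawRing (polynomialRing ℕ)) endRing ρ
    isLinear :
      LeftModuleMorphisms.IsLeftModuleHomomorphism (polynomialModule ℕ) endModule ρ

Regular : Pred ℚ[x,y] 0ℓ
Regular b = ∀ f → b * f ≈ con 0ℚ → f ≈ con 0ℚ

-- The field ℚ(x,y) as the total ring of fractions of the domain ℚ[x,y], where
-- regular means nonzero.

record ℚ⟨x,y⟩ : Set where
  constructor _/_[_]
  field
    num     : ℚ[x,y]
    den     : ℚ[x,y]
    regular : Regular den

infix  4 _≈ᶠ_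
infixl 6 _+ᶠ_
infixl 7 _*ᶠ_
infix  8 -ᶠ_

_≈ᶠ_ : ℚ⟨x,y⟩ → ℚ⟨x,y⟩ → Set
(a / b [ _ ]) ≈ᶠ (c / d [ _ ]) = a * d ≈ c * b

regular-1 : Regular (con 1ℚ)
regular-1 f p = ≈-trans (≈-sym (*-identityˡ f)) p

regular-* : ∀ {b d} → Regular b → Regular d → Regular (b * d)
regular-* rb rd f p = rd f (rb _ (≈-trans (≈-sym (*-assoc _ _ f)) p))

_+ᶠ_ _*ᶠ_ : ℚ⟨x,y⟩ → ℚ⟨x,y⟩ → ℚ⟨x,y⟩
(a / b [ p ]) +ᶠ (c / d [ q ]) = (a * d + c * b) / b * d [ regular-* p q ]
(a / b [ p ]) *ᶠ (c / d [ q ]) = (a * c) / b * d [ regular-* p q ]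

-ᶠ_ : ℚ⟨x,y⟩ → ℚ⟨x,y⟩
-ᶠ (a / b [ p ]) = (- a) / b [ p ]

ι : ℚ[x,y] → ℚ⟨x,y⟩
ι f = f / con 1ℚ [ regular-1 ]

≈ᶠ-trans : ∀ {p q r} → p ≈ᶠ q → q ≈ᶠ r → p ≈ᶠ r
≈ᶠ-trans {a / b [ _ ]} {c / d [ rd ]} {e / f [ _ ]} ad≈cb cf≈ed =
  P.x∙y⁻¹≈ε⇒x≈y _ _ (rd _ (begin
    d * (a * f - e * b)     ≈⟨ R.solve 5 (λ a b d e f →
                                 (d R.:* (a R.:* f R.:- (e R.:* b))) R.:=
                                 ((a R.:* d) R.:* f R.:- ((e R.:* d) R.:* b)))
                                 ≈-refl a b d e f ⟩
    (a * d) * f - e * d * b ≈⟨ +-cong (*-cong ad≈cb ≈-refl) (-‿cong (*-cong (≈-sym cf≈ed) ≈-refl)) ⟩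
    (c * b) * f - c * f * b ≈⟨ +-cong (R.solve 3 (λ b c f →
                                 ((c R.:* b) R.:* f) R.:= ((c R.:* f) R.:* b))
                                 ≈-refl b c f) ≈-refl ⟩
    c * f * b - c * f * b   ≈⟨ P.-‿inverseʳ _ ⟩
    con 0ℚ                  ∎))
  where open SetoidReasoning P.setoid

fractionField : CommutativeRing 0ℓ 0ℓ
fractionField = record
  { Carrier = ℚ⟨x,y⟩ ; _≈_ = _≈ᶠ_ ; _+_ = _+ᶠ_ ; _*_ = _*ᶠ_ ; -_ = -ᶠ_
  ; 0# = ι (con 0ℚ) ; 1# = ι (con 1ℚ)
  ; isCommutativeRing = record
    { isRing = record
      { +-isAbelianGroup = record
        { isGroup = record
          { isMonoid = record
            { isSemigroup = record
              { isMagma = record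
                { isEquivalence = record
                  { refl = ≈-refl ; sym = ≈-sym
                  ; trans = λ {p} {q} {r} → ≈ᶠ-trans {p} {q} {r} }
                ; ∙-cong = λ {p} {q} {r} {s} → +ᶠ-cong {p} {q} {r} {s} }
              ; assoc = +ᶠ-assoc }
            ; identity = +ᶠ-identityˡ ,
                λ p → ≈ᶠ-trans {p +ᶠ 0ᶠ} {0ᶠ +ᶠ p} {p} (+ᶠ-comm p 0ᶠ) (+ᶠ-identityˡ p) }
          ; inverse = -ᶠ-inverseˡ ,
              λ p → ≈ᶠ-trans {p +ᶠ (-ᶠ p)} {(-ᶠ p) +ᶠ p} {0ᶠ} (+ᶠ-comm p (-ᶠ p)) (-ᶠ-inverseˡ p)
          ; ⁻¹-cong = λ {p} {q} → -ᶠ-cong {p} {q} }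
        ; comm = +ᶠ-comm }
      ; *-cong = λ {p} {q} {r} {s} → *ᶠ-cong {p} {q} {r} {s}
      ; *-assoc = λ _ _ _ → *-cong (*-assoc _ _ _) (≈-sym (*-assoc _ _ _))
      ; *-identity = *ᶠ-identityˡ ,
          λ p → ≈ᶠ-trans {p *ᶠ 1ᶠ} {1ᶠ *ᶠ p} {p} (*ᶠ-comm p 1ᶠ) (*ᶠ-identityˡ p)
      ; distrib = *ᶠ-distribˡ , λ p q r →
          ≈ᶠ-trans {(q +ᶠ r) *ᶠ p} {p *ᶠ (q +ᶠ r)} {q *ᶠ p +ᶠ r *ᶠ p} (*ᶠ-comm (q +ᶠ r) p)
          (≈ᶠ-trans {p *ᶠ (q +ᶠ r)} {p *ᶠ q +ᶠ p *ᶠ r} {q *ᶠ p +ᶠ r *ᶠ p} (*ᶠ-distribˡ p q r)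
          (+ᶠ-cong {p *ᶠ q} {q *ᶠ p} {p *ᶠ r} {r *ᶠ p} (*ᶠ-comm p q) (*ᶠ-comm p r))) }
    ; *-comm = *ᶠ-comm } }
  where
  open SetoidReasoning (P.setoid {Fin 2})
  0ᶠ 1ᶠ : ℚ⟨x,y⟩
  0ᶠ = ι (con 0ℚ)
  1ᶠ = ι (con 1ℚ)

  +ᶠ-cong : ∀ {p p′ q q′} → p ≈ᶠ p′ → q ≈ᶠ q′ → p +ᶠ q ≈ᶠ p′ +ᶠ q′
  +ᶠ-cong {a / b [ _ ]} {a′ / b′ [ _ ]} {c / d [ _ ]} {c′ / d′ [ _ ]} e₁ e₂ = begin
    (a * d + c * b) * (b′ * d′)
      ≈⟨ R.solve 6 (λ a b c d b′ d′ →
           ((a R.:* d R.:+ c R.:* b) R.:* (b′ R.:* d′)) R.:=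
           ((a R.:* b′) R.:* (d R.:* d′) R.:+ (c R.:* d′) R.:* (b R.:* b′)))
           ≈-refl a b c d b′ d′ ⟩
    (a * b′) * (d * d′) + (c * d′) * (b * b′)
      ≈⟨ +-cong (*-cong e₁ ≈-refl) (*-cong e₂ ≈-refl) ⟩
    (a′ * b) * (d * d′) + (c′ * d) * (b * b′)
      ≈⟨ R.solve 6 (λ a′ b c′ d b′ d′ →
           ((a′ R.:* b) R.:* (d R.:* d′) R.:+ (c′ R.:* d) R.:* (b R.:* b′)) R.:=
           ((a′ R.:* d′ R.:+ c′ R.:* b′) R.:* (b R.:* d)))
           ≈-refl a′ b c′ d b′ d′ ⟩
    (a′ * d′ + c′ * b′) * (b * d) ∎

  *ᶠ-cong : ∀ {p p′ q q′} → p ≈ᶠ p′ → q ≈ᶠ q′ → p *ᶠ q ≈ᶠ p′ *ᶠ q′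
  *ᶠ-cong e₁ e₂ =
    ≈-trans (P.*-interchange _ _ _ _)
    (≈-trans (*-cong e₁ e₂) (P.*-interchange _ _ _ _))

  -ᶠ-cong : ∀ {p p′} → p ≈ᶠ p′ → -ᶠ p ≈ᶠ -ᶠ p′
  -ᶠ-cong e = ≈-trans (≈-sym (P.-‿distribˡ-* _ _)) (≈-trans (-‿cong e) (P.-‿distribˡ-* _ _))

  +ᶠ-assoc : ∀ p q r → (p +ᶠ q) +ᶠ r ≈ᶠ p +ᶠ (q +ᶠ r)
  +ᶠ-assoc (a / b [ _ ]) (c / d [ _ ]) (e / f [ _ ]) =
    R.solve 6 (λ a b c d e f →
      (((a R.:* d R.:+ c R.:* b) R.:* f R.:+ e R.:* (b R.:* d)) R.:* (b R.:* (d R.:* f))) R.:=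
      ((a R.:* (d R.:* f) R.:+ (c R.:* f R.:+ e R.:* d) R.:* b) R.:* (b R.:* d R.:* f)))
      ≈-refl a b c d e f

  +ᶠ-comm : ∀ p q → p +ᶠ q ≈ᶠ q +ᶠ p
  +ᶠ-comm _ _ = *-cong (+-comm _ _) (*-comm _ _)

  *ᶠ-comm : ∀ p q → p *ᶠ q ≈ᶠ q *ᶠ p
  *ᶠ-comm _ _ = *-cong (*-comm _ _) (*-comm _ _)

  +ᶠ-identityˡ : ∀ p → 0ᶠ +ᶠ p ≈ᶠ p
  +ᶠ-identityˡ (a / b [ _ ]) =
    *-cong (≈-trans (+-cong (P.zeroˡ b) (≈-trans (*-comm _ _) (*-identityˡ a))) (+-identityˡ a))
           (≈-sym (*-identityˡ b))

  *ᶠ-identityˡ : ∀ p → 1ᶠ *ᶠ p ≈ᶠ p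
  *ᶠ-identityˡ (a / b [ _ ]) = *-cong (*-identityˡ a) (≈-sym (*-identityˡ b))

  -ᶠ-inverseˡ : ∀ p → (-ᶠ p) +ᶠ p ≈ᶠ 0ᶠ
  -ᶠ-inverseˡ (a / b [ _ ]) = begin
    ((- a) * b + a * b) * con 1ℚ ≈⟨ *-cong (P.distribʳ b (- a) a) ≈-refl ⟨
    ((- a) + a) * b * con 1ℚ     ≈⟨ *-cong (*-cong (-‿inverseˡ a) ≈-refl) ≈-refl ⟩
    con 0ℚ * b * con 1ℚ          ≈⟨ *-cong (P.zeroˡ b) ≈-refl ⟩
    con 0ℚ * con 1ℚ              ≈⟨ P.zeroˡ _ ⟩
    con 0ℚ                       ≈⟨ P.zeroˡ _ ⟨
    con 0ℚ * (b * b)             ∎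

  *ᶠ-distribˡ : ∀ p q r → p *ᶠ (q +ᶠ r) ≈ᶠ p *ᶠ q +ᶠ p *ᶠ r
  *ᶠ-distribˡ (a / b [ _ ]) (c / d [ _ ]) (e / f [ _ ]) =
    R.solve 6 (λ a b c d e f →
      ((a R.:* (c R.:* f R.:+ e R.:* d)) R.:* ((b R.:* d) R.:* (b R.:* f))) R.:=
      (((a R.:* c) R.:* (b R.:* f) R.:+ (a R.:* e) R.:* (b R.:* d)) R.:* (b R.:* (d R.:* f))))
      ≈-refl a b c d e f

-- The quotient of f by y, with remainder f at y = 0, shows that y is regular.

private
  at-y=0 quotient : ℚ[x,y] → ℚ[x,y]
  at-y=0 = substitute λ { zero → x ; (suc _) → con 0ℚ }

  quotient (con c)          = con 0ℚ
  quotient (var zero)       = con 0ℚ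
  quotient (var (suc zero)) = con 1ℚ
  quotient (f + g)          = quotient f + quotient g
  quotient (f * g)          = quotient f * g + at-y=0 f * quotient g
  quotient (- f)            = - quotient f

  division : ∀ f → f ≈ at-y=0 f + y * quotient f
  division (con c) = ≈-sym (≈-trans (+-cong ≈-refl (P.zeroʳ y)) (P.+-identityʳ _))
  division (var zero) = ≈-sym (≈-trans (+-cong ≈-refl (P.zeroʳ y)) (P.+-identityʳ _))
  division (var (suc zero)) = ≈-sym (≈-trans (+-identityˡ _) (P.*-identityʳ y))
  division (f + g) =
    ≈-trans (+-cong (division f) (division g))
    (≈-trans (P.+-interchange _ _ _ _) (+-cong ≈-refl (≈-sym (distribˡ _ _ _))))
  division (f * g) = begin
    f * g
      ≈⟨ *-cong (division f) ≈-refl ⟩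
    (f₀ + y * f₁) * g
      ≈⟨ R.solve 4 (λ f₀ f₁ g y →
           ((f₀ R.:+ y R.:* f₁) R.:* g) R.:= (f₀ R.:* g R.:+ y R.:* (f₁ R.:* g)))
           ≈-refl f₀ f₁ g y ⟩
    f₀ * g + y * (f₁ * g)
      ≈⟨ +-cong (*-cong ≈-refl (division g)) ≈-refl ⟩
    f₀ * (g₀ + y * g₁) + y * (f₁ * g)
      ≈⟨ R.solve 6 (λ f₀ f₁ g g₀ g₁ y →
           (f₀ R.:* (g₀ R.:+ y R.:* g₁) R.:+ y R.:* (f₁ R.:* g)) R.:=
           (f₀ R.:* g₀ R.:+ y R.:* (f₁ R.:* g R.:+ f₀ R.:* g₁)))
           ≈-refl f₀ f₁ g g₀ g₁ y ⟩
    f₀ * g₀ + y * (f₁ * g + f₀ * g₁) ∎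
    where
    open SetoidReasoning P.setoid
    f₀ = at-y=0 f
    f₁ = quotient f
    g₀ = at-y=0 g
    g₁ = quotient g
  division (- f) =
    ≈-trans (-‿cong (division f))
    (≈-trans (≈-sym (P.-‿+-comm _ _)) (+-cong ≈-refl (P.-‿distribʳ-* _ _)))

  quotient-cong : ∀ {f g} → f ≈ g → quotient f ≈ quotient g
  quotient-cong ≈-refl = ≈-refl
  quotient-cong (≈-sym p) = ≈-sym (quotient-cong p)
  quotient-cong (≈-trans p q) = ≈-trans (quotient-cong p) (quotient-cong q)
  quotient-cong (+-cong p q) = +-cong (quotient-cong p) (quotient-cong q)
  quotient-cong (*-cong p q) =
    +-cong (*-cong (quotient-cong p) q) (*-cong (substitute-cong _ p) (quotient-cong q))
  quotient-cong (-‿cong p) = -‿cong (quotient-cong p)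
  quotient-cong (+-assoc f g h) = +-assoc _ _ _
  quotient-cong (+-comm f g) = +-comm _ _
  quotient-cong (+-identityˡ f) = +-identityˡ _
  quotient-cong (-‿inverseˡ f) = -‿inverseˡ _
  quotient-cong (*-assoc f g h) =
    R.solve 7 (λ f₀ f₁ g g₀ g₁ h h₁ →
      ((f₁ R.:* g R.:+ f₀ R.:* g₁) R.:* h R.:+ (f₀ R.:* g₀) R.:* h₁) R.:=
      (f₁ R.:* (g R.:* h) R.:+ f₀ R.:* (g₁ R.:* h R.:+ g₀ R.:* h₁)))
      ≈-refl (at-y=0 f) (quotient f) g (at-y=0 g) (quotient g) h (quotient h)
  quotient-cong (*-comm f g) = begin
    f₁ * g + f₀ * g₁
      ≈⟨ +-cong (*-cong ≈-refl (division g)) ≈-refl ⟩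
    f₁ * (g₀ + y * g₁) + f₀ * g₁
      ≈⟨ R.solve 5 (λ f₀ f₁ g₀ g₁ y →
           (f₁ R.:* (g₀ R.:+ y R.:* g₁) R.:+ f₀ R.:* g₁) R.:=
           (g₁ R.:* (f₀ R.:+ y R.:* f₁) R.:+ g₀ R.:* f₁))
           ≈-refl f₀ f₁ g₀ g₁ y ⟩
    g₁ * (f₀ + y * f₁) + g₀ * f₁
      ≈⟨ +-cong (*-cong ≈-refl (division f)) ≈-refl ⟨
    g₁ * f + g₀ * f₁ ∎
    where
    open SetoidReasoning P.setoid
    f₀ = at-y=0 f
    f₁ = quotient f
    g₀ = at-y=0 g
    g₁ = quotient g
  quotient-cong (*-identityˡ f) =
    ≈-trans (+-cong (P.zeroˡ f) (*-identityˡ _)) (+-identityˡ _)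
  quotient-cong (distribˡ f g h) =
    R.solve 6 (λ f₀ f₁ g g₁ h h₁ →
      (f₁ R.:* (g R.:+ h) R.:+ f₀ R.:* (g₁ R.:+ h₁)) R.:=
      ((f₁ R.:* g R.:+ f₀ R.:* g₁) R.:+ (f₁ R.:* h R.:+ f₀ R.:* h₁)))
      ≈-refl (at-y=0 f) (quotient f) g (quotient g) h (quotient h)
  quotient-cong (con-+ a b) = ≈-sym (+-identityˡ _)
  quotient-cong (con-* a b) =
    ≈-sym (≈-trans (+-cong (P.zeroˡ _) (P.zeroʳ _)) (+-identityˡ _))

regular-y : Regular y
regular-y f yf≈0 = begin
  f                                ≈⟨ *-identityˡ f ⟨
  con 1ℚ * f                       ≈⟨ P.+-identityʳ _ ⟨
  con 1ℚ * f + con 0ℚ              ≈⟨ +-cong ≈-refl (P.zeroˡ _) ⟨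
  con 1ℚ * f + con 0ℚ * quotient f ≈⟨ quotient-cong yf≈0 ⟩
  con 0ℚ                           ∎
  where open SetoidReasoning P.setoid

u : ℚ⟨x,y⟩
u = x / y [ regular-y ]

record IsDerivation (d : ℚ⟨x,y⟩ → ℚ⟨x,y⟩) : Set where
  field
    cong    : ∀ {p q} → p ≈ᶠ q → d p ≈ᶠ d q
    +-homo  : ∀ p q → d (p +ᶠ q) ≈ᶠ d p +ᶠ d q
    ·-homo  : ∀ c p → d (ι (con c) *ᶠ p) ≈ᶠ ι (con c) *ᶠ d p
    leibniz : ∀ p q → d (p *ᶠ q) ≈ᶠ d p *ᶠ q +ᶠ p *ᶠ d q

-- Φ maps ℚ[x,y] to itself and T is its restriction.

infix 4 _≐_
infix 5 δ^_⟨_⟩^_ δ^_∑[_]_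

_≐_ : End → (ℚ⟨x,y⟩ → ℚ⟨x,y⟩) → Set
T ≐ Φ = ∀ f → ι (apply T f) ≈ᶠ Φ (ι f)

open RawSemiringOps (RawRing.rawSemiring (CommutativeRing.rawRing fractionField)) public
  using () renaming (sum to sumᶠ)

δ^_⟨_⟩^_ : ℕ → (ℚ⟨x,y⟩ → ℚ⟨x,y⟩) → ℕ → ℚ⟨x,y⟩ → ℚ⟨x,y⟩
(δ^ n ⟨ E ⟩^ k) q = ι (δ ^ n) *ᶠ fold q E k

-- δⁿ (c₁ E + c₂ E² + ⋯ + cₙ Eⁿ)
δ^_∑[_]_ : ∀ n → (Fin n → ℚ) → (ℚ⟨x,y⟩ → ℚ⟨x,y⟩) → ℚ⟨x,y⟩ → ℚ⟨x,y⟩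
(δ^ n ∑[ c ] E) q = ι (δ ^ n) *ᶠ sumᶠ (λ i → ι (con (c i)) *ᶠ fold q E (suc (toℕ i)))

{-# OPTIONS --safe #-}

-- With A = xyD one has (r + 1) 𝒢_{r+1} = (A + r δ) 𝒢_r, and A commutes with δ; hence
-- (r + 1) 𝒢_{r+1} = Σ_{i≤r} δⁱ A 𝒢_{r-i}, and comparison with Newton's identities gives
-- ρ(p_{r+1}) = δʳ A. Modulo the relations, p_λ is the hook product p_{n-ℓ+1} p₁^{ℓ-1}, which ρ maps
-- to δ^{n-ℓ} A^ℓ. These operators are linearly independent because the polynomials δᵏ Aˡ x are:
-- over ℚ[δ], Aˡ x has degree l + 1 in x. That a symmetric function is determined by its
-- restrictions and that the p_λ are linearly independent is read off coefficients: if
-- ℓ(λ) ≤ ℓ(μ) = N, then z₁^{μ₁} ⋯ z_N^{μ_N} occurs in p_λ(z₁, …, z_N) only if λ = μ.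
module Submission where

open import Defs
open import Algebra.Bundles using (CommutativeRing; RawRing)
import Algebra.Definitions.RawSemiring as RawSemiringOps
open import Algebra.Module.Morphism.Structures using (module LeftModuleMorphisms)
open import Algebra.Morphism.Structures using (module RingMorphisms)
import Algebra.Properties.CommutativeSemigroup as CommutativeSemigroupProperties
import Algebra.Properties.Group as GroupProperties
open import Data.Bool.Base using (if_then_else_)
open import Data.Empty using (⊥-elim)
open import Data.Fin.Base using (Fin; zero; suc; toℕ; fromℕ<)
import Data.Fin.Properties as Fin
import Data.Integer.Base as ℤ
import Data.Integer.Properties as ℤ
open import Data.List.Base as List using (List; []; _∷_; _++_; length; lookup; allFin)
import Data.List.Membership.DecPropositional as DecMembership
open import Data.List.Membership.Propositional using (_∈_; _∉_)
import Data.List.Membership.Propositional.Properties as ∈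
import Data.List.Properties as List
open import Data.List.Relation.Binary.Permutation.Propositional
  using (_↭_; prep; swap; refl; trans; ↭-refl; ↭-trans; ↭-sym; ↭-reflexive; ↭⇒↭ₛ)
import Data.List.Relation.Binary.Permutation.Propositional.Properties as ↭
import Data.List.Relation.Binary.Pointwise as Pointwise
open import Data.List.Relation.Unary.All as All using (All; []; _∷_)
import Data.List.Relation.Unary.All.Properties as All
open import Data.List.Relation.Unary.AllPairs using ([]; _∷_)
open import Data.List.Relation.Unary.Any as Any using (Any; here; there)
import Data.List.Relation.Unary.Any.Properties as Any
open import Data.List.Relation.Unary.Linked as Linked using (Linked)
import Data.List.Relation.Unary.Sorted.TotalOrder.Properties as Sorted
import Data.List.Relation.Unary.Unique.DecPropositional.Properties as DecUnique
open import Data.List.Relation.Unary.Unique.Propositional using (Unique)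
import Data.List.Relation.Unary.Unique.Propositional.Properties as Unique
open import Data.Nat.Base as ℕ using (ℕ; zero; suc; _≤_; _<_; _≥_; z≤n; s≤s; _∸_; _!)
open import Data.Nat.Combinatorics using (_C_; nCk+nC[k+1]≡[n+1]C[k+1]; k>n⇒nCk≡0; nC1≡n)
open import Data.Nat.GeneralisedArithmetic using (fold)
import Data.Nat.ListAction as ListAction
import Data.Nat.ListAction.Properties as ListAction
import Data.Nat.Properties as ℕ
open import Data.Nat.Properties using (_!≢0)
open import Data.Nat.Tactic.RingSolver using (solve-∀)
open import Data.Product.Base using (∃; ∃₂; _×_; _,_; proj₁; proj₂)
open import Data.Product.Properties using () renaming (≡-dec to ×-≡-dec)
open import Data.Rational.Base using (ℚ; 0ℚ; 1ℚ)
import Data.Rational as ℚ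
import Data.Rational.Properties as ℚ
import Data.Rational.Unnormalised as ℚᵘ
import Data.Rational.Unnormalised.Properties as ℚᵘ
open import Data.Sum.Base using (_⊎_; inj₁; inj₂)
open import Function.Base using (_∘_; id)
open import Function.Bundles using (_⇔_; _↔_; mk↔ₛ′; mk⇔)
open import Level using (0ℓ)
open import Relation.Binary.Bundles using (DecTotalOrder)
import Relation.Binary.Construct.Flip.EqAndOrd as Flip
open import Relation.Binary.Definitions using (DecidableEquality; tri<; tri≈; tri>)
open import Relation.Binary.PropositionalEquality as ≡ using (_≡_; _≢_; refl)
import Relation.Binary.Reasoning.Setoid as SetoidReasoning
open import Relation.Nullary using (¬_; Dec; yes; no; does; map′)
open import Relation.Nullary.Decidable using (¬?; dec-true; dec-false)
open import Relation.Unary using (Pred)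
open R using (_:+_; _:*_; :-_; _:=_; solve) renaming (con to :con)

open module ≈-Reasoning {X : Set} = SetoidReasoning (P.setoid {X})

-- Polynomials are terms modulo a congruence, so coefficients are not data and equality of
-- polynomials is not decided. Coefficients are therefore read off by iterated derivations followed
-- by a substitution, which respect the congruence. This yields them up to factorials, and it is
-- enough that the factor is a nonzero natural number. Independence is likewise stated without
-- normal forms: a formal combination is a list, possibly with repetitions, and the conclusion is
-- that it evaluates to zero under every family that is constant on classes of indices. This one
-- criterion, `Triangular`, serves both the products of power sums (indices up to permutation, size
-- the length) and the polynomials δᵏAˡx (size l). Applied to the family of hook products it lifts a
-- relation between operators back to Λ.

private variable
  X Y Z : Set

-- Congruence rules and rational constants.

≡⇒≈ : {f g : ℚ[ X ]} → f ≡ g → f ≈ g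
≡⇒≈ refl = ≈-refl

+-congʳ : ∀ {f g g′ : ℚ[ X ]} → g ≈ g′ → f + g ≈ f + g′
+-congʳ = +-cong ≈-refl

+-congˡ : ∀ {f g g′ : ℚ[ X ]} → g ≈ g′ → g + f ≈ g′ + f
+-congˡ p = +-cong p ≈-refl

*-congʳ : ∀ {f g g′ : ℚ[ X ]} → g ≈ g′ → f * g ≈ f * g′
*-congʳ = *-cong ≈-refl

*-congˡ : ∀ {f g g′ : ℚ[ X ]} → g ≈ g′ → g * f ≈ g′ * f
*-congˡ p = *-cong p ≈-refl

-- Defined by recursion so that `nat (suc n)` splits by the axiom `con-+` alone; `ν-/` connects it
-- with the fractions occurring in `𝒢`.
ν : ℕ → ℚ
ν zero    = 0ℚ
ν (suc n) = 1ℚ ℚ.+ ν n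

ν-+ : ∀ m n → ν (m ℕ.+ n) ≡ ν m ℚ.+ ν n
ν-+ zero    n = ≡.sym (ℚ.+-identityˡ (ν n))
ν-+ (suc m) n = ≡.trans (≡.cong (1ℚ ℚ.+_) (ν-+ m n)) (≡.sym (ℚ.+-assoc 1ℚ (ν m) (ν n)))

ν-* : ∀ m n → ν (m ℕ.* n) ≡ ν m ℚ.* ν n
ν-* zero    n = ≡.sym (ℚ.*-zeroˡ (ν n))
ν-* (suc m) n =
  ≡.trans (ν-+ n (m ℕ.* n))
  (≡.trans (≡.cong₂ ℚ._+_ (≡.sym (ℚ.*-identityˡ (ν n))) (ν-* m n))
           (≡.sym (ℚ.*-distribʳ-+ (ν n) 1ℚ (ν m))))

ν-nonNeg : ∀ n → 0ℚ ℚ.≤ ν n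
ν-nonNeg zero    = ℚ.≤-refl
ν-nonNeg (suc n) = ℚ.≤-trans (ν-nonNeg n)
  (ℚ.≤-trans (ℚ.≤-reflexive (≡.sym (ℚ.+-identityˡ (ν n))))
             (ℚ.+-monoˡ-≤ (ν n) (ℚ.<⇒≤ (ℚ.positive⁻¹ 1ℚ))))

ν-suc≢0 : ∀ n → ν (suc n) ≢ 0ℚ
ν-suc≢0 n p = ℚ.<-irrefl (≡.sym p)
  (ℚ.<-≤-trans (ℚ.positive⁻¹ 1ℚ)
    (ℚ.≤-trans (ℚ.≤-reflexive (≡.sym (ℚ.+-identityʳ 1ℚ))) (ℚ.+-monoʳ-≤ 1ℚ (ν-nonNeg n))))

ν≡/1 : ∀ n → ν n ≡ ℤ.+ n ℚ./ 1
ν≡/1 zero    = refl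
ν≡/1 (suc n) = ≡.trans (≡.cong (1ℚ ℚ.+_) (ν≡/1 n)) (ℚ.toℚᵘ-injective
  (ℚᵘ.≃-trans (ℚ.toℚᵘ-homo-+ 1ℚ (ℤ.+ n ℚ./ 1))
  (ℚᵘ.≃-trans (ℚᵘ.+-cong (ℚᵘ.≃-refl {ℚᵘ.1ℚᵘ}) (ℚ.toℚᵘ-fromℚᵘ (ℚᵘ.mkℚᵘ (ℤ.+ n) 0)))
  (ℚᵘ.≃-trans (ℚᵘ.*≡* (≡.cong (ℤ._* ℤ.+ 1) (≡.cong (ℤ._+_ (ℤ.+ 1)) (ℤ.*-identityʳ (ℤ.+ n)))))
              (ℚᵘ.≃-sym (ℚ.toℚᵘ-fromℚᵘ (ℚᵘ.mkℚᵘ (ℤ.+ suc n) 0)))))))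

ν-/ : ∀ a d .{{_ : ℕ.NonZero d}} → (ℤ.+ a ℚ./ d) ℚ.* ν d ≡ ν a
ν-/ a d@(suc d-1) =
  ≡.trans (≡.cong ((ℤ.+ a ℚ./ d) ℚ.*_) (ν≡/1 d))
  (≡.trans (ℚ.toℚᵘ-injective
    (ℚᵘ.≃-trans (ℚ.toℚᵘ-homo-* (ℤ.+ a ℚ./ d) (ℤ.+ d ℚ./ 1))
    (ℚᵘ.≃-trans (ℚᵘ.*-cong (ℚ.toℚᵘ-fromℚᵘ (ℚᵘ.mkℚᵘ (ℤ.+ a) d-1)) (ℚ.toℚᵘ-fromℚᵘ (ℚᵘ.mkℚᵘ (ℤ.+ d) 0)))
    (ℚᵘ.≃-trans cancel (ℚᵘ.≃-sym (ℚ.toℚᵘ-fromℚᵘ (ℚᵘ.mkℚᵘ (ℤ.+ a) 0)))))))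
  (≡.sym (ν≡/1 a)))
  where
  cancel : ℚᵘ.mkℚᵘ (ℤ.+ a) d-1 ℚᵘ.* ℚᵘ.mkℚᵘ (ℤ.+ d) 0 ℚᵘ.≃ ℚᵘ.mkℚᵘ (ℤ.+ a) 0
  cancel = ℚᵘ.*≡* (≡.trans (ℤ.*-identityʳ (ℤ.+ a ℤ.* ℤ.+ d))
    (≡.cong (λ e → ℤ.+ a ℤ.* ℤ.+ e) (≡.sym (ℕ.*-identityʳ d))))

nat : ℕ → ℚ[ X ]
nat n = con (ν n)

nat-suc : ∀ n → nat {X} (suc n) ≈ con 1ℚ + nat n
nat-suc n = con-+ 1ℚ (ν n)

nat-+ : ∀ m n → nat {X} (m ℕ.+ n) ≈ nat m + nat n
nat-+ m n = ≈-trans (≡⇒≈ (≡.cong con (ν-+ m n))) (con-+ (ν m) (ν n))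

nat-* : ∀ m n → nat {X} (m ℕ.* n) ≈ nat m * nat n
nat-* m n = ≈-trans (≡⇒≈ (≡.cong con (ν-* m n))) (con-* (ν m) (ν n))

con-cancel : ∀ {c} {f : ℚ[ X ]} → c ≢ 0ℚ → con c * f ≈ con 0ℚ → f ≈ con 0ℚ
con-cancel {c = c} {f} c≢0 cf≈0 = begin
  f                     ≈⟨ *-identityˡ f ⟨
  con 1ℚ * f            ≈⟨ *-congˡ (≡⇒≈ (≡.cong con (ℚ.*-inverseˡ c))) ⟨
  con (c⁻¹ ℚ.* c) * f   ≈⟨ *-congˡ (con-* c⁻¹ c) ⟩
  con c⁻¹ * con c * f   ≈⟨ *-assoc _ _ _ ⟩
  con c⁻¹ * (con c * f) ≈⟨ *-congʳ cf≈0 ⟩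
  con c⁻¹ * con 0ℚ      ≈⟨ P.zeroʳ _ ⟩
  con 0ℚ                ∎
  where
  instance
    c-nonZero : ℚ.NonZero c
    c-nonZero = ℚ.≢-nonZero c≢0
  c⁻¹ = ℚ.1/ c

-- Evaluation at 0, with values in ℚ, where equality is propositional. It shows that the congruence
-- keeps distinct constants apart, and the independence proofs end with it.
constantTerm : ℚ[ X ] → ℚ
constantTerm (con c) = c
constantTerm (var _) = 0ℚ
constantTerm (f + g) = constantTerm f ℚ.+ constantTerm g
constantTerm (f * g) = constantTerm f ℚ.* constantTerm g
constantTerm (- f)   = ℚ.- constantTerm f

constantTerm-cong : {f g : ℚ[ X ]} → f ≈ g → constantTerm f ≡ constantTerm g
constantTerm-cong ≈-refl = refl
constantTerm-cong (≈-sym p) = ≡.sym (constantTerm-cong p)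
constantTerm-cong (≈-trans p q) = ≡.trans (constantTerm-cong p) (constantTerm-cong q)
constantTerm-cong (+-cong p q) = ≡.cong₂ ℚ._+_ (constantTerm-cong p) (constantTerm-cong q)
constantTerm-cong (*-cong p q) = ≡.cong₂ ℚ._*_ (constantTerm-cong p) (constantTerm-cong q)
constantTerm-cong (-‿cong p) = ≡.cong ℚ.-_ (constantTerm-cong p)
constantTerm-cong (+-assoc f g h) = ℚ.+-assoc (constantTerm f) (constantTerm g) (constantTerm h)
constantTerm-cong (+-comm f g) = ℚ.+-comm (constantTerm f) (constantTerm g)
constantTerm-cong (+-identityˡ f) = ℚ.+-identityˡ (constantTerm f)
constantTerm-cong (-‿inverseˡ f) = ℚ.+-inverseˡ (constantTerm f)
constantTerm-cong (*-assoc f g h) = ℚ.*-assoc (constantTerm f) (constantTerm g) (constantTerm h)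
constantTerm-cong (*-comm f g) = ℚ.*-comm (constantTerm f) (constantTerm g)
constantTerm-cong (*-identityˡ f) = ℚ.*-identityˡ (constantTerm f)
constantTerm-cong (distribˡ f g h) = ℚ.*-distribˡ-+ (constantTerm f) (constantTerm g) (constantTerm h)
constantTerm-cong (con-+ a b) = refl
constantTerm-cong (con-* a b) = refl

con-injective : ∀ {a b} → con {X} a ≈ con b → a ≡ b
con-injective = constantTerm-cong

-- Linear maps and spans.

record Linear (φ : ℚ[ X ] → ℚ[ Y ]) : Set where
  field
    cong   : ∀ {f g} → f ≈ g → φ f ≈ φ g
    +-homo : ∀ f g → φ (f + g) ≈ φ f + φ g
    ·-homo : ∀ c f → φ (c · f) ≈ c · φ f

  0-homo : φ (con 0ℚ) ≈ con 0ℚ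
  0-homo = ≈-trans (cong (≈-sym (P.zeroˡ (con 0ℚ)))) (≈-trans (·-homo 0ℚ _) (P.zeroˡ _))

open Linear

id-linear : Linear {X} id
id-linear = record { cong = id ; +-homo = λ _ _ → ≈-refl ; ·-homo = λ _ _ → ≈-refl }

∘-linear : {φ : ℚ[ Y ] → ℚ[ Z ]} {ψ : ℚ[ X ] → ℚ[ Y ]} → Linear φ → Linear ψ → Linear (φ ∘ ψ)
∘-linear φ ψ = record
  { cong   = φ .cong ∘ ψ .cong
  ; +-homo = λ f g → ≈-trans (φ .cong (ψ .+-homo f g)) (φ .+-homo _ _)
  ; ·-homo = λ c f → ≈-trans (φ .cong (ψ .·-homo c f)) (φ .·-homo c _) }

fold-linear : {φ : ℚ[ X ] → ℚ[ X ]} → Linear φ → ∀ n → Linear (λ f → fold f φ n)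
fold-linear φ zero    = id-linear
fold-linear φ (suc n) = ∘-linear φ (fold-linear φ n)

*-linear : (g : ℚ[ X ]) → Linear (g *_)
*-linear g = record
  { cong   = *-congʳ
  ; +-homo = distribˡ g
  ; ·-homo = λ c f → P.*-leftComm g (con c) f }

substitute-linear : (σ : X → ℚ[ Y ]) → Linear (substitute σ)
substitute-linear σ = record
  { cong = substitute-cong σ ; +-homo = λ _ _ → ≈-refl ; ·-homo = λ _ _ → ≈-refl }

End-linear : (T : End) → Linear (apply T)
End-linear T = record { cong = T.⟦⟧-cong ; +-homo = T.+ᴹ-homo ; ·-homo = T.*ₗ-homo }
  where module T = End T

module _ {S : Pred ℚ[ X ] 0ℓ} where

  Span-map : {T : Pred ℚ[ Y ] 0ℓ} {φ : ℚ[ X ] → ℚ[ Y ]} → Linear φ →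
             (∀ {f} → S f → Span T (φ f)) → ∀ {f} → Span S f → Span T (φ f)
  Span-map φ s (gen p)    = s p
  Span-map φ s 0∈         = resp (≈-sym (0-homo φ)) 0∈
  Span-map φ s (p +∈ q)   = resp (≈-sym (φ .+-homo _ _)) (Span-map φ s p +∈ Span-map φ s q)
  Span-map φ s (c ·∈ p)   = resp (≈-sym (φ .·-homo c _)) (c ·∈ Span-map φ s p)
  Span-map φ s (resp e p) = resp (φ .cong e) (Span-map φ s p)

  Span-⊆ : {T : Pred ℚ[ X ] 0ℓ} → (∀ {f} → S f → Span T f) → ∀ {f} → Span S f → Span T f
  Span-⊆ = Span-map id-linear

  Span-vanish : {φ : ℚ[ X ] → ℚ[ Y ]} → Linear φ →
                (∀ {f} → S f → φ f ≈ con 0ℚ) → ∀ {f} → Span S f → φ f ≈ con 0ℚ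
  Span-vanish φ s (gen p)    = s p
  Span-vanish φ s 0∈         = 0-homo φ
  Span-vanish φ s (p +∈ q)   = ≈-trans (φ .+-homo _ _)
    (≈-trans (+-cong (Span-vanish φ s p) (Span-vanish φ s q)) (+-identityˡ _))
  Span-vanish φ s (c ·∈ p)   = ≈-trans (φ .·-homo c _) (≈-trans (*-congʳ (Span-vanish φ s p)) (P.zeroʳ _))
  Span-vanish φ s (resp e p) = ≈-trans (≈-sym (φ .cong e)) (Span-vanish φ s p)

  Span-neg : ∀ {f} → Span S f → Span S (- f)
  Span-neg {f} p = resp (solve 1 (λ f → :con (ℚ.- 1ℚ) :* f := :- f) ≈-refl f) ((ℚ.- 1ℚ) ·∈ p)

Span-* : {S T U : Pred ℚ[ X ] 0ℓ} → (∀ {f g} → S f → T g → Span U (f * g)) →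
         ∀ {f g} → Span S f → Span T g → Span U (f * g)
Span-* s p q = resp (*-comm _ _) (Span-map (*-linear _)
  (λ Sf → resp (*-comm _ _) (Span-map (*-linear _) (s Sf) q)) p)

mon : (ℕ → ℚ[ X ]) → List ℕ → ℚ[ X ]
mon g rs = ∏ (List.map g rs)

mon-++ : ∀ (g : ℕ → ℚ[ X ]) rs ss → mon g (rs ++ ss) ≈ mon g rs * mon g ss
mon-++ g []       ss = ≈-sym (*-identityˡ _)
mon-++ g (r ∷ rs) ss = ≈-trans (*-congʳ (mon-++ g rs ss)) (≈-sym (*-assoc _ _ _))

mon-↭ : ∀ (g : ℕ → ℚ[ X ]) {rs ss} → rs ↭ ss → mon g rs ≈ mon g ss
mon-↭ g refl         = ≈-refl
mon-↭ g (prep r p)   = *-congʳ (mon-↭ g p)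
mon-↭ g (swap r s p) = ≈-trans (P.*-leftComm _ _ _) (*-congʳ (*-congʳ (mon-↭ g p)))
mon-↭ g (trans p q)  = ≈-trans (mon-↭ g p) (mon-↭ g q)

mon-cong : ∀ {g g′ : ℕ → ℚ[ X ]} → (∀ r → g r ≈ g′ r) → ∀ rs → mon g rs ≈ mon g′ rs
mon-cong e []       = ≈-refl
mon-cong e (r ∷ rs) = *-cong (e r) (mon-cong e rs)

substitute-mon : ∀ (σ : X → ℚ[ Y ]) g rs → substitute σ (mon g rs) ≡ mon (substitute σ ∘ g) rs
substitute-mon σ g []       = refl
substitute-mon σ g (r ∷ rs) = ≡.cong (substitute σ (g r) *_) (substitute-mon σ g rs)

-- Formal linear combinations.

Combination : Set → Set
Combination I = List (ℚ × I)

eval : ∀ {I : Set} → (I → ℚ[ X ]) → Combination I → ℚ[ X ]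
eval g []            = con 0ℚ
eval g ((c , i) ∷ L) = c · g i + eval g L

reindex : ∀ {I J : Set} → (I → J) → Combination I → Combination J
reindex κ = List.map λ (c , i) → c , κ i

eval-reindex : ∀ {I J : Set} (κ : I → J) (g : J → ℚ[ X ]) L → eval g (reindex κ L) ≡ eval (g ∘ κ) L
eval-reindex κ g []            = refl
eval-reindex κ g ((c , i) ∷ L) = ≡.cong (c · g (κ i) +_) (eval-reindex κ g L)

module _ {I : Set} where

  eval-++ : ∀ (g : I → ℚ[ X ]) L M → eval g (L ++ M) ≈ eval g L + eval g M
  eval-++ g []            M = ≈-sym (+-identityˡ _)
  eval-++ g ((c , i) ∷ L) M = ≈-trans (+-congʳ (eval-++ g L M)) (≈-sym (+-assoc _ _ _))

  eval-cong : {g g′ : I → ℚ[ X ]} → (∀ i → g i ≈ g′ i) → ∀ L → eval g L ≈ eval g′ L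
  eval-cong e []            = ≈-refl
  eval-cong e ((c , i) ∷ L) = +-cong (*-congʳ (e i)) (eval-cong e L)

  eval-map : {φ : ℚ[ X ] → ℚ[ Y ]} → Linear φ → ∀ (g : I → ℚ[ X ]) L →
             φ (eval g L) ≈ eval (φ ∘ g) L
  eval-map φ g []            = 0-homo φ
  eval-map φ g ((c , i) ∷ L) =
    ≈-trans (φ .+-homo _ _) (+-cong (φ .·-homo c _) (eval-map φ g L))

  eval-· : ∀ (g : I → ℚ[ X ]) c L →
           eval g (List.map (λ (a , i) → c ℚ.* a , i) L) ≈ c · eval g L
  eval-· g c []            = ≈-sym (P.zeroʳ _)
  eval-· g c ((a , i) ∷ L) = begin
    (c ℚ.* a) · g i + _                  ≈⟨ +-cong (*-congˡ (con-* c a)) (eval-· g c L) ⟩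
    con c * con a * g i + c · eval g L   ≈⟨ +-congˡ (*-assoc _ _ _) ⟩
    c · (a · g i) + c · eval g L         ≈⟨ distribˡ _ _ _ ⟨
    c · (a · g i + eval g L)             ∎

  Span⇒Combination : {g : I → ℚ[ X ]} {S : Pred ℚ[ X ] 0ℓ} → (∀ {f} → S f → ∃ λ i → f ≡ g i) →
                     ∀ {f} → Span S f → ∃ λ L → f ≈ eval g L
  Span⇒Combination s (gen p) with s p
  ... | i , refl = (1ℚ , i) ∷ [] , ≈-sym (≈-trans (P.+-identityʳ _) (*-identityˡ _))
  Span⇒Combination s 0∈ = [] , ≈-refl
  Span⇒Combination {g = g} s (p +∈ q) with Span⇒Combination s p | Span⇒Combination s q
  ... | L , e | M , e′ = L ++ M , ≈-trans (+-cong e e′) (≈-sym (eval-++ g L M))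
  Span⇒Combination {g = g} s (c ·∈ p) with Span⇒Combination s p
  ... | L , e = List.map _ L , ≈-trans (*-congʳ e) (≈-sym (eval-· g c L))
  Span⇒Combination s (resp e p) with Span⇒Combination s p
  ... | L , e′ = L , ≈-trans (≈-sym e) e′

-- Φ m isolates the coefficient of m in a combination in which m has maximal size.
module Triangular {I : Set} (_~_ : I → I → Set) (_~?_ : ∀ i j → Dec (i ~ j)) (~-refl : ∀ {i} → i ~ i)
  (size : I → ℕ) (Φ : I → I → ℚ[ X ])
  (Φ-cong : ∀ m {i j} → i ~ j → Φ m i ≈ Φ m j)
  (Φ-zero : ∀ m i → size i ≤ size m → ¬ m ~ i → Φ m i ≈ con 0ℚ)
  (Φ-unit : ∀ m → ∃ λ c → c ≢ 0ℚ × Φ m m ≈ con c) where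

  coefficient : I → Combination I → ℚ
  coefficient m []            = 0ℚ
  coefficient m ((c , i) ∷ L) with m ~? i
  ... | yes _ = c ℚ.+ coefficient m L
  ... | no  _ = coefficient m L

  rest : I → Combination I → Combination I
  rest m []            = []
  rest m ((c , i) ∷ L) with m ~? i
  ... | yes _ = rest m L
  ... | no  _ = (c , i) ∷ rest m L

  eval-split : ∀ m (g : I → ℚ[ Y ]) → (∀ i → m ~ i → g i ≈ g m) → ∀ L →
               eval g L ≈ coefficient m L · g m + eval g (rest m L)
  eval-split m g g-~ [] = ≈-sym (≈-trans (P.+-identityʳ _) (P.zeroˡ _))
  eval-split m g g-~ ((c , i) ∷ L) with m ~? i
  ... | yes p = begin
    c · g i + eval g L                 ≈⟨ +-cong (*-congʳ (g-~ i p)) (eval-split m g g-~ L) ⟩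
    c · g m + (C · g m + eval g L′)    ≈⟨ +-assoc _ _ _ ⟨
    c · g m + C · g m + eval g L′      ≈⟨ +-congˡ (P.distribʳ (g m) (con c) (con C)) ⟨
    (con c + con C) * g m + eval g L′  ≈⟨ +-congˡ (*-congˡ (con-+ c C)) ⟨
    (c ℚ.+ C) · g m + eval g L′        ∎
    where C = coefficient m L
          L′ = rest m L
  ... | no _ = begin
    c · g i + eval g L                    ≈⟨ +-congʳ (eval-split m g g-~ L) ⟩
    c · g i + (C · g m + eval g L′)       ≈⟨ +-assoc _ _ _ ⟨
    c · g i + C · g m + eval g L′         ≈⟨ +-congˡ (+-comm _ _) ⟩
    C · g m + c · g i + eval g L′         ≈⟨ +-assoc _ _ _ ⟩
    C · g m + (c · g i + eval g L′)       ∎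
    where C = coefficient m L
          L′ = rest m L

  rest-≤ : ∀ m L → length (rest m L) ≤ length L
  rest-≤ m []            = z≤n
  rest-≤ m ((c , i) ∷ L) with m ~? i
  ... | yes _ = ℕ.m≤n⇒m≤1+n (rest-≤ m L)
  ... | no  _ = s≤s (rest-≤ m L)

  rest-< : ∀ m L → Any (λ (_ , i) → m ≡ i) L → length (rest m L) < length L
  rest-< m ((c , i) ∷ L) p with m ~? i
  rest-< m ((c , i) ∷ L) p           | yes _   = s≤s (rest-≤ m L)
  rest-< m ((c , m) ∷ L) (here refl) | no m≁m  = ⊥-elim (m≁m ~-refl)
  rest-< m ((c , i) ∷ L) (there p)   | no _    = s≤s (rest-< m L p)

  rest-vanishes : ∀ m L → All (λ (_ , i) → size i ≤ size m) L → eval (Φ m) (rest m L) ≈ con 0ℚ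
  rest-vanishes m []            []      = ≈-refl
  rest-vanishes m ((c , i) ∷ L) (b ∷ B) with m ~? i
  ... | yes _  = rest-vanishes m L B
  ... | no m≁i = ≈-trans (+-cong (≈-trans (*-congʳ (Φ-zero m i b m≁i)) (P.zeroʳ _)) (rest-vanishes m L B))
                         (+-identityˡ _)

  largest : ∀ t (L : Combination I) → ∃ λ m →
            Any (λ (_ , i) → m ≡ i) (t ∷ L) × All (λ (_ , i) → size i ≤ size m) (t ∷ L)
  largest (c , i) [] = i , here refl , ℕ.≤-refl ∷ []
  largest (c , i) (t ∷ L) with largest t L
  ... | m , m∈ , B with ℕ.≤-total (size i) (size m)
  ... | inj₁ i≤m = m , there m∈ , i≤m ∷ B
  ... | inj₂ m≤i = i , here refl , ℕ.≤-refl ∷ All.map (λ b → ℕ.≤-trans b m≤i) B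

  private
    vanish′ : ∀ n L → length L ≤ n → (∀ m → eval (Φ m) L ≈ con 0ℚ) →
              (g : I → ℚ[ Y ]) → (∀ {i j} → i ~ j → g i ≈ g j) → eval g L ≈ con 0ℚ
    vanish′ n       []       _   ΦL≈0 g g-~ = ≈-refl
    vanish′ (suc n) (t ∷ L₀) L≤n ΦL≈0 g g-~ with largest t L₀
    ... | m , m∈ , B = ≈-trans (drop g g-~)
      (vanish′ n (rest m L) (ℕ.≤-pred (ℕ.≤-trans (rest-< m L m∈) L≤n))
        (λ m′ → ≈-trans (≈-sym (drop (Φ m′) (Φ-cong m′))) (ΦL≈0 m′)) g g-~)
      where
      L = t ∷ L₀
      C = coefficient m L
      c = proj₁ (Φ-unit m)

      split : ∀ {Y} (g : I → ℚ[ Y ]) → (∀ {i j} → i ~ j → g i ≈ g j) →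
              eval g L ≈ C · g m + eval g (rest m L)
      split g g-~ = eval-split m g (λ i m~i → ≈-sym (g-~ m~i)) L

      con-C≈0 : con {X} C ≈ con 0ℚ
      con-C≈0 = con-cancel (proj₁ (proj₂ (Φ-unit m))) (begin
        con c * con C                      ≈⟨ *-comm _ _ ⟩
        C · con c                          ≈⟨ *-congʳ (proj₂ (proj₂ (Φ-unit m))) ⟨
        C · Φ m m                          ≈⟨ P.+-identityʳ _ ⟨
        C · Φ m m + con 0ℚ                 ≈⟨ +-congʳ (rest-vanishes m L B) ⟨
        C · Φ m m + eval (Φ m) (rest m L)  ≈⟨ split (Φ m) (Φ-cong m) ⟨
        eval (Φ m) L                       ≈⟨ ΦL≈0 m ⟩
        con 0ℚ                             ∎)

      drop : ∀ {Y} (g : I → ℚ[ Y ]) → (∀ {i j} → i ~ j → g i ≈ g j) → eval g L ≈ eval g (rest m L)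
      drop g g-~ = begin
        eval g L                      ≈⟨ split g g-~ ⟩
        C · g m + eval g (rest m L)   ≈⟨ +-congˡ (*-congˡ (≡⇒≈ (≡.cong con (con-injective con-C≈0)))) ⟩
        0ℚ · g m + eval g (rest m L)  ≈⟨ +-congˡ (P.zeroˡ _) ⟩
        con 0ℚ + eval g (rest m L)    ≈⟨ +-identityˡ _ ⟩
        eval g (rest m L)             ∎

  -- Quantifying over `g` says that `L` is formally zero without collecting equal terms. Later `g`
  -- is the family of products itself, the family of hook products, or the indicator of a class.
  vanish : ∀ L → (∀ m → eval (Φ m) L ≈ con 0ℚ) →
           (g : I → ℚ[ Y ]) → (∀ {i j} → i ~ j → g i ≈ g j) → eval g L ≈ con 0ℚ
  vanish L = vanish′ (length L) L ℕ.≤-refl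

-- Series convolution and Newton's identities.

conv : (ℕ → ℚ[ X ]) → (ℕ → ℚ[ X ]) → ℕ → ℚ[ X ]
conv a b zero    = a 0 * b 0
conv a b (suc m) = a 0 * b (suc m) + conv (a ∘ suc) b m

conv-cong : {a a′ b b′ : ℕ → ℚ[ X ]} → (∀ m → a m ≈ a′ m) → (∀ m → b m ≈ b′ m) →
            ∀ m → conv a b m ≈ conv a′ b′ m
conv-cong e e′ zero    = *-cong (e 0) (e′ 0)
conv-cong e e′ (suc m) = +-cong (*-cong (e 0) (e′ (suc m))) (conv-cong (e ∘ suc) e′ m)

-- A series with constant term 1 is cancellable: once the leading terms of `a` and `a′` agree, they
-- can be subtracted and the hypothesis passes to the shifted series.
conv-cancel : ∀ {a a′ b : ℕ → ℚ[ X ]} → b 0 ≈ con 1ℚ →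
              (∀ m → conv a b m ≈ conv a′ b m) → ∀ m → a m ≈ a′ m
conv-cancel {a = a} {a′} {b} b₀ e zero = begin
  a 0           ≈⟨ P.*-identityʳ _ ⟨
  a 0 * con 1ℚ  ≈⟨ *-congʳ b₀ ⟨
  a 0 * b 0     ≈⟨ e 0 ⟩
  a′ 0 * b 0    ≈⟨ *-congʳ b₀ ⟩
  a′ 0 * con 1ℚ ≈⟨ P.*-identityʳ _ ⟩
  a′ 0          ∎
conv-cancel {a = a} {a′} {b} b₀ e (suc m) = conv-cancel b₀ e′ m
  where
  e′ : ∀ m → conv (a ∘ suc) b m ≈ conv (a′ ∘ suc) b m
  e′ m = P.+-cancelˡ (a 0 * b (suc m)) _ _
    (≈-trans (e (suc m)) (+-congˡ (*-congˡ (≈-sym (conv-cancel b₀ e 0)))))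

substitute-conv : ∀ (σ : X → ℚ[ Y ]) a b m →
                  substitute σ (conv a b m) ≡ conv (substitute σ ∘ a) (substitute σ ∘ b) m
substitute-conv σ a b zero    = refl
substitute-conv σ a b (suc m) = ≡.cong (substitute σ (a 0 * b (suc m)) +_) (substitute-conv σ (a ∘ suc) b m)

-- The coefficients of (Σ s_r tʳ) / (Σ h_r tʳ).
series/h : ℕ → (ℕ → Λ) → Λ
series/h zero    s = s 0
series/h (suc m) s = series/h m (λ k → s (suc k) - s 0 * h (suc k))

conv-series/h : ∀ s m → conv (λ k → series/h k s) h m ≈ s m
conv-series/h s zero    = P.*-identityʳ (s 0)
conv-series/h s (suc m) = begin
  s 0 * h (suc m) + conv (λ k → series/h k s′) h m   ≈⟨ +-congʳ (conv-series/h s′ m) ⟩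
  s 0 * h (suc m) + (s (suc m) - s 0 * h (suc m))
    ≈⟨ solve 2 (λ a b → a :+ (b :+ :- a) := b) ≈-refl (s 0 * h (suc m)) (s (suc m)) ⟩
  s (suc m)                                          ∎
  where s′ = λ k → s (suc k) - s 0 * h (suc k)

-- The identity P(t) H(t) = H′(t), coefficient by coefficient. The index of the power sums is
-- shifted: `p k` stands for p_{k+1}, while `h 0` is the constant term of H.
Newton : (ℕ → ℚ[ X ]) → (ℕ → ℚ[ X ]) → Set
Newton p h = ∀ m → conv p h m ≈ nat (suc m) * h (suc m)

-- The logarithmic derivative H′/H.
𝓅 : ℕ → Λ
𝓅 m = series/h m (λ k → nat (suc k) * h (suc k))

𝓅-newton : Newton 𝓅 h
𝓅-newton = conv-series/h _

powerSum : List X → ℕ → ℚ[ X ]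
powerSum []       m = con 0ℚ
powerSum (z ∷ zs) m = var z ^ suc m + powerSum zs m

conv-+ : ∀ (a a′ b : ℕ → ℚ[ X ]) m → conv (λ k → a k + a′ k) b m ≈ conv a b m + conv a′ b m
conv-+ a a′ b zero    = P.distribʳ _ _ _
conv-+ a a′ b (suc m) = ≈-trans (+-cong (P.distribʳ _ _ _) (conv-+ (a ∘ suc) (a′ ∘ suc) b m)) (P.+-interchange _ _ _ _)

conv-scale : ∀ t (a b : ℕ → ℚ[ X ]) m → conv (λ k → t * a k) b m ≈ t * conv a b m
conv-scale t a b zero    = *-assoc _ _ _
conv-scale t a b (suc m) = ≈-trans (+-cong (*-assoc _ _ _) (conv-scale t (a ∘ suc) b m)) (≈-sym (distribˡ _ _ _))

conv-zero : ∀ (b : ℕ → ℚ[ X ]) m → conv (λ _ → con 0ℚ) b m ≈ con 0ℚ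
conv-zero b zero    = P.zeroˡ _
conv-zero b (suc m) = ≈-trans (+-cong (P.zeroˡ _) (conv-zero b m)) (+-identityˡ _)

module _ (z : X) (zs : List X) where
  private
    H H′ : ℕ → ℚ[ X ]
    H r  = complete r (z ∷ zs)
    H′ r = complete r zs

  -- The recursion of `complete` says H = ztH + H₀, where H₀ is the series of `zs`, written `H′`
  -- here; multiply it by the series of `a`.
  conv-complete-∷ : ∀ a m → conv a H (suc m) ≈ var z * conv a H m + conv a H′ (suc m)
  conv-complete-∷ a zero = solve 5
    (λ z a₀ a₁ h′ i → a₀ :* (z :* i :+ h′) :+ a₁ :* i := z :* (a₀ :* i) :+ (a₀ :* h′ :+ a₁ :* i))
    ≈-refl (var z) (a 0) (a 1) (H′ 1) (con 1ℚ)
  conv-complete-∷ a (suc m) = ≈-trans (+-congʳ (conv-complete-∷ (a ∘ suc) m))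
    (solve 6 (λ z a₀ H H′ c c′ → a₀ :* (z :* H :+ H′) :+ (z :* c :+ c′) :=
                                 z :* (a₀ :* H :+ c) :+ (a₀ :* H′ :+ c′))
      ≈-refl (var z) (a 0) (H (suc m)) (H′ (suc (suc m))) (conv (a ∘ suc) H m) (conv (a ∘ suc) H′ (suc m)))

  -- The geometric series is z/(1 - zt), and (1 - zt)H is the series of `zs`.
  conv-geometric : ∀ m → conv (λ k → var z ^ suc k) H′ m ≈ var z * H m
  conv-geometric zero    = *-congˡ (P.*-identityʳ _)
  conv-geometric (suc m) = begin
    var z * con 1ℚ * H′ (suc m) + conv (λ k → var z * var z ^ suc k) H′ m
      ≈⟨ +-cong (*-congˡ (P.*-identityʳ _)) (≈-trans (conv-scale (var z) _ H′ m) (*-congʳ (conv-geometric m))) ⟩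
    var z * H′ (suc m) + var z * (var z * H m)
      ≈⟨ ≈-trans (+-comm _ _) (≈-sym (distribˡ _ _ _)) ⟩
    var z * H (suc m) ∎

-- Differentiating H = ztH + H₀ gives zt dH + zH + dH₀. By the two preceding lemmas the product of
-- the power sum series with H satisfies the same recursion, so induction on the variables and the
-- degree applies.
powerSum-newton : ∀ (zs : List X) → Newton (powerSum zs) (λ r → complete r zs)
powerSum-newton []       m = ≈-trans (conv-zero _ m) (≈-sym (P.zeroʳ _))
powerSum-newton (z ∷ zs) zero = begin
  (var z * con 1ℚ + powerSum zs 0) * con 1ℚ
    ≈⟨ solve 2 (λ v s → (v :* :con 1ℚ :+ s) :* :con 1ℚ := v :+ s :* :con 1ℚ) ≈-refl (var z) (powerSum zs 0) ⟩
  var z + powerSum zs 0 * con 1ℚ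
    ≈⟨ +-congʳ (powerSum-newton zs 0) ⟩
  var z + con 1ℚ * complete 1 zs
    ≈⟨ solve 2 (λ v s → v :+ :con 1ℚ :* s := :con 1ℚ :* (v :* :con 1ℚ :+ s)) ≈-refl (var z) (complete 1 zs) ⟩
  con 1ℚ * (var z * con 1ℚ + complete 1 zs) ∎
powerSum-newton {X} (z ∷ zs) (suc m) = begin
  conv (powerSum (z ∷ zs)) H (suc m)
    ≈⟨ conv-complete-∷ z zs (powerSum (z ∷ zs)) m ⟩
  v * conv (powerSum (z ∷ zs)) H m + conv (powerSum (z ∷ zs)) H′ (suc m)
    ≈⟨ +-cong (*-congʳ (powerSum-newton (z ∷ zs) m)) (conv-+ (λ k → v ^ suc k) (powerSum zs) H′ (suc m)) ⟩
  v * (nat (suc m) * H (suc m)) + (conv (λ k → v ^ suc k) H′ (suc m) + conv (powerSum zs) H′ (suc m))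
    ≈⟨ +-congʳ (+-cong (conv-geometric z zs (suc m)) (powerSum-newton zs (suc m))) ⟩
  v * (nat (suc m) * H (suc m)) + (v * H (suc m) + nat (2 ℕ.+ m) * H′ (2 ℕ.+ m))
    ≈⟨ +-congʳ (+-congʳ (*-congˡ (nat-suc (suc m)))) ⟩
  v * (nat (suc m) * H (suc m)) + (v * H (suc m) + (con 1ℚ + nat (suc m)) * H′ (2 ℕ.+ m))
    ≈⟨ solve 4 (λ v n H H′ → v :* (n :* H) :+ (v :* H :+ (:con 1ℚ :+ n) :* H′) := (:con 1ℚ :+ n) :* (v :* H :+ H′))
         ≈-refl v (nat (suc m)) (H (suc m)) (H′ (2 ℕ.+ m)) ⟩
  (con 1ℚ + nat (suc m)) * H (2 ℕ.+ m)
    ≈⟨ *-congˡ (nat-suc (suc m)) ⟨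
  nat (2 ℕ.+ m) * H (2 ℕ.+ m) ∎
  where
  v = var z
  H H′ : ℕ → ℚ[ X ]
  H r  = complete r (z ∷ zs)
  H′ r = complete r zs

powerSum-tabulate : ∀ {N} (f : Fin N → X) m → powerSum (List.tabulate f) m ≡ sum (λ i → var (f i) ^ suc m)
powerSum-tabulate {N = zero}  f m = refl
powerSum-tabulate {N = suc N} f m = ≡.cong (var (f zero) ^ suc m +_) (powerSum-tabulate (f ∘ suc) m)

restrict-h : ∀ N r → restrict N (h r) ≡ complete r (allFin N)
restrict-h N zero    = refl
restrict-h N (suc r) = refl

-- Both sides solve Newton's identities for the same series `H`, whose constant term is 1.
restrict-𝓅 : ∀ N m → restrict N (𝓅 m) ≈ sum (λ (i : Fin N) → var i ^ suc m)
restrict-𝓅 N m = ≈-trans (conv-cancel {b = H} ≈-refl step m) (≡⇒≈ (powerSum-tabulate id m))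
  where
  H = λ r → complete r (allFin N)
  step : ∀ m → conv (restrict N ∘ 𝓅) H m ≈ conv (powerSum (allFin N)) H m
  step m = begin
    conv (restrict N ∘ 𝓅) H m                   ≈⟨ conv-cong (λ _ → ≈-refl) (λ r → ≡⇒≈ (restrict-h N r)) m ⟨
    conv (restrict N ∘ 𝓅) (restrict N ∘ h) m    ≡⟨ substitute-conv _ 𝓅 h m ⟨
    restrict N (conv 𝓅 h m)                     ≈⟨ substitute-cong _ (𝓅-newton m) ⟩
    nat (suc m) * H (suc m)                     ≈⟨ powerSum-newton (allFin N) m ⟨
    conv (powerSum (allFin N)) H m              ∎

-- Change of generators. A list r₁, …, r_l stands for the partition with parts rᵢ + 1.

weight : List ℕ → ℕ
weight rs = ListAction.sum (List.map suc rs)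

Monomial : (ℕ → ℚ[ X ]) → Pred ℚ[ X ] 0ℓ
Monomial g f = ∃ λ rs → f ≡ mon g rs

MonomialOfWeight : ℕ → (ℕ → ℚ[ X ]) → Pred ℚ[ X ] 0ℓ
MonomialOfWeight n g f = ∃ λ rs → weight rs ≡ n × f ≡ mon g rs

reweigh : ∀ {m n} {g : ℕ → ℚ[ X ]} {f} → m ≡ n →
          Span (MonomialOfWeight m g) f → Span (MonomialOfWeight n g) f
reweigh refl p = p

Span-nat⁻¹ : {S : Pred ℚ[ X ] 0ℓ} → ∀ n {f} → Span S (nat (suc n) * f) → Span S f
Span-nat⁻¹ n {f} p = resp
  (≈-trans (≈-sym (*-assoc _ _ f))
  (≈-trans (*-congˡ (≈-trans (≈-sym (con-* c⁻¹ c)) (≡⇒≈ (≡.cong con (ℚ.*-inverseˡ c))))) (*-identityˡ f)))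
  (c⁻¹ ·∈ p)
  where
  c = ν (suc n)
  instance
    c-nonZero : ℚ.NonZero c
    c-nonZero = ℚ.≢-nonZero (ν-suc≢0 n)
  c⁻¹ = ℚ.1/ c

module _ {g : ℕ → ℚ[ X ]} where

  Span-weight : ℕ → Pred ℚ[ X ] 0ℓ
  Span-weight n = Span (MonomialOfWeight n g)

  weight-* : ∀ {m n f f′} → Span-weight m f → Span-weight n f′ → Span-weight (m ℕ.+ n) (f * f′)
  weight-* = Span-* λ where
    (rs , refl , refl) (ss , refl , refl) → resp (mon-++ g rs ss)
      (gen (rs ++ ss , ≡.trans (≡.cong ListAction.sum (List.map-++ suc rs ss))
         (ListAction.sum-++ (List.map suc rs) (List.map suc ss)) , refl))

  weight-1 : Span-weight 0 (con 1ℚ)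
  weight-1 = gen ([] , refl , refl)

  weight-gen : ∀ r → Span-weight (suc r) (g r)
  weight-gen r = resp (P.*-identityʳ _) (gen (r ∷ [] , ℕ.+-identityʳ (suc r) , refl))

  -- The recursion of `conv` shifts `a`, so the weight `d` of its leading entry has to vary. The
  -- condition on `b` stops at `m` because `h-weight` applies this inside a complete induction.
  conv-weight : ∀ m d {a b : ℕ → ℚ[ X ]} → (∀ k → Span-weight (d ℕ.+ k) (a k)) →
                (∀ k → k ≤ m → Span-weight k (b k)) → Span-weight (d ℕ.+ m) (conv a b m)
  conv-weight zero    d {a} {b} A B =
    reweigh (ℕ.+-identityʳ _) (weight-* (A 0) (B 0 z≤n))
  conv-weight (suc m) d {a} {b} A B =
    reweigh (≡.cong (ℕ._+ suc m) (ℕ.+-identityʳ d)) (weight-* (A 0) (B (suc m) ℕ.≤-refl))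
    +∈ reweigh (≡.sym (ℕ.+-suc d m))
       (conv-weight m (suc d) (λ k → reweigh (ℕ.+-suc d k) (A (suc k)))
                    (λ k k≤m → B k (ℕ.m≤n⇒m≤1+n k≤m)))

  mon-weight : ∀ {g′ : ℕ → ℚ[ X ]} → (∀ r → Span-weight (suc r) (g′ r)) →
               ∀ rs → Span-weight (weight rs) (mon g′ rs)
  mon-weight G []       = weight-1
  mon-weight G (r ∷ rs) = weight-* (G r) (mon-weight G rs)

change-generators : ∀ {g g′ : ℕ → ℚ[ X ]} → (∀ r → Span (MonomialOfWeight (suc r) g′) (g r)) →
                    ∀ {n f} → Span (MonomialOfWeight n g) f → Span (MonomialOfWeight n g′) f
change-generators {g = g} {g′} G = Span-⊆ λ where
  (rs , refl , refl) → mon-weight {g = g′} {g} G rs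

module _ {p : ℕ → Λ} (p-newton : Newton p h) where

  -- Newton's identity gives (k+1) h_{k+1} in terms of power sums and h₀, ..., h_k; division by k+1
  -- uses the rational coefficients. `m` bounds the complete induction.
  h-weight : ∀ m k → k ≤ m → Span (MonomialOfWeight k p) (h k)
  h-weight m       zero    _         = weight-1 {g = p}
  h-weight (suc m) (suc k) (s≤s k≤m) = Span-nat⁻¹ k (resp (p-newton k)
    (conv-weight {g = p} k 1 (weight-gen {g = p}) (λ j j≤k → h-weight m j (ℕ.≤-trans j≤k k≤m))))

  newton-unique : ∀ m → 𝓅 m ≈ p m
  newton-unique = conv-cancel {b = h} ≈-refl (λ m → ≈-trans (𝓅-newton m) (≈-sym (p-newton m)))

  h⇒p : ∀ {n f} → Span (MonomialOfWeight n var) f → Span (MonomialOfWeight n p) f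
  h⇒p = change-generators {g = var} {p} (λ r → h-weight (suc r) (suc r) ℕ.≤-refl)

  p⇒h : ∀ {n f} → Span (MonomialOfWeight n p) f → Span (MonomialOfWeight n var) f
  p⇒h = change-generators {g = p} {var} (λ r → resp (newton-unique r) (series/h-weight r 1 _
    (λ k → ν (suc k) ·∈ weight-gen {g = var} k)))
    where
    -- One step of the long division drops the leading coefficient, of weight `d`, and leaves a
    -- series whose leading coefficient has weight `d + 1`.
    series/h-weight : ∀ m d s → (∀ k → Span (MonomialOfWeight (d ℕ.+ k) var) (s k)) →
                      Span (MonomialOfWeight (d ℕ.+ m) var) (series/h m s)
    series/h-weight zero    d s S = S 0
    series/h-weight (suc m) d s S = reweigh (≡.sym (ℕ.+-suc d m))
      (series/h-weight m (suc d) _ λ k →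
        reweigh (ℕ.+-suc d k) (S (suc k)) +∈
        Span-neg (reweigh
          (≡.trans (≡.cong (ℕ._+ suc k) (ℕ.+-identityʳ d)) (ℕ.+-suc d k))
          (weight-* {g = var} (S 0) (weight-gen {g = var} k))))

  p-spans : ∀ f → Span (Monomial p) f
  p-spans (con c) = resp (P.*-identityʳ _) (c ·∈ gen ([] , refl))
  p-spans (var r) = Span-⊆ (λ (rs , _ , e) → gen (rs , e)) (h-weight (suc r) (suc r) ℕ.≤-refl)
  p-spans (f + g) = p-spans f +∈ p-spans g
  p-spans (f * g) = Span-* (λ where
    (rs , refl) (ss , refl) → resp (mon-++ p rs ss) (gen (rs ++ ss , refl))) (p-spans f) (p-spans g)
  p-spans (- f)   = Span-neg (p-spans f)

-- Taylor coefficients along a derivation.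

module Derivation {d : ℚ[ X ] → ℚ[ X ]} (d-linear : Linear d)
  (leibniz : ∀ f g → d (f * g) ≈ d f * g + f * d g) where

  dᵏ⁺¹-v* : ∀ {v} → d v ≈ con 1ℚ → ∀ k f → fold (v * f) d (suc k) ≈ nat (suc k) * fold f d k + v * fold f d (suc k)
  dᵏ⁺¹-v* {v} dv≈1 zero    f = ≈-trans (leibniz v f) (+-congˡ (*-congˡ dv≈1))
  dᵏ⁺¹-v* {v} dv≈1 (suc k) f = begin
    d (fold (v * f) d (suc k))
      ≈⟨ cong d-linear (dᵏ⁺¹-v* dv≈1 k f) ⟩
    d (nat (suc k) * f₀ + v * f₁)
      ≈⟨ ≈-trans (+-homo d-linear _ _) (+-cong (·-homo d-linear _ _) (leibniz v f₁)) ⟩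
    nat (suc k) * f₁ + (d v * f₁ + v * f₂)
      ≈⟨ +-congʳ (+-congˡ (*-congˡ dv≈1)) ⟩
    nat (suc k) * f₁ + (con 1ℚ * f₁ + v * f₂)
      ≈⟨ solve 4 (λ n f₁ v f₂ → n :* f₁ :+ (:con 1ℚ :* f₁ :+ v :* f₂) := (:con 1ℚ :+ n) :* f₁ :+ v :* f₂)
           ≈-refl (nat (suc k)) f₁ v f₂ ⟩
    (con 1ℚ + nat (suc k)) * f₁ + v * f₂
      ≈⟨ +-congˡ (*-congˡ (nat-suc (suc k))) ⟨
    nat (2 ℕ.+ k) * f₁ + v * f₂ ∎
    where
    f₀ = fold f d k
    f₁ = d f₀
    f₂ = d f₁

  dᵏ⁺¹-const : ∀ {g} → d g ≈ con 0ℚ → ∀ k → fold g d (suc k) ≈ con 0ℚ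
  dᵏ⁺¹-const dg≈0 zero    = dg≈0
  dᵏ⁺¹-const dg≈0 (suc k) = ≈-trans (cong d-linear (dᵏ⁺¹-const dg≈0 k)) (0-homo d-linear)

  dᵏ-const* : ∀ {g} → d g ≈ con 0ℚ → ∀ k f → fold (g * f) d k ≈ g * fold f d k
  dᵏ-const*     dg≈0 zero    f = ≈-refl
  dᵏ-const* {g} dg≈0 (suc k) f = begin
    d (fold (g * f) d k)                   ≈⟨ cong d-linear (dᵏ-const* dg≈0 k f) ⟩
    d (g * fold f d k)                     ≈⟨ leibniz g _ ⟩
    d g * fold f d k + g * fold f d (suc k) ≈⟨ +-congˡ (≈-trans (*-congˡ dg≈0) (P.zeroˡ _)) ⟩
    con 0ℚ + g * fold f d (suc k)          ≈⟨ +-identityˡ _ ⟩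
    g * fold f d (suc k)                   ∎

-- Here `d` plays the partial derivative in the direction of `v`, and `τ` sets `v` to 0, possibly
-- passing to other variables. This is applied to a first variable z₁ and to δ.
module Taylor {d : ℚ[ X ] → ℚ[ X ]} (d-linear : Linear d) (leibniz : ∀ f g → d (f * g) ≈ d f * g + f * d g)
  (τ : X → ℚ[ Y ]) {v : ℚ[ X ]} (dv≈1 : d v ≈ con 1ℚ) (τv≈0 : substitute τ v ≈ con 0ℚ) where

  open Derivation d-linear leibniz

  abstract

    -- k! times the coefficient of vᵏ
    T : ℕ → ℚ[ X ] → ℚ[ Y ]
    T k f = substitute τ (fold f d k)

    T-linear : ∀ k → Linear (T k)
    T-linear k = ∘-linear (substitute-linear τ) (fold-linear d-linear k)

    T₀ : ∀ f → T 0 f ≈ substitute τ f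
    T₀ f = ≈-refl

    Tᵏ⁺¹-v* : ∀ k f → T (suc k) (v * f) ≈ nat (suc k) * T k f
    Tᵏ⁺¹-v* k f = begin
      T (suc k) (v * f)                                   ≈⟨ substitute-cong τ (dᵏ⁺¹-v* dv≈1 k f) ⟩
      nat (suc k) * T k f + substitute τ v * T (suc k) f  ≈⟨ +-congʳ (≈-trans (*-congˡ τv≈0) (P.zeroˡ _)) ⟩
      nat (suc k) * T k f + con 0ℚ                        ≈⟨ P.+-identityʳ _ ⟩
      nat (suc k) * T k f                                 ∎

    T-const* : ∀ {g} → d g ≈ con 0ℚ → ∀ k f → T k (g * f) ≈ substitute τ g * T k f
    T-const* dg≈0 k f = substitute-cong τ (dᵏ-const* dg≈0 k f)

    Tᵏ⁺¹-const : ∀ {g} → d g ≈ con 0ℚ → ∀ k → T (suc k) g ≈ con 0ℚ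
    Tᵏ⁺¹-const {g} dg≈0 k = substitute-cong τ {fold g d (suc k)} (dᵏ⁺¹-const dg≈0 k)

  T₀-v* : ∀ f → T 0 (v * f) ≈ con 0ℚ
  T₀-v* f = ≈-trans (T₀ (v * f)) (≈-trans (*-congˡ τv≈0) (P.zeroˡ _))

  T-vʲ*-> : ∀ {k j} → k < j → ∀ f → T k (v ^ j * f) ≈ con 0ℚ
  T-vʲ*-> {zero}  {suc j} k<j       f = ≈-trans (cong (T-linear 0) (*-assoc v (v ^ j) f)) (T₀-v* (v ^ j * f))
  T-vʲ*-> {suc k} {suc j} (s≤s k<j) f = begin
    T (suc k) (v * v ^ j * f)          ≈⟨ cong (T-linear (suc k)) (*-assoc v (v ^ j) f) ⟩
    T (suc k) (v * (v ^ j * f))        ≈⟨ Tᵏ⁺¹-v* k (v ^ j * f) ⟩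
    nat (suc k) * T k (v ^ j * f)      ≈⟨ *-congʳ (T-vʲ*-> k<j f) ⟩
    nat (suc k) * con 0ℚ               ≈⟨ P.zeroʳ _ ⟩
    con 0ℚ                             ∎

  -- The factor is (j + t)!/t!. Only its being nonzero matters, so it is produced as a successor.
  T-vʲ* : ∀ j t → ∃ λ c → ∀ f → T (j ℕ.+ t) (v ^ j * f) ≈ nat (suc c) * T t f
  T-vʲ* zero    t = 0 , λ f → ≈-trans (cong (T-linear t) (*-identityˡ f)) (≈-sym (*-identityˡ _))
  T-vʲ* (suc j) t with T-vʲ* j t
  ... | c , e = c ℕ.+ (j ℕ.+ t) ℕ.* suc c , λ f → begin
    T (suc (j ℕ.+ t)) (v * v ^ j * f)                 ≈⟨ cong (T-linear (suc (j ℕ.+ t))) (*-assoc v (v ^ j) f) ⟩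
    T (suc (j ℕ.+ t)) (v * (v ^ j * f))               ≈⟨ Tᵏ⁺¹-v* (j ℕ.+ t) (v ^ j * f) ⟩
    nat (suc (j ℕ.+ t)) * T (j ℕ.+ t) (v ^ j * f)     ≈⟨ *-congʳ (e f) ⟩
    nat (suc (j ℕ.+ t)) * (nat (suc c) * T t f)       ≈⟨ *-assoc _ _ _ ⟨
    nat (suc (j ℕ.+ t)) * nat (suc c) * T t f         ≈⟨ *-congˡ (nat-* (suc (j ℕ.+ t)) (suc c)) ⟨
    nat (suc (j ℕ.+ t) ℕ.* suc c) * T t f             ∎

∂-linear : ∀ {n} (i : Fin n) → Linear (∂ i)
∂-linear i = record
  { cong   = ∂-cong i
  ; +-homo = λ _ _ → ≈-refl
  ; ·-homo = λ c f → ≈-trans (+-congˡ (P.zeroˡ f)) (+-identityˡ _) }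

-- Coefficients of products of power sums in N variables.

𝓅[_] : ∀ N → ℕ → ℚ[ Fin N ]
𝓅[ N ] r = sum (λ (i : Fin N) → var i ^ suc r)

drop₀ : ∀ {N} → Fin (suc N) → ℚ[ Fin N ]
drop₀ zero    = con 0ℚ
drop₀ (suc i) = var i

module _ {N : ℕ} where

  open Taylor (∂-linear {suc N} zero) (λ _ _ → ≈-refl) drop₀ {var zero} ≈-refl ≈-refl public

  ∂₀-tail : ∀ {n} (f : Fin n → Fin N) m → ∂ zero (sum (λ i → var (suc (f i)) ^ m)) ≈ con 0ℚ
  ∂₀-tail {zero}  f m = ≈-refl
  ∂₀-tail {suc n} f m = ≈-trans (+-cong (power m) (∂₀-tail (f ∘ suc) m)) (+-identityˡ _)
    where
    power : ∀ m → ∂ zero (var (suc (f zero)) ^ m) ≈ con 0ℚ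
    power zero    = ≈-refl
    power (suc m) = ≈-trans (+-cong (P.zeroˡ _) (≈-trans (*-congʳ (power m)) (P.zeroʳ _))) (+-identityˡ _)

  drop₀-tail : ∀ {n} (f : Fin n → Fin N) m →
               substitute drop₀ (sum (λ i → var (suc (f i)) ^ m)) ≡ sum (λ i → var (f i) ^ m)
  drop₀-tail {zero}  f m = refl
  drop₀-tail {suc n} f m = ≡.cong₂ _+_ (power m) (drop₀-tail (f ∘ suc) m)
    where
    power : ∀ m → substitute drop₀ (var (suc (f zero)) ^ m) ≡ var (f zero) ^ m
    power zero    = refl
    power (suc m) = ≡.cong (var (f zero) *_) (power m)

  -- The power sum is z₁^{r+1} plus a sum free of z₁, and `T k` treats the latter as a constant.
  T-𝓅 : ∀ k r rs → T k (mon 𝓅[ suc N ] (r ∷ rs)) ≈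
        T k (var zero ^ suc r * mon 𝓅[ suc N ] rs) + 𝓅[ N ] r * T k (mon 𝓅[ suc N ] rs)
  T-𝓅 k r rs = begin
    T k ((v + s) * M)                         ≈⟨ cong (T-linear k) (P.distribʳ M v s) ⟩
    T k (v * M + s * M)                       ≈⟨ +-homo (T-linear k) (v * M) (s * M) ⟩
    T k (v * M) + T k (s * M)                 ≈⟨ +-congʳ (T-const* (∂₀-tail id (suc r)) k M) ⟩
    T k (v * M) + substitute drop₀ s * T k M  ≈⟨ +-congʳ (*-congˡ (≡⇒≈ (drop₀-tail id (suc r)))) ⟩
    T k (v * M) + 𝓅[ N ] r * T k M            ∎
    where
    v = var zero ^ suc r
    s = sum (λ (i : Fin N) → var (suc i) ^ suc r)
    M = mon 𝓅[ suc N ] rs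

  T₀-𝓅 : ∀ rs → T 0 (mon 𝓅[ suc N ] rs) ≈ mon 𝓅[ N ] rs
  T₀-𝓅 []       = T₀ (con 1ℚ)
  T₀-𝓅 (r ∷ rs) = ≈-trans (T-𝓅 0 r rs)
    (≈-trans (+-cong (T-vʲ*-> {j = suc r} (s≤s z≤n) (mon 𝓅[ suc N ] rs)) (*-congʳ (T₀-𝓅 rs))) (+-identityˡ _))

Shorter : ∀ N → ℕ → Pred ℚ[ Fin N ] 0ℓ
Shorter N n f = ∃ λ rs → length rs < n × f ≡ mon 𝓅[ N ] rs

Shorter-mono : ∀ {N m n} → m ≤ n → ∀ {f} → Span (Shorter N m) f → Span (Shorter N n) f
Shorter-mono m≤n = Span-⊆ λ (rs , b , e) → gen (rs , ℕ.≤-trans b m≤n , e)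

Shorter-* : ∀ {N n} r {f} → Span (Shorter N n) f → Span (Shorter N (suc n)) (𝓅[ N ] r * f)
Shorter-* r = Span-map (*-linear _) λ where (rs , b , refl) → gen (r ∷ rs , s≤s b , refl)

-- A positive power of z₁ has to be taken from at least one factor, and that factor contributes
-- nothing else.
T-shortens : ∀ {N} k rs → Span (Shorter N (length rs)) (T (suc k) (mon 𝓅[ suc N ] rs))
T-shortens {N} k [] = resp (≈-sym (Tᵏ⁺¹-const ≈-refl k)) 0∈
T-shortens {N} k (r ∷ rs) = resp (≈-sym (T-𝓅 (suc k) r rs)) (first +∈ Shorter-* r (T-shortens k rs))
  where
  M = mon 𝓅[ suc N ] rs
  first : Span (Shorter N (suc (length rs))) (T (suc k) (var zero ^ suc r * M))
  first with ℕ.<-≤-connex (suc k) (suc r)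
  ... | inj₁ k<r = resp (≈-sym (T-vʲ*-> {j = suc r} k<r M)) 0∈
  ... | inj₂ r≤k with ℕ.m≤n⇒∃[o]m+o≡n r≤k
  ... | t , refl with T-vʲ* {N} (suc r) t
  ... | c , e = resp (≈-sym (e M)) (ν (suc c) ·∈ T-M t)
    where
    T-M : ∀ t → Span (Shorter N (suc (length rs))) (T t M)
    -- For `t = 0` the head alone has supplied the power of z₁, and what remains is the product over
    -- `rs`, one factor shorter than the original.
    T-M zero    = resp (≈-sym (T₀-𝓅 rs)) (gen (rs , ℕ.≤-refl , refl))
    T-M (suc t) = Shorter-mono (ℕ.n≤1+n _) (T-shortens t rs)

Shorter-*-pred : ∀ {N} n r {f} → Span (Shorter N (ℕ.pred n)) f → Span (Shorter N n) (𝓅[ N ] r * f)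
Shorter-*-pred zero    r = Shorter-mono z≤n ∘ Span-map (*-linear _) λ where (_ , () , _)
Shorter-*-pred (suc n) r = Shorter-* r

-- If r > k, the power of z₁ is already too high. If r < k, another factor has to supply the missing
-- power, so that two factors are lost.
T-head-≢ : ∀ {N} {k r} rs → r ≢ k →
           Span (Shorter N (length rs)) (T (suc k) (var zero ^ suc r * mon 𝓅[ suc N ] rs))
T-head-≢ {N} {k} {r} rs r≢k with ℕ.<-cmp k r
... | tri< k<r _ _ = resp (≈-sym (T-vʲ*-> {j = suc r} (s≤s k<r) (mon 𝓅[ suc N ] rs))) 0∈
... | tri≈ _ k≡r _ = ⊥-elim (r≢k (≡.sym k≡r))
... | tri> _ _ r<k with ℕ.m≤n⇒∃[o]m+o≡n r<k
... | t , refl with T-vʲ* {N} (suc r) (suc t)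
...   | c , e = resp (≈-trans (≈-sym (e M)) (≡⇒≈ (≡.cong (λ n → T n (var zero ^ suc r * M)) (ℕ.+-suc (suc r) t))))
                   (ν (suc c) ·∈ T-shortens t rs)
  where M = mon 𝓅[ suc N ] rs

T-head-≡ : ∀ {N} k → ∃ λ c → ∀ rs →
           T (suc k) (var zero ^ suc k * mon 𝓅[ suc N ] rs) ≈ nat (suc c) * mon 𝓅[ N ] rs
T-head-≡ {N} k with T-vʲ* {N} (suc k) 0
... | c , e = c , λ rs →
    ≈-trans (≡⇒≈ (≡.cong (λ n → T n (var zero ^ suc k * mon 𝓅[ suc N ] rs)) (≡.sym (ℕ.+-identityʳ (suc k)))))
                         (≈-trans (e (mon 𝓅[ suc N ] rs)) (*-congʳ (T₀-𝓅 rs)))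

-- T (k + 1) acts on products of power sums as the derivation ∂/∂p_{k+1} (up to a
-- factor), modulo products that are shorter by 2 or more.
data Derivative N k rs : Set where
  absent  : ¬ k ∈ rs → Span (Shorter N (ℕ.pred (length rs))) (T (suc k) (mon 𝓅[ suc N ] rs)) →
            Derivative N k rs
  present : ∀ rs′ c → rs ↭ k ∷ rs′ →
            Span (Shorter N (ℕ.pred (length rs))) (T (suc k) (mon 𝓅[ suc N ] rs) - nat (suc c) * mon 𝓅[ N ] rs′) →
            Derivative N k rs

-- The product rule, by induction on the list: the head contributes a main term exactly if r = k.
-- Contributions of equal factors add up, and as all of them are positive the multiplicity cannot
-- cancel.
derivative : ∀ N k rs → Derivative N k rs
derivative N k [] = absent (λ ()) (T-shortens k [])
derivative N k (r ∷ rs) with r ℕ.≟ k | derivative N k rs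
... | no r≢k | absent k∉rs S = absent (λ { (here k≡r) → r≢k (≡.sym k≡r) ; (there k∈rs) → k∉rs k∈rs })
  (resp (≈-sym (T-𝓅 (suc k) r rs)) (T-head-≢ rs r≢k +∈ Shorter-*-pred (length rs) r S))
... | no r≢k | present rs′ c p S = present (r ∷ rs′) c (↭-trans (prep r p) (swap r k ↭-refl))
  (resp (≈-sym (≈-trans (+-congˡ (T-𝓅 (suc k) r rs))
     (solve 5 (λ t p s n m → (t :+ p :* s) :+ :- (n :* (p :* m)) := t :+ p :* (s :+ :- (n :* m))) ≈-refl
        (T (suc k) (var zero ^ suc r * M)) (𝓅[ N ] r) (T (suc k) M) (nat (suc c)) (mon 𝓅[ N ] rs′))))
    (T-head-≢ rs r≢k +∈ Shorter-*-pred (length rs) r S))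
  where M = mon 𝓅[ suc N ] rs
... | yes refl | absent k∉rs S with T-head-≡ {N} k
... | c , e = present rs c ↭-refl
  (resp (≈-sym (≈-trans (+-congˡ (≈-trans (T-𝓅 (suc k) k rs) (+-congˡ (e rs))))
     (solve 2 (λ a b → (a :+ b) :+ :- a := b) ≈-refl
        (nat (suc c) * mon 𝓅[ N ] rs) (𝓅[ N ] k * T (suc k) (mon 𝓅[ suc N ] rs)))))
    (Shorter-*-pred (length rs) k S))
derivative N k (r ∷ rs) | yes refl | present rs′ c p S with T-head-≡ {N} k
... | c′ , e = present rs (c′ ℕ.+ suc c) ↭-refl
  (resp (≈-sym (≈-trans (+-cong (≈-trans (T-𝓅 (suc k) k rs) (+-congˡ (e rs)))
                                (-‿cong (*-cong (nat-+ (suc c′) (suc c)) (mon-↭ 𝓅[ N ] p))))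
     (≈-trans (+-congˡ (+-congˡ (*-congʳ (mon-↭ 𝓅[ N ] p))))
     (solve 5 (λ a b p m t → (a :* (p :* m) :+ p :* t) :+ :- ((a :+ b) :* (p :* m)) := p :* (t :+ :- (b :* m))) ≈-refl
        (nat (suc c′)) (nat (suc c)) (𝓅[ N ] k) (mon 𝓅[ N ] rs′) (T (suc k) (mon 𝓅[ suc N ] rs))))))
    (Shorter-*-pred (length rs) k S))

-- A multiple of the coefficient of z₁^{k₁+1} ⋯ z_N^{k_N+1}, as a constant.
coefficientAt : ∀ ks → ℚ[ Fin (length ks) ] → Λ
coefficientAt []       = substitute λ ()
coefficientAt (k ∷ ks) = coefficientAt ks ∘ T (suc k)

coefficientAt-linear : ∀ ks → Linear (coefficientAt ks)
coefficientAt-linear []       = substitute-linear _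
coefficientAt-linear (k ∷ ks) = ∘-linear (coefficientAt-linear ks) (T-linear (suc k))

-- Every variable consumes at least one factor, so fewer factors than variables cannot produce the
-- monomial.
coefficientAt-short : ∀ ks {f} → Span (Shorter (length ks) (length ks)) f → coefficientAt ks f ≈ con 0ℚ
coefficientAt-short ks = Span-vanish (coefficientAt-linear ks) λ where (rs , b , refl) → short ks rs b
  where
  short : ∀ ks rs → length rs < length ks → coefficientAt ks (mon 𝓅[ length ks ] rs) ≈ con 0ℚ
  short (k ∷ ks) rs (s≤s b) = coefficientAt-short ks (Shorter-mono b (T-shortens k rs))

-- Every variable needs a factor of its own. With no more factors than variables, losing two factors
-- to one variable leaves too few for the others, so the error terms in `Derivative` vanish and each
-- variable must match one factor exactly.
coefficientAt-𝓅 : ∀ ks rs → length rs ≤ length ks →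
  (ks ↭ rs × ∃ λ c → coefficientAt ks (mon 𝓅[ length ks ] rs) ≈ nat (suc c)) ⊎
  (¬ (ks ↭ rs) × coefficientAt ks (mon 𝓅[ length ks ] rs) ≈ con 0ℚ)
coefficientAt-𝓅 []       []  b = inj₁ (↭-refl , 0 , ≈-refl)
coefficientAt-𝓅 (k ∷ ks) rs b with derivative (length ks) k rs
... | absent k∉rs S = inj₂ ((λ p → k∉rs (↭.∈-resp-↭ p (here refl))) ,
  coefficientAt-short ks (Shorter-mono (ℕ.pred-mono-≤ b) S))
... | present rs′ c p S = step (coefficientAt-𝓅 ks rs′ (ℕ.≤-pred (≡.subst (_≤ _) (↭.↭-length p) b)))
  where
  φ  = coefficientAt-linear ks
  M  = mon 𝓅[ suc (length ks) ] rs
  M′ = mon 𝓅[ length ks ] rs′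
  e : coefficientAt (k ∷ ks) M ≈ nat (suc c) * coefficientAt ks M′
  e = begin
    coefficientAt ks (T (suc k) M)
      ≈⟨ cong φ (solve 2 (λ a b → a := b :+ (a :+ :- b)) ≈-refl (T (suc k) M) (nat (suc c) * M′)) ⟩
    coefficientAt ks (nat (suc c) * M′ + (T (suc k) M - nat (suc c) * M′))
      ≈⟨ +-homo φ _ _ ⟩
    coefficientAt ks (nat (suc c) * M′) + coefficientAt ks (T (suc k) M - nat (suc c) * M′)
      ≈⟨ +-cong (·-homo φ _ M′) (coefficientAt-short ks (Shorter-mono (ℕ.pred-mono-≤ b) S)) ⟩
    nat (suc c) * coefficientAt ks M′ + con 0ℚ
      ≈⟨ P.+-identityʳ _ ⟩
    nat (suc c) * coefficientAt ks M′ ∎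
  step : _ → _
  step (inj₁ (q , c′ , e′)) = inj₁ (↭-trans (prep k q) (↭-sym p) , c′ ℕ.+ c ℕ.* suc c′ ,
    ≈-trans e (≈-trans (*-congʳ e′) (≈-sym (nat-* (suc c) (suc c′)))))
  step (inj₂ (¬q , e′)) = inj₂ ((λ q → ¬q (↭.drop-∷ (↭-trans q p))) ,
    ≈-trans e (≈-trans (*-congʳ e′) (P.zeroʳ _)))

-- Sorting, and linear independence of the products of power sums.

≥-decTotalOrder : DecTotalOrder 0ℓ 0ℓ 0ℓ
≥-decTotalOrder = Flip.decTotalOrder ℕ.≤-decTotalOrder

open import Data.List.Sort ≥-decTotalOrder using (sort; sort-↭; sort-↗)

decreasing-unique : ∀ {rs ss} → Linked _≥_ rs → Linked _≥_ ss → rs ↭ ss → rs ≡ ss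
decreasing-unique r s p = Pointwise.Pointwise-≡⇒≡
  (Sorted.↗↭↗⇒≋ (DecTotalOrder.totalOrder ≥-decTotalOrder) r s (↭⇒↭ₛ p))

_↭?_ : ∀ (rs ss : List ℕ) → Dec (rs ↭ ss)
rs ↭? ss = map′
  (λ e → ↭-trans (↭-sym (sort-↭ rs)) (↭-trans (↭-reflexive e) (sort-↭ ss)))
  (λ p → decreasing-unique (sort-↗ rs) (sort-↗ ss) (↭-trans (sort-↭ rs) (↭-trans p (↭-sym (sort-↭ ss)))))
  (List.≡-dec ℕ._≟_ (sort rs) (sort ss))

IsPowerSums : (ℕ → Λ) → Set
IsPowerSums p = ∀ N r → restrict N (p r) ≈ 𝓅[ N ] r

module _ {p : ℕ → Λ} (p-powerSums : IsPowerSums p) where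
  private
    Φ : List ℕ → List ℕ → Λ
    Φ ks rs = coefficientAt ks (mon 𝓅[ length ks ] rs)

    Φ-zero : ∀ ks rs → length rs ≤ length ks → ¬ (ks ↭ rs) → Φ ks rs ≈ con 0ℚ
    Φ-zero ks rs b ks↭̸rs with coefficientAt-𝓅 ks rs b
    ... | inj₁ (ks↭rs , _) = ⊥-elim (ks↭̸rs ks↭rs)
    ... | inj₂ (_ , e)     = e

    Φ-unit : ∀ ks → ∃ λ c → c ≢ 0ℚ × Φ ks ks ≈ con c
    Φ-unit ks with coefficientAt-𝓅 ks ks ℕ.≤-refl
    ... | inj₁ (_ , c , e)   = ν (suc c) , ν-suc≢0 c , e
    ... | inj₂ (ks↭̸ks , _) = ⊥-elim (ks↭̸ks ↭-refl)

    open module Monomials = Triangular _↭_ _↭?_ ↭-refl length Φ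
      (λ ks q → cong (coefficientAt-linear ks) (mon-↭ 𝓅[ length ks ] q)) Φ-zero Φ-unit

  restrict-mon : ∀ N rs → restrict N (mon p rs) ≈ mon 𝓅[ N ] rs
  restrict-mon N rs = ≈-trans (≡⇒≈ (substitute-mon _ p rs)) (mon-cong (p-powerSums N) rs)

  -- All `N` occur in the hypothesis because the coefficient belonging to `ks` is read off in
  -- `length ks` variables.
  monomials-independent : ∀ L → (∀ N → restrict N (eval (mon p) L) ≈ con 0ℚ) →
    (g : List ℕ → ℚ[ Y ]) → (∀ {rs ss} → rs ↭ ss → g rs ≈ g ss) → eval g L ≈ con 0ℚ
  monomials-independent L e = vanish L λ ks → begin
    eval (Φ ks) L
      ≈⟨ eval-map (coefficientAt-linear ks) (mon 𝓅[ length ks ]) L ⟨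
    coefficientAt ks (eval (mon 𝓅[ length ks ]) L)
      ≈⟨ cong (coefficientAt-linear ks) (eval-cong (restrict-mon (length ks)) L) ⟨
    coefficientAt ks (eval (restrict (length ks) ∘ mon p) L)
      ≈⟨ cong (coefficientAt-linear ks) (eval-map (substitute-linear _) (mon p) L) ⟨
    coefficientAt ks (restrict (length ks) (eval (mon p) L))
      ≈⟨ cong (coefficientAt-linear ks) (e (length ks)) ⟩
    coefficientAt ks (con 0ℚ)
      ≈⟨ 0-homo (coefficientAt-linear ks) ⟩
    con 0ℚ ∎

-- Expand `f` in products of the `𝓅 r`, whose restrictions are known, and take these products
-- themselves as the test family.
restrict-injective : ∀ f → (∀ N → restrict N f ≈ con 0ℚ) → f ≈ con 0ℚ
restrict-injective f e with Span⇒Combination {g = mon 𝓅} id (p-spans 𝓅-newton f)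
... | L , f≈L = ≈-trans f≈L (monomials-independent {p = 𝓅} restrict-𝓅 L
  (λ N → ≈-trans (substitute-cong _ (≈-sym f≈L)) (e N)) (mon 𝓅) (mon-↭ 𝓅))

-- The given family has the same restrictions as `𝓅`, hence equals it and inherits its identities.
powerSums-newton : ∀ {p} → IsPowerSums p → Newton p h
powerSums-newton {p} p-powerSums m = ≈-trans (conv-cong (λ r → ≈-sym (𝓅≈p r)) (λ _ → ≈-refl) m) (𝓅-newton m)
  where
  𝓅≈p : ∀ r → 𝓅 r ≈ p r
  𝓅≈p r = P.x∙y⁻¹≈ε⇒x≈y _ _ (restrict-injective (𝓅 r - p r) λ N →
    ≈-trans (+-cong (restrict-𝓅 N r) (-‿cong (p-powerSums N r))) (P.-‿inverseʳ _))

-- Partitions.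

module _ {n : ℕ} where

  indices : Partition n → List ℕ
  indices lam = List.map ℕ.pred (parts lam)

  parts≡suc-indices : ∀ lam → parts lam ≡ List.map suc (indices lam)
  parts≡suc-indices lam = ≡.trans (suc-pred (Partition.positive lam)) (List.map-∘ (parts lam))
    where
    suc-pred : ∀ {rs} → All (1 ≤_) rs → rs ≡ List.map (λ r → suc (ℕ.pred r)) rs
    suc-pred []            = refl
    suc-pred (s≤s z≤n ∷ P) = ≡.cong (_ ∷_) (suc-pred P)

  ⟦⟧≡mon : ∀ (f : ℕ → Λ) lam → f ⟦ lam ⟧ ≡ mon (f ∘ suc) (indices lam)
  ⟦⟧≡mon f lam = ≡.cong ∏ (≡.trans (≡.cong (List.map f) (parts≡suc-indices lam)) (≡.sym (List.map-∘ (indices lam))))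

  weight-indices : ∀ lam → weight (indices lam) ≡ n
  weight-indices lam = ≡.trans (≡.cong ListAction.sum (≡.sym (parts≡suc-indices lam))) (Partition.sums-to lam)

  length-indices : ∀ lam → length (indices lam) ≡ ℓ lam
  length-indices lam = List.length-map ℕ.pred (parts lam)

  fromIndices : ∀ rs → weight rs ≡ n → Partition n
  fromIndices rs e = record
    { parts      = sort (List.map suc rs)
    ; decreasing = sort-↗ (List.map suc rs)
    ; positive   = ↭.All-resp-↭ (↭-sym (sort-↭ (List.map suc rs))) (All.map⁺ (All.universal (λ _ → s≤s z≤n) rs))
    ; sums-to    = ≡.trans (ListAction.sum-↭ (sort-↭ (List.map suc rs))) e }

  fromIndices-mon : ∀ (f : ℕ → Λ) rs e → f ⟦ fromIndices rs e ⟧ ≈ mon (f ∘ suc) rs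
  fromIndices-mon f rs e = ≈-trans (mon-↭ f (sort-↭ (List.map suc rs))) (≡⇒≈ (≡.cong ∏ (≡.sym (List.map-∘ rs))))

  Partition-≡ : {lam mu : Partition n} → parts lam ≡ parts mu → lam ≡ mu
  Partition-≡ {record { decreasing = d ; positive = q ; sums-to = s }}
              {record { decreasing = d′ ; positive = q′ ; sums-to = s′ }} refl
    with Linked.irrelevant ℕ.≤-irrelevant d d′ | All.irrelevant ℕ.≤-irrelevant q q′ | ℕ.≡-irrelevant s s′
  ... | refl | refl | refl = refl

  indices-injective : {lam mu : Partition n} → indices lam ↭ indices mu → lam ≡ mu
  indices-injective {lam} {mu} p = Partition-≡ (decreasing-unique (Partition.decreasing lam) (Partition.decreasing mu)
    (↭-trans (↭-reflexive (parts≡suc-indices lam))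
      (↭-trans (↭.map⁺ suc p) (↭-reflexive (≡.sym (parts≡suc-indices mu))))))

PartitionProduct : ℕ → (ℕ → Λ) → Pred Λ 0ℓ
PartitionProduct n f g = ∃ λ (lam : Partition n) → g ≡ f ⟦ lam ⟧

partition⇒weight : ∀ (f : ℕ → Λ) {n g} → Span (PartitionProduct n f) g → Span (MonomialOfWeight n (f ∘ suc)) g
partition⇒weight f = Span-⊆ λ where (lam , refl) → gen (indices lam , weight-indices lam , ⟦⟧≡mon f lam)

weight⇒partition : ∀ (f : ℕ → Λ) {n g} → Span (MonomialOfWeight n (f ∘ suc)) g → Span (PartitionProduct n f) g
weight⇒partition f = Span-⊆ λ where (rs , e , refl) → resp (fromIndices-mon f rs e) (gen (fromIndices rs e , refl))

-- The operators 𝒢.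

D-linear : Linear (apply D)
D-linear = End-linear D

D-leibniz : ∀ f g → apply D (f * g) ≈ apply D f * g + f * apply D g
D-leibniz f g = solve 6 (λ f g f₀ f₁ g₀ g₁ →
  (f₀ :* g :+ f :* g₀) :+ (f₁ :* g :+ f :* g₁) := (f₀ :+ f₁) :* g :+ f :* (g₀ :+ g₁))
  ≈-refl f g (∂ zero f) (∂ (suc zero) f) (∂ zero g) (∂ (suc zero) g)

-- The extra factor `v` avoids the exponent j - 1.
v*D-vʲ : ∀ {v} → apply D v ≈ con 1ℚ → ∀ j → v * apply D (v ^ j) ≈ nat j * v ^ j
v*D-vʲ {v} Dv≈1 zero    = solve 1 (λ v → v :* (:con 0ℚ :+ :con 0ℚ) := :con 0ℚ :* :con 1ℚ) ≈-refl v
v*D-vʲ {v} Dv≈1 (suc j) = begin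
  v * apply D (v * v ^ j)
    ≈⟨ *-congʳ (D-leibniz v (v ^ j)) ⟩
  v * (apply D v * v ^ j + v * apply D (v ^ j))
    ≈⟨ *-congʳ (+-cong (*-congˡ Dv≈1) (v*D-vʲ Dv≈1 j)) ⟩
  v * (con 1ℚ * v ^ j + nat j * v ^ j)
    ≈⟨ solve 3 (λ v w n → v :* (:con 1ℚ :* w :+ n :* w) := (:con 1ℚ :+ n) :* (v :* w)) ≈-refl v (v ^ j) (nat j) ⟩
  (con 1ℚ + nat j) * (v * v ^ j)
    ≈⟨ *-congˡ (nat-suc j) ⟨
  nat (suc j) * v ^ suc j ∎

A : ℚ[x,y] → ℚ[x,y]
A f = x * y * apply D f

A-linear : Linear A
A-linear = ∘-linear (*-linear (x * y)) D-linear

Dx≈1 : apply D x ≈ con 1ℚ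
Dx≈1 = P.+-identityʳ _

Dy≈1 : apply D y ≈ con 1ℚ
Dy≈1 = +-identityˡ _

-- Differentiating `y ^ r` produces r x yʳ g, which the -x in δ cancels. Behind the power of y only
-- the operator xD + r is left, which acts simply on the xʲDʲ.
A-yʳ : ∀ r g → A (y ^ r * g) + nat r * (δ * (y ^ r * g)) ≈ y ^ suc r * (nat r * g + x * apply D g)
A-yʳ r g = begin
  x * y * apply D (y ^ r * g) + nat r * (δ * (y ^ r * g))
    ≈⟨ +-congˡ (*-congʳ (D-leibniz (y ^ r) g)) ⟩
  x * y * (apply D (y ^ r) * g + y ^ r * apply D g) + nat r * (δ * (y ^ r * g))
    ≈⟨ solve 7 (λ x y z dz g dg n → x :* y :* (dz :* g :+ z :* dg) :+ n :* ((y :+ :- x) :* (z :* g)) :=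
                                    x :* g :* (y :* dz) :+ (y :* z :* (x :* dg) :+ n :* ((y :+ :- x) :* (z :* g))))
         ≈-refl x y (y ^ r) (apply D (y ^ r)) g (apply D g) (nat r) ⟩
  x * g * (y * apply D (y ^ r)) + (y * y ^ r * (x * apply D g) + nat r * (δ * (y ^ r * g)))
    ≈⟨ +-congˡ (*-congʳ (v*D-vʲ Dy≈1 r)) ⟩
  x * g * (nat r * y ^ r) + (y * y ^ r * (x * apply D g) + nat r * (δ * (y ^ r * g)))
    ≈⟨ solve 6 (λ x y z g dg n → x :* g :* (n :* z) :+ (y :* z :* (x :* dg) :+ n :* ((y :+ :- x) :* (z :* g))) :=
                                 y :* z :* (n :* g :+ x :* dg))
         ≈-refl x y (y ^ r) g (apply D g) (nat r) ⟩
  y ^ suc r * (nat r * g + x * apply D g) ∎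

xʲDʲ : ℚ[x,y] → ℕ → ℚ[x,y]
xʲDʲ f j = x ^ j * fold f (apply D) j

xD-xʲDʲ : ∀ r f j → nat r * xʲDʲ f j + x * apply D (xʲDʲ f j) ≈ nat (r ℕ.+ j) * xʲDʲ f j + xʲDʲ f (suc j)
xD-xʲDʲ r f j = begin
  nat r * (x ^ j * g) + x * apply D (x ^ j * g)
    ≈⟨ +-congʳ (*-congʳ (D-leibniz (x ^ j) g)) ⟩
  nat r * (x ^ j * g) + x * (apply D (x ^ j) * g + x ^ j * apply D g)
    ≈⟨ solve 6 (λ n x z dz g dg → n :* (z :* g) :+ x :* (dz :* g :+ z :* dg) :=
                 n :* (z :* g) :+ (x :* dz :* g :+ x :* z :* dg))
         ≈-refl (nat r) x (x ^ j) (apply D (x ^ j)) g (apply D g) ⟩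
  nat r * (x ^ j * g) + (x * apply D (x ^ j) * g + x * x ^ j * apply D g)
    ≈⟨ +-congʳ (+-congˡ (*-congˡ (v*D-vʲ Dx≈1 j))) ⟩
  nat r * (x ^ j * g) + (nat j * x ^ j * g + x * x ^ j * apply D g)
    ≈⟨ solve 5 (λ n j z g t → n :* (z :* g) :+ (j :* z :* g :+ t) := (n :+ j) :* (z :* g) :+ t)
         ≈-refl (nat r) (nat j) (x ^ j) g (x * x ^ j * apply D g) ⟩
  (nat r + nat j) * (x ^ j * g) + x * x ^ j * apply D g
    ≈⟨ +-congˡ (*-congˡ (nat-+ r j)) ⟨
  nat (r ℕ.+ j) * (x ^ j * g) + x * x ^ j * apply D g ∎
  where g = fold f (apply D) j

-- Finite sums and the recursion of the coefficients of 𝒢.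

rangeSum : ℕ → (ℕ → ℚ[ X ]) → ℚ[ X ]
rangeSum zero    t = con 0ℚ
rangeSum (suc n) t = t 0 + rangeSum n (t ∘ suc)

rangeSum-cong : ∀ n {t t′ : ℕ → ℚ[ X ]} → (∀ i → t i ≈ t′ i) → rangeSum n t ≈ rangeSum n t′
rangeSum-cong zero    e = ≈-refl
rangeSum-cong (suc n) e = +-cong (e 0) (rangeSum-cong n (e ∘ suc))

rangeSum-+ : ∀ n (t t′ : ℕ → ℚ[ X ]) → rangeSum n (λ i → t i + t′ i) ≈ rangeSum n t + rangeSum n t′
rangeSum-+ zero    t t′ = ≈-sym (+-identityˡ _)
rangeSum-+ (suc n) t t′ = ≈-trans (+-congʳ (rangeSum-+ n (t ∘ suc) (t′ ∘ suc))) (P.+-interchange _ _ _ _)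

rangeSum-map : {φ : ℚ[ X ] → ℚ[ Y ]} → Linear φ → ∀ n t → φ (rangeSum n t) ≈ rangeSum n (φ ∘ t)
rangeSum-map φ zero    t = 0-homo φ
rangeSum-map φ (suc n) t = ≈-trans (+-homo φ _ _) (+-congʳ (rangeSum-map φ n (t ∘ suc)))

rangeSum-last : ∀ n (t : ℕ → ℚ[ X ]) → rangeSum (suc n) t ≈ rangeSum n t + t n
rangeSum-last zero    t = +-comm _ _
rangeSum-last (suc n) t = ≈-trans (+-congʳ (rangeSum-last n (t ∘ suc))) (≈-sym (+-assoc _ _ _))

-- Reindexing for a two-term recursion: `w i` receives `v i` from its own summand and `c` from the
-- preceding one, and `v n ≈ 0` closes the sum at the upper end.
rangeSum-shift : ∀ n (u v c w : ℕ → ℚ[ X ]) → u 0 ≈ v 0 → (∀ i → u (suc i) ≈ v (suc i) + c i) → v n ≈ con 0ℚ →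
                 rangeSum (suc n) (λ i → u i * w i) ≈ rangeSum n (λ i → v i * w i + c i * w (suc i))
rangeSum-shift n u v c w u₀ uᵢ vₙ = begin
  u 0 * w 0 + rangeSum n (λ i → u (suc i) * w (suc i))
    ≈⟨ +-cong (*-congˡ u₀) (rangeSum-cong n λ i → ≈-trans (*-congˡ (uᵢ i)) (P.distribʳ _ _ _)) ⟩
  v 0 * w 0 + rangeSum n (λ i → v (suc i) * w (suc i) + c i * w (suc i))
    ≈⟨ +-congʳ (rangeSum-+ n _ _) ⟩
  v 0 * w 0 + (rangeSum n (λ i → v (suc i) * w (suc i)) + rangeSum n (λ i → c i * w (suc i)))
    ≈⟨ +-assoc _ _ _ ⟨
  rangeSum (suc n) (λ i → v i * w i) + rangeSum n (λ i → c i * w (suc i))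
    ≈⟨ +-congˡ (rangeSum-last n (λ i → v i * w i)) ⟩
  rangeSum n (λ i → v i * w i) + v n * w n + rangeSum n (λ i → c i * w (suc i))
    ≈⟨ +-congˡ (≈-trans (+-congʳ (≈-trans (*-congˡ vₙ) (P.zeroˡ _))) (P.+-identityʳ _)) ⟩
  rangeSum n (λ i → v i * w i) + rangeSum n (λ i → c i * w (suc i))
    ≈⟨ rangeSum-+ n _ _ ⟨
  rangeSum n (λ i → v i * w i + c i * w (suc i)) ∎

sum≡rangeSum : ∀ n (t : ℕ → ℚ[ X ]) → sum {n = n} (t ∘ toℕ) ≡ rangeSum n t
sum≡rangeSum zero    t = refl
sum≡rangeSum (suc n) t = ≡.cong (t 0 +_) (sum≡rangeSum n (t ∘ suc))

-- The identity (k+1) C(n, k+1) = (n - k) C(n, k), arranged without truncated subtraction; Pascal's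
-- rule proves it by induction.
[1+k]C+kC≡nC : ∀ n k → suc k ℕ.* (n C suc k) ℕ.+ k ℕ.* (n C k) ≡ n ℕ.* (n C k)
[1+k]C+kC≡nC zero zero = refl
[1+k]C+kC≡nC zero (suc k) = ≡.cong₂ ℕ._+_
  (≡.trans (≡.cong (suc (suc k) ℕ.*_) (k>n⇒nCk≡0 {0} {suc (suc k)} (s≤s z≤n))) (ℕ.*-zeroʳ (suc (suc k))))
  (≡.trans (≡.cong (suc k ℕ.*_) (k>n⇒nCk≡0 {0} {suc k} (s≤s z≤n))) (ℕ.*-zeroʳ (suc k)))
[1+k]C+kC≡nC (suc n) zero = ≡.trans (≡.cong (λ c → 1 ℕ.* c ℕ.+ 0) (nC1≡n (suc n))) (lemma n)
  where
  lemma : ∀ n → 1 ℕ.* suc n ℕ.+ 0 ≡ suc n ℕ.* 1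
  lemma = solve-∀
[1+k]C+kC≡nC (suc n) (suc k) = ≡.trans
  (≡.cong₂ (λ a b → suc (suc k) ℕ.* a ℕ.+ suc k ℕ.* b)
    (≡.sym (nCk+nC[k+1]≡[n+1]C[k+1] n (suc k))) (≡.sym (nCk+nC[k+1]≡[n+1]C[k+1] n k)))
  (≡.trans (lemma k (n C suc (suc k)) (n C suc k) (n C k))
  (≡.trans (≡.cong₂ (λ a b → a ℕ.+ b ℕ.+ (n C suc k) ℕ.+ (n C k)) ([1+k]C+kC≡nC n (suc k)) ([1+k]C+kC≡nC n k))
  (≡.trans (lemma′ n (n C suc k) (n C k)) (≡.cong (suc n ℕ.*_) (nCk+nC[k+1]≡[n+1]C[k+1] n k)))))
  where
  lemma : ∀ k a b c → suc (suc k) ℕ.* (b ℕ.+ a) ℕ.+ suc k ℕ.* (c ℕ.+ b) ≡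
          suc (suc k) ℕ.* a ℕ.+ suc k ℕ.* b ℕ.+ (suc k ℕ.* b ℕ.+ k ℕ.* c) ℕ.+ b ℕ.+ c
  lemma = solve-∀
  lemma′ : ∀ n b c → n ℕ.* b ℕ.+ n ℕ.* c ℕ.+ b ℕ.+ c ≡ suc n ℕ.* (c ℕ.+ b)
  lemma′ = solve-∀

nat-cancel : ∀ n .{{_ : ℕ.NonZero n}} {a b : ℚ[ X ]} → a * nat n ≈ b * nat n → a ≈ b
nat-cancel (suc n) {a} {b} e = P.x∙y⁻¹≈ε⇒x≈y a b (con-cancel (ν-suc≢0 n) (begin
  nat (suc n) * (a - b)
    ≈⟨ solve 3 (λ n a b → n :* (a :+ :- b) := a :* n :+ :- (b :* n)) ≈-refl (nat (suc n)) a b ⟩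
  a * nat (suc n) - b * nat (suc n)
    ≈⟨ +-congˡ e ⟩
  b * nat (suc n) - b * nat (suc n)
    ≈⟨ P.-‿inverseʳ _ ⟩
  con 0ℚ ∎))

-- The coefficient of yˢ⁺¹ xⁱ⁺¹ Dⁱ⁺¹ in 𝒢 (s + 1).
α : ℕ → ℕ → ℚ
α s i = (ℤ.+ (s C i) ℚ./ (suc i !)) {{suc i !≢0}}

α-! : ∀ s i → con {X} (α s i) * nat (suc i !) ≈ nat (s C i)
α-! s i = ≈-trans (≈-sym (con-* _ _)) (≡⇒≈ (≡.cong con (ν-/ (s C i) (suc i !) {{suc i !≢0}})))

α-last : ∀ s → con {X} (α s (suc s)) ≈ con 0ℚ
α-last s = nat-cancel (suc (suc s) !) {{suc (suc s) !≢0}} (≈-trans (α-! s (suc s))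
  (≈-trans (≡⇒≈ (≡.cong nat (k>n⇒nCk≡0 {s} ℕ.≤-refl))) (≈-sym (P.zeroˡ _))))

-- The coefficient of xⁱ⁺²Dⁱ⁺² in `𝒢-step` for r = s + 1. Multiplied by (i+2)! it is an identity of
-- binomial coefficients: expand by Pascal's rule and replace s C(s, i) by `[1+k]C+kC≡nC`.
α-suc : ∀ s i → nat {X} (2 ℕ.+ s) * con (α (suc s) (suc i)) ≈
        con (α s (suc i)) * nat (suc s ℕ.+ suc (suc i)) + con (α s i)
α-suc {X} s i = nat-cancel (suc (suc i) !) {{suc (suc i) !≢0}} (begin
  nat (2 ℕ.+ s) * con (α (suc s) (suc i)) * nat N
    ≈⟨ ≈-trans (*-assoc _ _ _) (*-congʳ (α-! (suc s) (suc i))) ⟩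
  nat (2 ℕ.+ s) * nat (suc s C suc i)
    ≈⟨ nat-* (2 ℕ.+ s) (suc s C suc i) ⟨
  nat ((2 ℕ.+ s) ℕ.* (suc s C suc i))
    ≡⟨ ≡.cong nat binomial ⟩
  nat ((s C suc i) ℕ.* (suc s ℕ.+ suc (suc i)) ℕ.+ (s C i) ℕ.* suc (suc i))
    ≈⟨ ≈-trans (nat-+ ((s C suc i) ℕ.* (suc s ℕ.+ suc (suc i))) ((s C i) ℕ.* suc (suc i)))
         (+-cong (nat-* (s C suc i) (suc s ℕ.+ suc (suc i))) (nat-* (s C i) (suc (suc i)))) ⟩
  nat (s C suc i) * nat (suc s ℕ.+ suc (suc i)) + nat (s C i) * nat (suc (suc i))
    ≈⟨ +-cong (*-congˡ (α-! s (suc i))) (*-congˡ (α-! s i)) ⟨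
  con (α s (suc i)) * nat N * nat (suc s ℕ.+ suc (suc i)) + con (α s i) * nat (suc i !) * nat (suc (suc i))
    ≈⟨ +-congʳ (≈-trans (*-assoc _ _ _) (*-congʳ (≈-trans (*-comm _ _) (≈-sym (nat-* (suc (suc i)) (suc i !)))))) ⟩
  con (α s (suc i)) * nat N * nat (suc s ℕ.+ suc (suc i)) + con (α s i) * nat N
    ≈⟨ solve 4 (λ a n k b → a :* n :* k :+ b :* n := (a :* k :+ b) :* n) ≈-refl
         (con (α s (suc i))) (nat N) (nat (suc s ℕ.+ suc (suc i))) (con (α s i)) ⟩
  (con (α s (suc i)) * nat (suc s ℕ.+ suc (suc i)) + con (α s i)) * nat N ∎)
  where
  N = suc (suc i) !
  lemma : ∀ s i a b → (2 ℕ.+ s) ℕ.* (b ℕ.+ a) ≡ s ℕ.* b ℕ.+ ((2 ℕ.+ s) ℕ.* a ℕ.+ 2 ℕ.* b)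
  lemma = solve-∀
  lemma′ : ∀ s i a b → (suc i ℕ.* a ℕ.+ i ℕ.* b) ℕ.+ ((2 ℕ.+ s) ℕ.* a ℕ.+ 2 ℕ.* b) ≡
           a ℕ.* (suc s ℕ.+ suc (suc i)) ℕ.+ b ℕ.* suc (suc i)
  lemma′ = solve-∀
  binomial : (2 ℕ.+ s) ℕ.* (suc s C suc i) ≡ (s C suc i) ℕ.* (suc s ℕ.+ suc (suc i)) ℕ.+ (s C i) ℕ.* suc (suc i)
  binomial = ≡.trans (≡.cong ((2 ℕ.+ s) ℕ.*_) (≡.sym (nCk+nC[k+1]≡[n+1]C[k+1] s i)))
    (≡.trans (lemma s i (s C suc i) (s C i))
    (≡.trans (≡.cong (ℕ._+ ((2 ℕ.+ s) ℕ.* (s C suc i) ℕ.+ 2 ℕ.* (s C i))) (≡.sym ([1+k]C+kC≡nC s i)))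
             (lemma′ s i (s C suc i) (s C i))))

apply-^ᴱ : ∀ (T : End) j f → apply (T ^ᴱ j) f ≡ fold f (apply T) j
apply-^ᴱ T zero    f = refl
apply-^ᴱ T (suc j) f = ≡.cong (apply T) (apply-^ᴱ T j f)

apply-sumᴱ : ∀ {n} (F : Fin n → End) f → apply (sumᴱ F) f ≡ sum (λ i → apply (F i) f)
apply-sumᴱ {zero}  F f = refl
apply-sumᴱ {suc n} F f = ≡.cong (apply (F zero) f +_) (apply-sumᴱ (F ∘ suc) f)

sum-cong : ∀ {n} {t t′ : Fin n → ℚ[ X ]} → (∀ i → t i ≈ t′ i) → sum t ≈ sum t′
sum-cong {n = zero}  e = ≈-refl
sum-cong {n = suc n} e = +-cong (e zero) (sum-cong (e ∘ suc))

𝒢-suc : ∀ s f → apply (𝒢 (suc s)) f ≈ y ^ suc s * rangeSum (suc s) (λ i → con (α s i) * xʲDʲ f (suc i))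
𝒢-suc s f = *-congʳ (begin
  apply (sumᴱ G) f                                 ≡⟨ apply-sumᴱ G f ⟩
  sum (λ i → apply (G i) f)                        ≈⟨ sum-cong {n = suc s} G≈t ⟩
  sum {n = suc s} (t ∘ toℕ)                        ≡⟨ sum≡rangeSum (suc s) t ⟩
  rangeSum (suc s) t                               ∎)
  where
  G : Fin (suc s) → End
  G i = let j = suc (toℕ i) in α s (toℕ i) ·ᴱ (mul (x ^ j) ∘ᴱ (D ^ᴱ j))
  t : ℕ → ℚ[x,y]
  t i = con (α s i) * xʲDʲ f (suc i)
  G≈t : ∀ i → apply (G i) f ≈ t (toℕ i)
  G≈t i = *-congʳ (*-congʳ (≡⇒≈ (apply-^ᴱ D (suc (toℕ i)) f)))

-- For r > 0 both sides are yʳ⁺¹ times a combination of the xʲDʲ, and coefficients are compared. The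
-- case r = 0 stands apart because `𝒢 0` is not given by the sum.
𝒢-step : ∀ r f → nat (suc r) * apply (𝒢 (suc r)) f ≈ A (apply (𝒢 r) f) + nat r * (δ * apply (𝒢 r) f)
𝒢-step zero f = solve 4 (λ x y δ df →
  :con 1ℚ :* (y :* :con 1ℚ :* (:con 1ℚ :* (x :* :con 1ℚ :* df) :+ :con 0ℚ)) := x :* y :* df :+ :con 0ℚ :* δ)
  ≈-refl x y (δ * f) (apply D f)
𝒢-step r@(suc s) f = begin
  nat (suc r) * apply (𝒢 (suc r)) f
    ≈⟨ *-congʳ (𝒢-suc r f) ⟩
  nat (suc r) * (y ^ suc r * rangeSum (suc r) (λ i → con (α r i) * w i))
    ≈⟨ ≈-trans (P.*-leftComm _ _ _)
         (*-congʳ (rangeSum-map (*-linear (nat (suc r))) (suc r) (λ i → con (α r i) * w i))) ⟩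
  y ^ suc r * rangeSum (suc r) (λ i → nat (suc r) * (con (α r i) * w i))
    ≈⟨ *-congʳ (rangeSum-cong (suc r) λ i → ≈-sym (*-assoc (nat (suc r)) (con (α r i)) (w i))) ⟩
  y ^ suc r * rangeSum (suc r) (λ i → nat (suc r) * con (α r i) * w i)
    ≈⟨ *-congʳ (rangeSum-shift r (λ i → nat (suc r) * con (α r i)) (λ i → con (α s i) * nat (r ℕ.+ suc i))
         (λ i → con (α s i)) w
         -- The coefficients `α r 0` and `α s 0` agree by computation.
         (≈-trans (*-comm _ _) (*-congʳ (≡⇒≈ (≡.cong nat (≡.sym (ℕ.+-comm r 1))))))
         (α-suc s)
         (≈-trans (*-congˡ (α-last s)) (P.zeroˡ _))) ⟩
  y ^ suc r * rangeSum r (λ i → con (α s i) * nat (r ℕ.+ suc i) * w i + con (α s i) * w (suc i))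
    ≈⟨ *-congʳ (rangeSum-cong r λ i → ≈-trans (+-congˡ (*-assoc (con (α s i)) (nat (r ℕ.+ suc i)) (w i)))
         (≈-sym (distribˡ (con (α s i)) (nat (r ℕ.+ suc i) * w i) (w (suc i))))) ⟩
  y ^ suc r * rangeSum r (λ i → con (α s i) * (nat (r ℕ.+ suc i) * w i + w (suc i)))
    ≈⟨ *-congʳ (rangeSum-cong r λ i → *-congʳ {f = con (α s i)} (xD-xʲDʲ r f (suc i))) ⟨
  y ^ suc r * rangeSum r (λ i → con (α s i) * Θ (w i))
    ≈⟨ *-congʳ (rangeSum-cong r λ i → ·-homo Θ-linear (α s i) (w i)) ⟨
  y ^ suc r * rangeSum r (λ i → Θ (con (α s i) * w i))
    ≈⟨ *-congʳ (rangeSum-map Θ-linear r (λ i → con (α s i) * w i)) ⟨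
  y ^ suc r * Θ g
    ≈⟨ A-yʳ r g ⟨
  A (y ^ r * g) + nat r * (δ * (y ^ r * g))
    ≈⟨ +-cong (cong A-linear (𝒢-suc s f)) (*-congʳ (*-congʳ (𝒢-suc s f))) ⟨
  A (apply (𝒢 r) f) + nat r * (δ * apply (𝒢 r) f) ∎
  where
  w = xʲDʲ f ∘ suc
  g = rangeSum r (λ i → con (α s i) * w i)
  Θ : ℚ[x,y] → ℚ[x,y]
  Θ g = nat r * g + x * apply D g
  Θ-linear : Linear Θ
  Θ-linear = record
    { cong   = λ e → +-cong (*-congʳ e) (*-congʳ (cong D-linear e))
    ; +-homo = λ f g → ≈-trans (+-cong (distribˡ _ _ _) (≈-trans (*-congʳ (+-homo D-linear f g)) (distribˡ _ _ _)))
                               (P.+-interchange _ _ _ _)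
    ; ·-homo = λ c f → ≈-trans (+-cong (P.*-leftComm _ _ _)
                               (≈-trans (*-congʳ (·-homo D-linear c f)) (P.*-leftComm _ _ _)))
                               (≈-sym (distribˡ _ _ _)) }

𝒢₁≈A : ∀ f → apply (𝒢 1) f ≈ A f
𝒢₁≈A f = solve 3 (λ x y df → y :* :con 1ℚ :* (:con 1ℚ :* (x :* :con 1ℚ :* df) :+ :con 0ℚ) := x :* y :* df)
  ≈-refl x y (apply D f)

^-+ : ∀ (f : ℚ[ X ]) m n → f ^ (m ℕ.+ n) ≈ f ^ m * f ^ n
^-+ f zero    n = ≈-sym (*-identityˡ _)
^-+ f (suc m) n = ≈-trans (*-congʳ (^-+ f m n)) (≈-sym (*-assoc _ _ _))

D-δᵏ : ∀ k → apply D (δ ^ k) ≈ con 0ℚ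
D-δᵏ zero    = +-identityˡ _
D-δᵏ (suc k) = ≈-trans (D-leibniz δ (δ ^ k))
  (≈-trans (+-cong (*-congˡ (solve 0 ((:con 0ℚ :+ :- :con 1ℚ) :+ (:con 1ℚ :+ :- :con 0ℚ) := :con 0ℚ) ≈-refl))
                   (*-congʳ (D-δᵏ k)))
           (≈-trans (+-cong (P.zeroˡ _) (P.zeroʳ _)) (+-identityˡ _)))

A-δᵏ : ∀ k g → A (δ ^ k * g) ≈ δ ^ k * A g
A-δᵏ k g = begin
  x * y * apply D (δ ^ k * g)                          ≈⟨ *-congʳ (D-leibniz (δ ^ k) g) ⟩
  x * y * (apply D (δ ^ k) * g + δ ^ k * apply D g)    ≈⟨ *-congʳ (+-congˡ (≈-trans (*-congˡ (D-δᵏ k)) (P.zeroˡ g))) ⟩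
  x * y * (con 0ℚ + δ ^ k * apply D g)                 ≈⟨ *-congʳ (+-identityˡ _) ⟩
  x * y * (δ ^ k * apply D g)                          ≈⟨ P.*-leftComm _ _ _ ⟩
  δ ^ k * A g                                          ∎

-- Independence of the polynomials δᵏAˡx.

δᵏAˡ : ℕ → ℕ → ℚ[x,y] → ℚ[x,y]
δᵏAˡ k l f = δ ^ k * fold f A l

module _ where
  private
    open Derivation D-linear D-leibniz
    d : ℕ → ℚ[x,y] → ℚ[x,y]
    d n f = fold f (apply D) n

    fold-shift : ∀ f n → fold (apply D f) (apply D) n ≡ d (suc n) f
    fold-shift f zero    = refl
    fold-shift f (suc n) = ≡.cong (apply D) (fold-shift f n)

    D-nat : ∀ c → apply D (nat c) ≈ con 0ℚ
    D-nat c = +-identityˡ _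

  -- Over ℚ[δ] the operator D is d/dx, and A = x(x + δ)D takes a leading term a xˡ⁺¹ to (l+1) a
  -- xˡ⁺². The resulting constant is l! (l+1)!.
  Dˡ⁺¹Aˡx : ∀ l → ∃ λ c → fold (fold x A l) (apply D) (suc l) ≈ nat (suc c)
  Dˡ⁺¹Aˡx zero = 0 , Dx≈1
  Dˡ⁺¹Aˡx (suc l) with Dˡ⁺¹Aˡx l
  -- `C` is a product of successors, so `suc (pred C)` computes to it.
  ... | c , e = ℕ.pred C , (begin
    d (2 ℕ.+ l) (x * y * g)
      ≈⟨ cong (fold-linear D-linear (2 ℕ.+ l)) (*-assoc x y g) ⟩
    d (2 ℕ.+ l) (x * (y * g))
      ≈⟨ dᵏ⁺¹-v* Dx≈1 (suc l) (y * g) ⟩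
    nat (2 ℕ.+ l) * d (suc l) (y * g) + x * d (2 ℕ.+ l) (y * g)
      ≈⟨ +-cong (*-congʳ (≈-trans (dᵏ⁺¹-v* Dy≈1 l g) (+-cong (*-congʳ d₀) (*-congʳ d₁))))
                (*-congʳ (≈-trans (dᵏ⁺¹-v* Dy≈1 (suc l) g) (+-cong (*-congʳ d₁) (*-congʳ d₂)))) ⟩
    nat (2 ℕ.+ l) * (nat (suc l) * nat (suc c) + y * con 0ℚ) + x * (nat (2 ℕ.+ l) * con 0ℚ + y * con 0ℚ)
      ≈⟨ solve 5 (λ a b c x y → a :* (b :* c :+ y :* :con 0ℚ) :+ x :* (a :* :con 0ℚ :+ y :* :con 0ℚ) := a :* (b :* c))
           ≈-refl (nat (2 ℕ.+ l)) (nat (suc l)) (nat (suc c)) x y ⟩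
    nat (2 ℕ.+ l) * (nat (suc l) * nat (suc c))
      ≈⟨ *-congʳ (nat-* (suc l) (suc c)) ⟨
    nat (2 ℕ.+ l) * nat (suc l ℕ.* suc c)
      ≈⟨ nat-* (2 ℕ.+ l) (suc l ℕ.* suc c) ⟨
    nat C ∎)
    where
    C = (2 ℕ.+ l) ℕ.* (suc l ℕ.* suc c)
    g = apply D (fold x A l)
    d₀ : d l g ≈ nat (suc c)
    d₀ = ≈-trans (≡⇒≈ (fold-shift _ l)) e
    d₁ : d (suc l) g ≈ con 0ℚ
    d₁ = ≈-trans (cong D-linear d₀) (D-nat (suc c))
    d₂ : d (2 ℕ.+ l) g ≈ con 0ℚ
    d₂ = ≈-trans (cong D-linear d₁) (0-homo D-linear)

  DⁿAˡx : ∀ l t → fold (fold x A l) (apply D) (suc l ℕ.+ suc t) ≈ con 0ℚ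
  DⁿAˡx l zero with Dˡ⁺¹Aˡx l
  ... | c , e = ≈-trans (≡⇒≈ (≡.cong (λ n → d n (fold x A l)) (ℕ.+-comm (suc l) 1)))
                        (≈-trans (cong D-linear e) (D-nat (suc c)))
  DⁿAˡx l (suc t) = ≈-trans (≡⇒≈ (≡.cong (λ n → d n (fold x A l)) (ℕ.+-suc (suc l) (suc t))))
                            (≈-trans (cong D-linear (DⁿAˡx l t)) (0-homo D-linear))

  Dⁿδᵏ : ∀ k n f → d n (δ ^ k * f) ≈ δ ^ k * d n f
  Dⁿδᵏ k = dᵏ-const* (D-δᵏ k)

-- In the coordinates δ, x the partial derivatives are ∂_y and D.
module δ-Taylor = Taylor {Y = Fin 0} (∂-linear (suc zero)) (λ _ _ → ≈-refl) (λ _ → con 0ℚ) {δ}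
  (solve 0 (:con 1ℚ :+ :- :con 0ℚ := :con 1ℚ) ≈-refl) (solve 0 (:con 0ℚ :+ :- :con 0ℚ := :con 0ℚ) ≈-refl)

private
  abstract

    -- k! (l+1)! times the coefficient of δᵏ xˡ⁺¹; the exponent of x is the degree of Aˡx.
    coefficientOf : ℕ → ℕ → ℚ[x,y] → ℚ[ Fin 0 ]
    coefficientOf k l f = δ-Taylor.T k (fold f (apply D) (suc l))

    coefficientOf-linear : ∀ k l → Linear (coefficientOf k l)
    coefficientOf-linear k l = ∘-linear (δ-Taylor.T-linear k) (fold-linear D-linear (suc l))

    coefficientOf-< : ∀ k k′ l t → coefficientOf k (suc l ℕ.+ t) (δᵏAˡ k′ l x) ≈ con 0ℚ
    coefficientOf-< k k′ l t = begin
      coefficientOf k (suc l ℕ.+ t) (δᵏAˡ k′ l x)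
        ≈⟨ cong (δ-Taylor.T-linear k) (Dⁿδᵏ k′ (suc (suc l ℕ.+ t)) (fold x A l)) ⟩
      δ-Taylor.T k (δ ^ k′ * fold (fold x A l) (apply D) (suc (suc l ℕ.+ t)))
        ≡⟨ ≡.cong (λ n → δ-Taylor.T k (δ ^ k′ * fold (fold x A l) (apply D) n)) (ℕ.+-suc (suc l) t) ⟨
      δ-Taylor.T k (δ ^ k′ * fold (fold x A l) (apply D) (suc l ℕ.+ suc t))
        ≈⟨ cong (δ-Taylor.T-linear k) (≈-trans (*-congʳ (DⁿAˡx l t)) (P.zeroʳ (δ ^ k′))) ⟩
      δ-Taylor.T k (con 0ℚ)
        ≈⟨ 0-homo (δ-Taylor.T-linear k) ⟩
      con 0ℚ ∎

    coefficientOf-≡ : ∀ k k′ l → ∃ λ c → coefficientOf k l (δᵏAˡ k′ l x) ≈ δ-Taylor.T k (δ ^ k′ * nat (suc c))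
    coefficientOf-≡ k k′ l = let c , e = Dˡ⁺¹Aˡx l in
      c , cong (δ-Taylor.T-linear k) (≈-trans (Dⁿδᵏ k′ (suc l) (fold x A l)) (*-congʳ e))

  T-δᵏ-≢ : ∀ k k′ c → k ≢ k′ → δ-Taylor.T k (δ ^ k′ * nat c) ≈ con 0ℚ
  T-δᵏ-≢ k k′ c k≢k′ with ℕ.<-cmp k k′
  ... | tri< k<k′ _ _ = δ-Taylor.T-vʲ*-> k<k′ (nat c)
  ... | tri≈ _ k≡k′ _ = ⊥-elim (k≢k′ k≡k′)
  ... | tri> _ _ k′<k = let t , e = ℕ.m≤n⇒∃[o]m+o≡n k′<k ; c′ , e′ = δ-Taylor.T-vʲ* k′ (suc t) in begin
    δ-Taylor.T k (δ ^ k′ * nat c)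
      ≡⟨ ≡.cong (λ n → δ-Taylor.T n (δ ^ k′ * nat c)) (≡.trans (ℕ.+-suc k′ t) e) ⟨
    δ-Taylor.T (k′ ℕ.+ suc t) (δ ^ k′ * nat c)
      ≈⟨ e′ (nat c) ⟩
    nat (suc c′) * δ-Taylor.T (suc t) (nat c)
      ≈⟨ *-congʳ (δ-Taylor.Tᵏ⁺¹-const ≈-refl t) ⟩
    nat (suc c′) * con 0ℚ
      ≈⟨ P.zeroʳ _ ⟩
    con 0ℚ ∎

  Φ : ℕ × ℕ → ℕ × ℕ → ℚ[ Fin 0 ]
  Φ (k , l) (k′ , l′) = coefficientOf k l (δᵏAˡ k′ l′ x)

  Φ-cong : ∀ m {i j} → i ≡ j → Φ m i ≈ Φ m j
  Φ-cong m refl = ≈-refl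

  -- If l′ < l, the degree in x is too small. If l′ = l, the coefficient of xˡ⁺¹ is a constant times
  -- the power k′ of δ, and only the exponents of δ are left to compare.
  Φ-zero : ∀ m i → proj₂ i ≤ proj₂ m → ¬ m ≡ i → Φ m i ≈ con 0ℚ
  Φ-zero (k , l) (k′ , l′) l′≤l m≢i with ℕ.m≤n⇒m<n∨m≡n l′≤l
  ... | inj₁ l′<l = let t , e = ℕ.m≤n⇒∃[o]m+o≡n l′<l in
    ≡.subst (λ l → coefficientOf k l (δᵏAˡ k′ l′ x) ≈ con 0ℚ) e (coefficientOf-< k k′ l′ t)
  ... | inj₂ l′≡l = let c , e = coefficientOf-≡ k k′ l′ in
    ≡.subst (λ l → coefficientOf k l (δᵏAˡ k′ l′ x) ≈ con 0ℚ) l′≡l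
      (≈-trans e (T-δᵏ-≢ k k′ (suc c) λ k≡k′ → m≢i (≡.cong₂ _,_ k≡k′ (≡.sym l′≡l))))

  Φ-unit : ∀ m → ∃ λ c → c ≢ 0ℚ × Φ m m ≈ con c
  Φ-unit (k , l) = let c , e = coefficientOf-≡ k k l ; c′ , e′ = δ-Taylor.T-vʲ* k 0 in
    ν (suc c′ ℕ.* suc c) , ν-suc≢0 (c ℕ.+ c′ ℕ.* suc c) , (begin
    Φ (k , l) (k , l)                        ≈⟨ e ⟩
    δ-Taylor.T k (δ ^ k * nat (suc c))
      ≡⟨ ≡.cong (λ n → δ-Taylor.T n (δ ^ k * nat (suc c))) (ℕ.+-identityʳ k) ⟨
    δ-Taylor.T (k ℕ.+ 0) (δ ^ k * nat (suc c))  ≈⟨ e′ (nat (suc c)) ⟩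
    nat (suc c′) * δ-Taylor.T 0 (nat (suc c))   ≈⟨ *-congʳ (δ-Taylor.T₀ (nat (suc c))) ⟩
    nat (suc c′) * nat (suc c)                  ≈⟨ nat-* (suc c′) (suc c) ⟨
    nat (suc c′ ℕ.* suc c)                      ∎)

  module Operators = Triangular _≡_ (×-≡-dec ℕ._≟_ ℕ._≟_) refl proj₂ Φ
    Φ-cong Φ-zero Φ-unit

δᵏAˡx-independent : ∀ L → eval (λ (k , l) → δᵏAˡ k l x) L ≈ con 0ℚ →
                    (g : ℕ × ℕ → ℚ[ Y ]) → eval g L ≈ con 0ℚ
δᵏAˡx-independent L e g = Operators.vanish L
  (λ (k , l) → let φ = coefficientOf-linear k l in
    ≈-trans (≈-sym (eval-map φ (λ (k , l) → δᵏAˡ k l x) L)) (≈-trans (cong φ e) (0-homo φ)))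
  g (λ { refl → ≈-refl })

-- Newton's identities for operators.

convAct : (ℕ → ℚ[x,y] → ℚ[x,y]) → ℕ → ℚ[x,y] → ℚ[x,y]
convAct a zero    f = a 0 (apply (𝒢 0) f)
convAct a (suc m) f = a 0 (apply (𝒢 (suc m)) f) + convAct (a ∘ suc) m f

-- As in `conv-cancel`, with `𝒢 0` the identity in place of the constant term 1. The argument `f` is
-- quantified because the leading operators are compared at `𝒢 (suc m)` of it.
convAct-cancel : ∀ {a a′ : ℕ → ℚ[x,y] → ℚ[x,y]} → (∀ m f → convAct a m f ≈ convAct a′ m f) →
                 ∀ m f → a m f ≈ a′ m f
convAct-cancel e zero    f = e 0 f
convAct-cancel {a} {a′} e (suc m) f = convAct-cancel {a ∘ suc} {a′ ∘ suc} e′ m f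
  where
  e′ : ∀ m f → convAct (a ∘ suc) m f ≈ convAct (a′ ∘ suc) m f
  e′ m f = P.+-cancelˡ (a 0 (apply (𝒢 (suc m)) f)) _ _
    (≈-trans (e (suc m) f) (+-congˡ (≈-sym (e 0 (apply (𝒢 (suc m)) f)))))

convAct-scale : ∀ t (a : ℕ → ℚ[x,y] → ℚ[x,y]) m f → convAct (λ r g → t * a r g) m f ≈ t * convAct a m f
convAct-scale t a zero    f = ≈-refl
convAct-scale t a (suc m) f = ≈-trans (+-congʳ (convAct-scale t (a ∘ suc) m f)) (≈-sym (distribˡ t _ _))

convAct-cong : ∀ {a a′ : ℕ → ℚ[x,y] → ℚ[x,y]} → (∀ r f → a r f ≈ a′ r f) → ∀ m f → convAct a m f ≈ convAct a′ m f
convAct-cong e zero    f = e 0 f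
convAct-cong e (suc m) f = +-cong (e 0 _) (convAct-cong (e ∘ suc) m f)

-- Splitting off the term r = 0 and taking δ out of the others leaves δ times the sum for m, and
-- `𝒢-step` is the resulting recursion.
convAct-δʳA : ∀ m f → convAct (λ r g → δ ^ r * A g) m f ≈ nat (suc m) * apply (𝒢 (suc m)) f
convAct-δʳA zero f = begin
  con 1ℚ * A f                   ≈⟨ solve 2 (λ a b → :con 1ℚ :* a := a :+ :con 0ℚ :* b) ≈-refl (A f) (δ * f) ⟩
  A f + nat 0 * (δ * f)          ≈⟨ 𝒢-step 0 f ⟨
  nat 1 * apply (𝒢 1) f          ∎
convAct-δʳA (suc m) f = begin
  con 1ℚ * A g + convAct (λ r g → δ * δ ^ r * A g) m f
    ≈⟨ +-cong (*-identityˡ _) (convAct-cong (λ r g → *-assoc δ (δ ^ r) (A g)) m f) ⟩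
  A g + convAct (λ r g → δ * (δ ^ r * A g)) m f
    ≈⟨ +-congʳ (≈-trans (convAct-scale δ (λ r g → δ ^ r * A g) m f) (*-congʳ (convAct-δʳA m f))) ⟩
  A g + δ * (nat (suc m) * g)
    ≈⟨ +-congʳ (P.*-leftComm δ (nat (suc m)) g) ⟩
  A g + nat (suc m) * (δ * g)
    ≈⟨ 𝒢-step (suc m) f ⟨
  nat (2 ℕ.+ m) * apply (𝒢 (2 ℕ.+ m)) f ∎
  where g = apply (𝒢 (suc m)) f

-- Congruence modulo an ideal, and reduction to hooks.

Ideal-neg : {S : Pred ℚ[ X ] 0ℓ} → ∀ {f} → Ideal S f → Ideal S (- f)
Ideal-neg {f = f} p = resp (solve 1 (λ f → :con (ℚ.- 1ℚ) :* f := :- f) ≈-refl f) (con (ℚ.- 1ℚ) *∈ p)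

infix 4 _≡_mod_
record _≡_mod_ (f g : ℚ[ X ]) (S : Pred ℚ[ X ] 0ℓ) : Set where
  constructor congruent
  field difference : Ideal S (f - g)

module _ {S : Pred ℚ[ X ] 0ℓ} where

  ≈⇒mod : ∀ {f g} → f ≈ g → f ≡ g mod S
  ≈⇒mod e = congruent (resp (≈-sym (≈-trans (+-congˡ e) (P.-‿inverseʳ _))) 0∈)

  mod-sym : ∀ {f g} → f ≡ g mod S → g ≡ f mod S
  mod-sym {f} {g} (congruent p) = congruent
    (resp (solve 2 (λ f g → :- (f :+ :- g) := g :+ :- f) ≈-refl f g) (Ideal-neg p))

  mod-trans : ∀ {f g h} → f ≡ g mod S → g ≡ h mod S → f ≡ h mod S
  mod-trans {f} {g} {h} (congruent p) (congruent q) = congruent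
    (resp (solve 3 (λ f g h → (f :+ :- g) :+ (g :+ :- h) := f :+ :- h) ≈-refl f g h) (p +∈ q))

  mod-* : ∀ k {f g} → f ≡ g mod S → k * f ≡ k * g mod S
  mod-* k {f} {g} (congruent p) = congruent
    (resp (solve 3 (λ k f g → k :* (f :+ :- g) := k :* f :+ :- (k :* g)) ≈-refl k f g) (k *∈ p))

  mod-+ : ∀ {f f′ g g′} → f ≡ f′ mod S → g ≡ g′ mod S → f + g ≡ f′ + g′ mod S
  mod-+ {f} {f′} {g} {g′} (congruent p) (congruent q) = congruent
    (resp (solve 4 (λ f f′ g g′ → (f :+ :- f′) :+ (g :+ :- g′) := (f :+ g) :+ :- (f′ :+ g′)) ≈-refl f f′ g g′) (p +∈ q))

  eval-mod : ∀ {I : Set} {g g′ : I → ℚ[ X ]} → (∀ i → g i ≡ g′ i mod S) → ∀ L → eval g L ≡ eval g′ L mod S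
  eval-mod e []            = ≈⇒mod ≈-refl
  eval-mod e ((c , i) ∷ L) = mod-+ (mod-* (con c) (e i)) (eval-mod e L)

-- p_{k+1} p₁ˡ⁻¹, which ρ maps to δᵏ Aˡ (for l = 0 only when k = 0).
hookIndices : ℕ × ℕ → List ℕ
hookIndices (k , zero)  = []
hookIndices (k , suc l) = k ∷ List.replicate l 0

hook : (ℕ → ℚ[ X ]) → ℕ × ℕ → ℚ[ X ]
hook p kl = mon p (hookIndices kl)

-- For a partition of n with ℓ parts this is (n - ℓ, ℓ), the indices being the parts minus one.
sumLength : List ℕ → ℕ × ℕ
sumLength rs = ListAction.sum rs , length rs

module _ (p : ℕ → Λ) where
  private
    p₊ : ℕ → Λ
    p₊ r = p (suc r)

  -- Each generator moves one unit from the smaller index to the larger, until the smaller is 0,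
  -- that is, the part 1. The hypothesis `r ≤ s` persists and guarantees i < j at every move.
  exchange : ∀ r s → r ≤ s → p₊ r * p₊ s ≡ p₊ (r ℕ.+ s) * p₊ 0 mod Relation p
  exchange zero    s _   = ≈⇒mod (*-comm _ _)
  exchange (suc r) s r<s = mod-trans
    (mod-sym (congruent (gen (suc r , suc s , s≤s z≤n , s≤s r<s , refl))))
    (≡.subst (λ n → p₊ r * p₊ (suc s) ≡ p₊ n * p₊ 0 mod Relation p) (ℕ.+-suc r s)
      (exchange r (suc s) (ℕ.≤-trans (ℕ.n≤1+n r) (ℕ.m≤n⇒m≤1+n r<s))))

  exchange′ : ∀ r s → p₊ r * p₊ s ≡ p₊ (r ℕ.+ s) * p₊ 0 mod Relation p
  exchange′ r s with ℕ.≤-total r s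
  ... | inj₁ r≤s = exchange r s r≤s
  ... | inj₂ s≤r = mod-trans (≈⇒mod (*-comm _ _))
    (≡.subst (λ n → p₊ s * p₊ r ≡ p₊ n * p₊ 0 mod Relation p) (ℕ.+-comm s r) (exchange s r s≤r))

  -- Induction: the head is exchanged against the long part of the hook of the tail, which grows
  -- while the head becomes another p₁.
  mon≡hook : ∀ rs → mon p₊ rs ≡ hook p₊ (sumLength rs) mod Relation p
  mon≡hook []           = ≈⇒mod ≈-refl
  mon≡hook (r ∷ [])     = ≈⇒mod (*-congˡ (≡⇒≈ (≡.cong p₊ (≡.sym (ℕ.+-identityʳ r)))))
  mon≡hook (r ∷ s ∷ rs) = mod-trans (mod-* (p₊ r) (mon≡hook (s ∷ rs)))
    (mod-trans (≈⇒mod (≈-trans (≈-sym (*-assoc _ _ _)) (*-comm _ _)))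
    (mod-trans (mod-* _ (exchange′ r (s ℕ.+ ListAction.sum rs)))
    (≈⇒mod (≈-trans (*-comm _ _) (*-assoc _ _ _)))))

-- The image of the power sums and the kernel of ρ.

module Representation (ρ : Λ → End) (ρ-isAlgebraHomomorphism : IsAlgebraHomomorphism ρ)
  (ρ-h : ∀ r → ρ (h r) ≈ᴱ 𝒢 r) (p : ℕ → Λ) (p-powerSum : ∀ m → 1 ≤ m → IsPowerSum m (p m)) where

  open IsAlgebraHomomorphism ρ-isAlgebraHomomorphism
  open RingMorphisms.IsRingHomomorphism isRingHomomorphism public
    using () renaming (⟦⟧-cong to ρ-cong; +-homo to ρ-+; *-homo to ρ-*;
             -‿homo to ρ-neg; 1#-homo to ρ-1; 0#-homo to ρ-0)
  open LeftModuleMorphisms.IsLeftModuleHomomorphism isLinear public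
    using () renaming (*ₗ-homo to ρ-·)

  p₊ : ℕ → Λ
  p₊ r = p (suc r)

  p₊-powerSums : IsPowerSums p₊
  p₊-powerSums N r = p-powerSum (suc r) (s≤s z≤n) N

  p₊-newton : Newton p₊ h
  p₊-newton = powerSums-newton p₊-powerSums

  ρ⟨_⟩ : Λ → ℚ[x,y] → ℚ[x,y]
  ρ⟨ f ⟩ = apply (ρ f)

  ρ⟨⟩-linear : ∀ f → Linear ρ⟨ f ⟩
  ρ⟨⟩-linear f = End-linear (ρ f)

  ρ-conv : ∀ (a : ℕ → Λ) m f → ρ⟨ conv a h m ⟩ f ≈ convAct (λ r → ρ⟨ a r ⟩) m f
  ρ-conv a zero    f = ≈-trans (ρ-* (a 0) (h 0) f) (cong (ρ⟨⟩-linear (a 0)) (ρ-h 0 f))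
  ρ-conv a (suc m) f = ≈-trans (ρ-+ (a 0 * h (suc m)) _ f)
    (+-cong (≈-trans (ρ-* (a 0) (h (suc m)) f) (cong (ρ⟨⟩-linear (a 0)) (ρ-h (suc m) f))) (ρ-conv (a ∘ suc) m f))

  -- Both families solve the image of Newton's identities under ρ, whose solution is unique.
  ρ-p : ∀ r f → ρ⟨ p₊ r ⟩ f ≈ δ ^ r * A f
  ρ-p = convAct-cancel λ m f → begin
    convAct (λ r → ρ⟨ p₊ r ⟩) m f          ≈⟨ ρ-conv p₊ m f ⟨
    ρ⟨ conv p₊ h m ⟩ f                     ≈⟨ ρ-cong (p₊-newton m) f ⟩
    ρ⟨ nat (suc m) * h (suc m) ⟩ f         ≈⟨ ρ-· (ν (suc m)) (h (suc m)) f ⟩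
    nat (suc m) * ρ⟨ h (suc m) ⟩ f         ≈⟨ *-congʳ (ρ-h (suc m) f) ⟩
    nat (suc m) * apply (𝒢 (suc m)) f      ≈⟨ convAct-δʳA m f ⟨
    convAct (λ r g → δ ^ r * A g) m f      ∎

  ρ-mon : ∀ rs f → ρ⟨ mon p₊ rs ⟩ f ≈ δᵏAˡ (ListAction.sum rs) (length rs) f
  ρ-mon []       f = ≈-trans (ρ-1 f) (≈-sym (*-identityˡ f))
  ρ-mon (r ∷ rs) f = begin
    ρ⟨ p₊ r * mon p₊ rs ⟩ f              ≈⟨ ρ-* (p₊ r) (mon p₊ rs) f ⟩
    ρ⟨ p₊ r ⟩ (ρ⟨ mon p₊ rs ⟩ f)         ≈⟨ cong (ρ⟨⟩-linear (p₊ r)) (ρ-mon rs f) ⟩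
    ρ⟨ p₊ r ⟩ (δ ^ s * fold f A l)       ≈⟨ ρ-p r _ ⟩
    δ ^ r * A (δ ^ s * fold f A l)       ≈⟨ *-congʳ (A-δᵏ s (fold f A l)) ⟩
    δ ^ r * (δ ^ s * A (fold f A l))     ≈⟨ *-assoc _ _ _ ⟨
    δ ^ r * δ ^ s * A (fold f A l)       ≈⟨ *-congˡ (^-+ δ r s) ⟨
    δ ^ (r ℕ.+ s) * A (fold f A l)       ∎
    where s = ListAction.sum rs
          l = length rs

  evalAt-linear : ∀ f → Linear (λ g → ρ⟨ g ⟩ f)
  evalAt-linear f = record
    { cong   = λ e → ρ-cong e f
    ; +-homo = λ g g′ → ρ-+ g g′ f
    ; ·-homo = λ c g → ρ-· c g f }

  -- Under ρ a product is remembered only through the pair `sumLength`. The combination of these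
  -- pairs annihilates x, so by independence it is formally zero, and therefore zero also on hook
  -- products in Λ.
  hook-vanishes : ∀ L → ρ (eval (mon p₊) L) ≈ᴱ 0ᴱ → eval (hook p₊ ∘ sumLength) L ≈ con 0ℚ
  hook-vanishes L e = ≈-trans (≈-sym (≡⇒≈ (eval-reindex sumLength (hook p₊) L)))
    (δᵏAˡx-independent (reindex sumLength L) (begin
    eval (λ (k , l) → δᵏAˡ k l x) (reindex sumLength L)  ≡⟨ eval-reindex sumLength (λ (k , l) → δᵏAˡ k l x) L ⟩
    eval (λ rs → δᵏAˡ (ListAction.sum rs) (length rs) x) L  ≈⟨ eval-cong (λ rs → ρ-mon rs x) L ⟨
    eval (λ rs → ρ⟨ mon p₊ rs ⟩ x) L                 ≈⟨ eval-map (evalAt-linear x) (mon p₊) L ⟨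
    ρ⟨ eval (mon p₊) L ⟩ x                           ≈⟨ e x ⟩
    con 0ℚ                                           ∎) (hook p₊))

  -- Modulo the relations `f` becomes the same combination of hook products, which is zero in Λ
  -- itself and not merely under ρ.
  kernel⊆ideal : ∀ f → ρ f ≈ᴱ 0ᴱ → Ideal (Relation p) f
  kernel⊆ideal f ρf≈0 with Span⇒Combination {g = mon p₊} id (p-spans p₊-newton f)
  ... | L , f≈L = zero-mod (mod-trans (≈⇒mod f≈L) (mod-trans (eval-mod (mon≡hook p) L) (≈⇒mod
    (hook-vanishes L λ g → ≈-trans (ρ-cong (≈-sym f≈L) g) (ρf≈0 g)))))
    where
    zero-mod : f ≡ con 0ℚ mod Relation p → Ideal (Relation p) f
    zero-mod (congruent q) = resp (solve 1 (λ f → f :+ :- :con 0ℚ := f) ≈-refl f) q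

  -- The two terms of a generator have the same number of factors and the same total degree, and ρ
  -- depends on nothing else.
  ideal⊆kernel : ∀ {f} → Ideal (Relation p) f → ρ f ≈ᴱ 0ᴱ
  ideal⊆kernel (gen (suc i , suc j , s≤s z≤n , _ , refl)) g = begin
    ρ⟨ p₊ i * p₊ (suc j) - p₊ (suc i) * p₊ j ⟩ g
      ≈⟨ ≈-trans (ρ-+ (p₊ i * p₊ (suc j)) _ g) (+-congʳ (ρ-neg (p₊ (suc i) * p₊ j) g)) ⟩
    ρ⟨ p₊ i * p₊ (suc j) ⟩ g - ρ⟨ p₊ (suc i) * p₊ j ⟩ g
      ≈⟨ +-cong (two i (suc j)) (-‿cong (two (suc i) j)) ⟩
    δ ^ (i ℕ.+ suc j) * A (A g) - δ ^ (suc i ℕ.+ j) * A (A g)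
      ≈⟨ +-congˡ (*-congˡ (≡⇒≈ (≡.cong (δ ^_) (ℕ.+-suc i j)))) ⟩
    δ ^ (suc i ℕ.+ j) * A (A g) - δ ^ (suc i ℕ.+ j) * A (A g)
      ≈⟨ P.-‿inverseʳ _ ⟩
    con 0ℚ ∎
    where
    two : ∀ i j → ρ⟨ p₊ i * p₊ j ⟩ g ≈ δ ^ (i ℕ.+ j) * A (A g)
    two i j = ≈-trans (ρ-cong (*-congʳ (≈-sym (P.*-identityʳ (p₊ j)))) g)
      (≈-trans (ρ-mon (i ∷ j ∷ []) g) (*-congˡ (≡⇒≈ (≡.cong (λ k → δ ^ (i ℕ.+ k)) (ℕ.+-identityʳ j)))))
  ideal⊆kernel 0∈                 g = ρ-0 g
  ideal⊆kernel (_+∈_ {f} {f′} p q) g = ≈-trans (ρ-+ f f′ g)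
    (≈-trans (+-cong (ideal⊆kernel p g) (ideal⊆kernel q g)) (+-identityˡ _))
  ideal⊆kernel (_*∈_ k {f} p)     g = ≈-trans (ρ-* k f g)
    (≈-trans (cong (ρ⟨⟩-linear k) (ideal⊆kernel p g)) (0-homo (ρ⟨⟩-linear k)))
  ideal⊆kernel (resp e p)         g = ≈-trans (≈-sym (ρ-cong e g)) (ideal⊆kernel p g)

-- The derivation E. An abstract ring stands for ℚ(x, y), whose equality computes too eagerly for
-- implicit arguments to be inferred.

module Field (F : CommutativeRing 0ℓ 0ℓ) where
  private module F = CommutativeRing F

  infixr 2 _∼⟨_⟩_ _∼⟨_⟨_
  infix  3 _∎′

  _∼⟨_⟩_ : ∀ p {q r} → p F.≈ q → q F.≈ r → p F.≈ r
  p ∼⟨ e ⟩ e′ = F.trans e e′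

  _∼⟨_⟨_ : ∀ p {q r} → q F.≈ p → q F.≈ r → p F.≈ r
  p ∼⟨ e ⟨ e′ = F.trans (F.sym e) e′

  _∎′ : ∀ p → p F.≈ p
  p ∎′ = F.refl

  module DerivationOver (ι : ℚ[x,y] → F.Carrier)
    (ι-cong : ∀ {f g} → f ≈ g → ι f F.≈ ι g) (ι-0 : ι (con 0ℚ) F.≈ F.0#) (ι-1 : ι (con 1ℚ) F.≈ F.1#)
    (ι-+ : ∀ f g → ι (f + g) F.≈ ι f F.+ ι g) (ι-* : ∀ f g → ι (f * g) F.≈ ι f F.* ι g)
    (u : F.Carrier) (u-y : u F.* ι y F.≈ ι x)
    (E : F.Carrier → F.Carrier) (E-cong : ∀ {p q} → p F.≈ q → E p F.≈ E q)
    (E-+ : ∀ p q → E (p F.+ q) F.≈ E p F.+ E q) (E-· : ∀ c p → E (ι (con c) F.* p) F.≈ ι (con c) F.* E p)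
    (E-leibniz : ∀ p q → E (p F.* q) F.≈ E p F.* q F.+ p F.* E q)
    (E-δ : E (ι δ) F.≈ F.0#) (E-u : E u F.≈ u) where

    open GroupProperties F.+-group using () renaming (∙-cancelˡ to F-+-cancelˡ; ∙-cancelʳ to F-+-cancelʳ)
    open CommutativeSemigroupProperties F.*-commutativeSemigroup using () renaming (x∙yz≈y∙xz to F-leftComm)
    open RawSemiringOps (RawRing.rawSemiring (CommutativeRing.rawRing F)) using () renaming (sum to F-sum)

    E-1 : E F.1# F.≈ F.0#
    E-1 = F-+-cancelˡ (E F.1#) _ _ (
      E F.1# F.+ E F.1#                       ∼⟨ F.+-cong (F.*-identityʳ _) (F.*-identityˡ _) ⟨
      E F.1# F.* F.1# F.+ F.1# F.* E F.1#     ∼⟨ E-leibniz F.1# F.1# ⟨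
      E (F.1# F.* F.1#)                       ∼⟨ E-cong (F.*-identityˡ F.1#) ⟩
      E F.1#                                  ∼⟨ F.+-identityʳ _ ⟨
      E F.1# F.+ F.0#                         ∎′)

    E-con : ∀ c → E (ι (con c)) F.≈ F.0#
    E-con c =
      E (ι (con c))             ∼⟨ E-cong (F.*-identityʳ _) ⟨
      E (ι (con c) F.* F.1#)    ∼⟨ E-· c F.1# ⟩
      ι (con c) F.* E F.1#      ∼⟨ F.*-congˡ E-1 ⟩
      ι (con c) F.* F.0#        ∼⟨ F.zeroʳ _ ⟩
      F.0#                      ∎′

    y≈δ+x : ι y F.≈ ι δ F.+ ι x
    y≈δ+x = F.trans (ι-cong (solve 2 (λ x y → y := (y :+ :- x) :+ x) ≈-refl x y)) (ι-+ δ x)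

    E-y : E (ι y) F.≈ E (ι x)
    E-y =
      E (ι y)                 ∼⟨ E-cong y≈δ+x ⟩
      E (ι δ F.+ ι x)         ∼⟨ E-+ _ _ ⟩
      E (ι δ) F.+ E (ι x)     ∼⟨ F.+-congʳ E-δ ⟩
      F.0# F.+ E (ι x)        ∼⟨ F.+-identityˡ _ ⟩
      E (ι x)                 ∎′

    -- Apply E to x = uy: since Eu = u and Ey = Ex, this reads Ex = x + u Ex. Multiply by y and
    -- cancel x Ex.
    δ*E-x : ι δ F.* E (ι x) F.≈ ι (x * y)
    δ*E-x = F-+-cancelʳ (ι x F.* E (ι x)) _ _ (
      ι δ F.* E (ι x) F.+ ι x F.* E (ι x)   ∼⟨ F.distribʳ _ _ _ ⟨
      (ι δ F.+ ι x) F.* E (ι x)             ∼⟨ F.*-congʳ y≈δ+x ⟨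
      ι y F.* E (ι x)                       ∼⟨ F.*-congˡ (E-cong u-y) ⟨
      ι y F.* E (u F.* ι y)                 ∼⟨ F.*-congˡ (E-leibniz u (ι y)) ⟩
      ι y F.* (E u F.* ι y F.+ u F.* E (ι y))
        ∼⟨ F.*-congˡ (F.+-cong (F.trans (F.*-congʳ E-u) u-y) (F.*-congˡ E-y)) ⟩
      ι y F.* (ι x F.+ u F.* E (ι x))       ∼⟨ F.distribˡ _ _ _ ⟩
      ι y F.* ι x F.+ ι y F.* (u F.* E (ι x))
        ∼⟨ F.+-cong (F.trans (F.*-comm _ _) (F.sym (ι-* x y)))
                    (F.trans (F-leftComm _ _ _) (F.trans (F.sym (F.*-assoc _ _ _)) (F.*-congʳ u-y))) ⟩
      ι (x * y) F.+ ι x F.* E (ι x)         ∎′)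

    -- Both sides are derivations along ι that vanish on constants, so it suffices to compare them
    -- at x and y.
    ι-A : ∀ f → ι (A f) F.≈ ι δ F.* E (ι f)
    ι-A (con c) =
      ι (A (con c))             ∼⟨ ι-cong (≈-trans (*-congʳ (+-identityˡ _)) (P.zeroʳ _)) ⟩
      ι (con 0ℚ)                ∼⟨ ι-0 ⟩
      F.0#                      ∼⟨ F.zeroʳ _ ⟨
      ι δ F.* F.0#              ∼⟨ F.*-congˡ (E-con c) ⟨
      ι δ F.* E (ι (con c))     ∎′
    ι-A (var zero) = F.trans (ι-cong (≈-trans (*-congʳ Dx≈1) (P.*-identityʳ _))) (F.sym δ*E-x)
    ι-A (var (suc zero)) = F.trans (ι-cong (≈-trans (*-congʳ Dy≈1) (P.*-identityʳ _)))
      (F.trans (F.sym δ*E-x) (F.*-congˡ (F.sym E-y)))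
    ι-A (f + g) =
      ι (A (f + g))                           ∼⟨ ι-cong (+-homo A-linear f g) ⟩
      ι (A f + A g)                           ∼⟨ ι-+ _ _ ⟩
      ι (A f) F.+ ι (A g)                     ∼⟨ F.+-cong (ι-A f) (ι-A g) ⟩
      ι δ F.* E (ι f) F.+ ι δ F.* E (ι g)     ∼⟨ F.distribˡ _ _ _ ⟨
      ι δ F.* (E (ι f) F.+ E (ι g))           ∼⟨ F.*-congˡ (E-+ _ _) ⟨
      ι δ F.* E (ι f F.+ ι g)                 ∼⟨ F.*-congˡ (E-cong (ι-+ f g)) ⟨
      ι δ F.* E (ι (f + g))                   ∎′
    ι-A (f * g) =
      ι (A (f * g))
        ∼⟨ ι-cong (≈-trans (*-congʳ (D-leibniz f g))
             (solve 5 (λ m f g f′ g′ → m :* (f′ :* g :+ f :* g′) := m :* f′ :* g :+ f :* (m :* g′))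
                ≈-refl (x * y) f g (apply D f) (apply D g))) ⟩
      ι (A f * g + f * A g)
        ∼⟨ F.trans (ι-+ _ _) (F.+-cong (ι-* _ _) (ι-* _ _)) ⟩
      ι (A f) F.* ι g F.+ ι f F.* ι (A g)
        ∼⟨ F.+-cong (F.*-congʳ (ι-A f)) (F.*-congˡ (ι-A g)) ⟩
      ι δ F.* E (ι f) F.* ι g F.+ ι f F.* (ι δ F.* E (ι g))
        ∼⟨ F.+-cong (F.*-assoc _ _ _) (F-leftComm _ _ _) ⟩
      ι δ F.* (E (ι f) F.* ι g) F.+ ι δ F.* (ι f F.* E (ι g))
        ∼⟨ F.distribˡ _ _ _ ⟨
      ι δ F.* (E (ι f) F.* ι g F.+ ι f F.* E (ι g))
        ∼⟨ F.*-congˡ (E-leibniz _ _) ⟨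
      ι δ F.* E (ι f F.* ι g)
        ∼⟨ F.*-congˡ (E-cong (ι-* f g)) ⟨
      ι δ F.* E (ι (f * g)) ∎′
    ι-A (- f) =
      ι (A (- f))
        -- Additivity and ℚ-linearity are what is given for E, so negation is written as
        -- multiplication by -1.
        ∼⟨ ι-cong (cong A-linear -f) ⟩
      ι (A (−1 · f))
        ∼⟨ ι-cong (·-homo A-linear −1 f) ⟩
      ι (−1 · A f)
        ∼⟨ F.trans (ι-* _ _) (F.*-congˡ (ι-A f)) ⟩
      ι (con −1) F.* (ι δ F.* E (ι f))
        ∼⟨ F-leftComm _ _ _ ⟩
      ι δ F.* (ι (con −1) F.* E (ι f))
        ∼⟨ F.*-congˡ (E-· −1 (ι f)) ⟨
      ι δ F.* E (ι (con −1) F.* ι f)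
        ∼⟨ F.*-congˡ (E-cong (F.trans (ι-cong -f) (ι-* _ _))) ⟨
      ι δ F.* E (ι (- f)) ∎′
      where
      −1 : ℚ
      −1 = ℚ.- 1ℚ
      -f : - f ≈ −1 · f
      -f = solve 1 (λ f → :- f := :con (ℚ.- 1ℚ) :* f) ≈-refl f

    E-δᵏ : ∀ k → E (ι (δ ^ k)) F.≈ F.0#
    E-δᵏ zero    = E-con 1ℚ
    E-δᵏ (suc k) =
      E (ι (δ * δ ^ k))                                   ∼⟨ F.trans (E-cong (ι-* _ _)) (E-leibniz _ _) ⟩
      E (ι δ) F.* ι (δ ^ k) F.+ ι δ F.* E (ι (δ ^ k))     ∼⟨ F.+-cong (F.*-congʳ E-δ) (F.*-congˡ (E-δᵏ k)) ⟩
      F.0# F.* ι (δ ^ k) F.+ ι δ F.* F.0#                 ∼⟨ F.+-cong (F.zeroˡ _) (F.zeroʳ _) ⟩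
      F.0# F.+ F.0#                                       ∼⟨ F.+-identityˡ _ ⟩
      F.0#                                                ∎′

    E-δᵏ* : ∀ k q → E (ι (δ ^ k) F.* q) F.≈ ι (δ ^ k) F.* E q
    E-δᵏ* k q =
      E (ι (δ ^ k) F.* q)                           ∼⟨ E-leibniz _ _ ⟩
      E (ι (δ ^ k)) F.* q F.+ ι (δ ^ k) F.* E q     ∼⟨ F.+-congʳ (F.trans (F.*-congʳ (E-δᵏ k)) (F.zeroˡ _)) ⟩
      F.0# F.+ ι (δ ^ k) F.* E q                    ∼⟨ F.+-identityˡ _ ⟩
      ι (δ ^ k) F.* E q                             ∎′

    ι-Aˡ : ∀ l f → ι (fold f A l) F.≈ ι (δ ^ l) F.* fold (ι f) E l
    ι-Aˡ zero    f = F.sym (F.trans (F.*-congʳ ι-1) (F.*-identityˡ _))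
    ι-Aˡ (suc l) f =
      ι (A (fold f A l))                              ∼⟨ ι-A _ ⟩
      ι δ F.* E (ι (fold f A l))                      ∼⟨ F.*-congˡ (E-cong (ι-Aˡ l f)) ⟩
      ι δ F.* E (ι (δ ^ l) F.* fold (ι f) E l)        ∼⟨ F.*-congˡ (E-δᵏ* l _) ⟩
      ι δ F.* (ι (δ ^ l) F.* E (fold (ι f) E l))      ∼⟨ F.*-assoc _ _ _ ⟨
      ι δ F.* ι (δ ^ l) F.* E (fold (ι f) E l)        ∼⟨ F.*-congʳ (ι-* _ _) ⟨
      ι (δ * δ ^ l) F.* E (fold (ι f) E l)            ∎′

    ι-δᵏAˡ : ∀ k l f → ι (δᵏAˡ k l f) F.≈ ι (δ ^ (k ℕ.+ l)) F.* fold (ι f) E l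
    ι-δᵏAˡ k l f =
      ι (δ ^ k * fold f A l)                          ∼⟨ F.trans (ι-* _ _) (F.*-congˡ (ι-Aˡ l f)) ⟩
      ι (δ ^ k) F.* (ι (δ ^ l) F.* fold (ι f) E l)    ∼⟨ F.*-assoc _ _ _ ⟨
      ι (δ ^ k) F.* ι (δ ^ l) F.* fold (ι f) E l      ∼⟨ F.*-congʳ (F.trans (ι-cong (^-+ δ k l)) (ι-* _ _)) ⟨
      ι (δ ^ (k ℕ.+ l)) F.* fold (ι f) E l            ∎′

    ι-sum : ∀ {n} (g : ℚ[x,y]) (c : Fin n → ℚ) (t : Fin n → ℚ[x,y]) (v : Fin n → F.Carrier) →
            (∀ i → ι (t i) F.≈ ι g F.* v i) →
            ι (sum (λ i → c i · t i)) F.≈ ι g F.* F-sum (λ i → ι (con (c i)) F.* v i)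
    ι-sum {zero}  g c t v e = F.trans ι-0 (F.sym (F.zeroʳ _))
    ι-sum {suc n} g c t v e =
      ι (c zero · t zero + sum (λ i → c (suc i) · t (suc i)))
        ∼⟨ F.trans (ι-+ _ _) (F.+-cong (ι-* _ _) (ι-sum g (c ∘ suc) (t ∘ suc) (v ∘ suc) (e ∘ suc))) ⟩
      ι (con (c zero)) F.* ι (t zero) F.+ ι g F.* S
        ∼⟨ F.+-congʳ (F.trans (F.*-congˡ (e zero)) (F-leftComm _ _ _)) ⟩
      ι g F.* (ι (con (c zero)) F.* v zero) F.+ ι g F.* S
        ∼⟨ F.distribˡ _ _ _ ⟨
      ι g F.* (ι (con (c zero)) F.* v zero F.+ S) ∎′
      where S = F-sum (λ i → ι (con (c (suc i))) F.* v (suc i))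

module _ {E : ℚ⟨x,y⟩ → ℚ⟨x,y⟩} (E-isDerivation : IsDerivation E)
  (E-δ : E (ι δ) ≈ᶠ ι (con 0ℚ)) (E-u : E u ≈ᶠ u) where
  private
    module E = IsDerivation E-isDerivation

    E-cong : ∀ {p q} → p ≈ᶠ q → E p ≈ᶠ E q
    E-cong {p} {q} = E.cong {p} {q}

    ι-+ : ∀ f g → ι (f + g) ≈ᶠ ι f +ᶠ ι g
    ι-+ = solve 2 (λ f g → (f :+ g) :* (:con 1ℚ :* :con 1ℚ) := (f :* :con 1ℚ :+ g :* :con 1ℚ) :* :con 1ℚ) ≈-refl

    ι-* : ∀ f g → ι (f * g) ≈ᶠ ι f *ᶠ ι g
    ι-* f g = *-congʳ (*-identityˡ (con 1ℚ))

    u-y : u *ᶠ ι y ≈ᶠ ι x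
    u-y = ≈-trans (P.*-identityʳ _) (*-congʳ (≈-sym (P.*-identityʳ y)))

  module Fraction = Field.DerivationOver fractionField ι *-congˡ ≈-refl ≈-refl ι-+ ι-* u u-y
    E E-cong E.+-homo E.·-homo E.leibniz E-δ E-u

-- Enumeration of the partitions of n, hooks first.

lookup-injective : ∀ {A : Set} {xs : List A} → Unique xs → ∀ i j → lookup xs i ≡ lookup xs j → i ≡ j
lookup-injective (x∉ ∷ _) zero    zero    e = refl
lookup-injective (x∉ ∷ _) zero    (suc j) e = ⊥-elim (All.lookup x∉ (∈.∈-lookup j) e)
lookup-injective (x∉ ∷ _) (suc i) zero    e = ⊥-elim (All.lookup x∉ (∈.∈-lookup i) (≡.sym e))
lookup-injective (_ ∷ u)  (suc i) (suc j) e = ≡.cong suc (lookup-injective u i j e)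

enumeration⇒↔ : ∀ {A : Set} {xs : List A} → Unique xs → (∀ a → a ∈ xs) → Fin (length xs) ↔ A
enumeration⇒↔ {xs = xs} u complete = mk↔ₛ′ (lookup xs) (λ a → Any.index (complete a))
  (λ a → ≡.sym (Any.lookup-index (complete a)))
  (λ i → lookup-injective u _ i (≡.sym (Any.lookup-index (complete (lookup xs i)))))

weight≡sum+length : ∀ rs → weight rs ≡ ListAction.sum rs ℕ.+ length rs
weight≡sum+length []       = refl
weight≡sum+length (r ∷ rs) = ≡.trans (≡.cong (suc r ℕ.+_) (weight≡sum+length rs))
  (≡.trans (≡.cong suc (≡.sym (ℕ.+-assoc r _ _))) (≡.sym (ℕ.+-suc (r ℕ.+ ListAction.sum rs) (length rs))))

-- A crude finite superset: a partition of n has at most n parts, with indices below n. Different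
-- orders of the same parts occur; these repetitions are removed by `deduplicate` later.
boundedLists : ℕ → ℕ → List (List ℕ)
boundedLists b zero    = [] ∷ []
boundedLists b (suc k) = [] ∷ List.cartesianProductWith _∷_ (List.upTo b) (boundedLists b k)

∈-boundedLists : ∀ {b} k {rs} → All (_< b) rs → length rs ≤ k → rs ∈ boundedLists b k
∈-boundedLists zero    []      _       = here refl
∈-boundedLists (suc k) []      _       = here refl
∈-boundedLists (suc k) (r ∷ R) (s≤s b) = there (∈.∈-cartesianProductWith⁺ _∷_ (∈.∈-upTo⁺ r) (∈-boundedLists k R b))

index<weight : ∀ rs → All (_< weight rs) rs
index<weight []       = []
index<weight (r ∷ rs) = ℕ.m≤m+n (suc r) _ ∷ All.map (λ b → ℕ.≤-trans b (ℕ.m≤n+m (weight rs) (suc r))) (index<weight rs)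

sumLength-hook : ∀ k l → sumLength (hookIndices (k , suc l)) ≡ (k , suc l)
sumLength-hook k l = ≡.cong₂ _,_
  (≡.trans (≡.cong (k ℕ.+_) (sum-zeros l)) (ℕ.+-identityʳ k)) (≡.cong suc (List.length-replicate l))
  where
  sum-zeros : ∀ l → ListAction.sum (List.replicate l 0) ≡ 0
  sum-zeros zero    = refl
  sum-zeros (suc l) = sum-zeros l

sumLength-hookIndices : ∀ rs → sumLength (hookIndices (sumLength rs)) ≡ sumLength rs
sumLength-hookIndices []       = refl
sumLength-hookIndices (r ∷ rs) = sumLength-hook (ListAction.sum (r ∷ rs)) (length rs)

sumLength-↭ : ∀ {rs ss} → rs ↭ ss → sumLength rs ≡ sumLength ss
sumLength-↭ p = ≡.cong₂ _,_ (ListAction.sum-↭ p) (↭.↭-length p)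

weight-hookIndices : ∀ rs → weight (hookIndices (sumLength rs)) ≡ weight rs
weight-hookIndices rs = ≡.trans (weight≡sum+length (hookIndices (sumLength rs)))
  (≡.trans (≡.cong (λ (k , l) → k ℕ.+ l) (sumLength-hookIndices rs)) (≡.sym (weight≡sum+length rs)))

module _ {n : ℕ} where

  _≟ᴾ_ : DecidableEquality (Partition n)
  lam ≟ᴾ mu = map′ Partition-≡ (≡.cong parts) (List.≡-dec ℕ._≟_ (parts lam) (parts mu))

  indices-fromIndices : ∀ rs e → indices (fromIndices {n} rs e) ↭ rs
  indices-fromIndices rs e = ↭-trans (↭.map⁺ ℕ.pred (sort-↭ (List.map suc rs)))
    (↭-reflexive (≡.trans (≡.sym (List.map-∘ rs)) (List.map-id rs)))

  fromIndices-indices : ∀ {rs} lam e → indices lam ↭ rs → lam ≡ fromIndices rs e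
  fromIndices-indices lam e p = indices-injective (↭-trans p (↭-sym (indices-fromIndices _ e)))

  partitionsWith : List ℕ → List (Partition n)
  partitionsWith rs with weight rs ℕ.≟ n
  ... | yes e = fromIndices rs e ∷ []
  ... | no  _ = []

  partitions : List (Partition n)
  partitions = List.concatMap partitionsWith (boundedLists n n)

  ∈-partitions : ∀ lam → lam ∈ partitions
  ∈-partitions lam = ∈.∈-concatMap⁺ partitionsWith
    (Any.map (λ { refl → ∈-partitionsWith })
      (∈-boundedLists n (≡.subst (λ m → All (_< m) _) (weight-indices lam) (index<weight (indices lam)))
        (ℕ.≤-trans (ℕ.m≤n+m _ _)
          (ℕ.≤-reflexive (≡.trans (≡.sym (weight≡sum+length (indices lam))) (weight-indices lam))))))
    where
    ∈-partitionsWith : lam ∈ partitionsWith (indices lam)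
    ∈-partitionsWith with weight (indices lam) ℕ.≟ n
    ... | yes e = here (fromIndices-indices lam e ↭-refl)
    ... | no ¬e = ⊥-elim (¬e (weight-indices lam))

module Hooks (m : ℕ) where

  -- In degree n = m + 1 the index `i` stands for the length ℓ = i + 1, and n - ℓ = m - i.
  hookAt : Fin (suc m) → List ℕ
  hookAt i = hookIndices (m ∸ toℕ i , suc (toℕ i))

  weight-hookAt : ∀ i → weight (hookAt i) ≡ suc m
  weight-hookAt i = ≡.trans (weight≡sum+length (hookAt i)) (≡.trans
    (≡.cong (λ (k , l) → k ℕ.+ l) (sumLength-hook (m ∸ toℕ i) (toℕ i)))
    (≡.trans (ℕ.+-suc (m ∸ toℕ i) (toℕ i)) (≡.cong suc (ℕ.m∸n+n≡m (ℕ.≤-pred (Fin.toℕ<n i))))))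

  hookAt-complete : ∀ rs → weight rs ≡ suc m → ∃ λ i → hookIndices (sumLength rs) ≡ hookAt i
  hookAt-complete (r ∷ rs) e = i , ≡.cong hookIndices (≡.cong₂ _,_
    (≡.trans (≡.sym (ℕ.m+n∸n≡m s l)) (≡.cong₂ _∸_ s+l≡m (≡.sym toℕ-i)))
    (≡.cong suc (≡.sym toℕ-i)))
    where
    s = ListAction.sum (r ∷ rs)
    l = length rs
    s+l≡m : s ℕ.+ l ≡ m
    s+l≡m = ℕ.suc-injective (≡.trans (≡.sym (ℕ.+-suc s l)) (≡.trans (≡.sym (weight≡sum+length (r ∷ rs))) e))
    l<1+m : l < suc m
    l<1+m = s≤s (≡.subst (l ≤_) s+l≡m (ℕ.m≤n+m l s))
    i = fromℕ< l<1+m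
    toℕ-i : toℕ i ≡ l
    toℕ-i = Fin.toℕ-fromℕ< l<1+m

  hookPartition : Fin (suc m) → Partition (suc m)
  hookPartition i = fromIndices (hookAt i) (weight-hookAt i)

  hookPartition-injective : ∀ {i j} → hookPartition i ≡ hookPartition j → i ≡ j
  hookPartition-injective {i} {j} e = Fin.toℕ-injective (ℕ.suc-injective
    (≡.trans (≡.sym (length-hookAt i)) (≡.trans (↭.↭-length hookAt-↭) (length-hookAt j))))
    where
    length-hookAt : ∀ i → length (hookAt i) ≡ suc (toℕ i)
    length-hookAt i = ≡.cong suc (List.length-replicate (toℕ i))
    hookAt-↭ : hookAt i ↭ hookAt j
    hookAt-↭ = ↭-trans (↭-sym (indices-fromIndices (hookAt i) (weight-hookAt i)))
      (↭-trans (↭-reflexive (≡.cong indices e)) (indices-fromIndices (hookAt j) (weight-hookAt j)))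

  open DecMembership (_≟ᴾ_ {suc m}) using (_∈?_)

  -- There is one hook for each length 1, ..., n. Listing them separately makes p(n) - n the length
  -- of `nonHooks`, which indexes the basis of the kernel.
  hooks nonHooks allPartitions : List (Partition (suc m))
  hooks         = List.map hookPartition (allFin (suc m))
  nonHooks      = List.filter (λ lam → ¬? (lam ∈? hooks)) (List.deduplicate _≟ᴾ_ partitions)
  allPartitions = hooks ++ nonHooks

  ∈-allPartitions : ∀ lam → lam ∈ hooks ⊎ lam ∈ nonHooks
  ∈-allPartitions lam with lam ∈? hooks
  ... | yes lam∈ = inj₁ lam∈
  ... | no  lam∉ = inj₂ (∈.∈-filter⁺ (λ lam → ¬? (lam ∈? hooks)) (∈.∈-deduplicate⁺ _≟ᴾ_ (∈-partitions lam)) lam∉)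

  nonHooks-∉ : ∀ {lam} → lam ∈ nonHooks → lam ∉ hooks
  nonHooks-∉ lam∈ = proj₂ (∈.∈-filter⁻ (λ lam → ¬? (lam ∈? hooks)) {xs = List.deduplicate _≟ᴾ_ partitions} lam∈)

  nonHooks-unique : Unique nonHooks
  nonHooks-unique = Unique.filter⁺ (λ lam → ¬? (lam ∈? hooks)) (DecUnique.deduplicate-! _≟ᴾ_ partitions)

  allPartitions-unique : Unique allPartitions
  allPartitions-unique = Unique.++⁺ (Unique.map⁺ hookPartition-injective (Unique.allFin⁺ (suc m))) nonHooks-unique
    (λ (lam∈hooks , lam∈nonHooks) → nonHooks-∉ lam∈nonHooks lam∈hooks)

  Fin↔Partition : Fin (length allPartitions) ↔ Partition (suc m)
  Fin↔Partition = enumeration⇒↔ allPartitions-unique λ lam → case (∈-allPartitions lam)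
    where
    case : ∀ {lam} → lam ∈ hooks ⊎ lam ∈ nonHooks → lam ∈ allPartitions
    case (inj₁ p) = ∈.∈-++⁺ˡ p
    case (inj₂ p) = ∈.∈-++⁺ʳ hooks p

  length-allPartitions : length nonHooks ℕ.+ suc m ≡ length allPartitions
  length-allPartitions = ≡.trans (ℕ.+-comm (length nonHooks) (suc m)) (≡.trans
    (≡.cong (ℕ._+ length nonHooks)
      (≡.sym (≡.trans (List.length-map hookPartition (allFin (suc m))) (List.length-tabulate id))))
    (≡.sym (List.length-++ hooks)))

  hook-indices : ∀ {lam} → lam ∈ hooks → indices lam ↭ hookIndices (sumLength (indices lam))
  hook-indices lam∈ with ∈.∈-map⁻ hookPartition lam∈
  ... | i , _ , refl = ↭-trans p (↭-reflexive (≡.sym (≡.cong hookIndices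
    (≡.trans (sumLength-↭ p) (sumLength-hook (m ∸ toℕ i) (toℕ i))))))
    where p = indices-fromIndices (hookAt i) (weight-hookAt i)

  ↭hook⇒∈hooks : ∀ {lam mu : Partition (suc m)} → indices lam ↭ hookIndices (sumLength (indices mu)) → lam ∈ hooks
  ↭hook⇒∈hooks {lam} {mu} p with hookAt-complete (indices mu) (weight-indices mu)
  ... | i , e = ≡.subst (_∈ hooks) (≡.sym (fromIndices-indices lam (weight-hookAt i) (↭-trans p (↭-reflexive e))))
    (∈.∈-map⁺ hookPartition (∈.∈-allFin i))

-- Coordinates with respect to a finite family.

sum-zero : ∀ {n} {t : Fin n → ℚ[ X ]} → (∀ i → t i ≈ con 0ℚ) → sum t ≈ con 0ℚ
sum-zero {n = zero}  e = ≈-refl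
sum-zero {n = suc n} e = ≈-trans (+-cong (e zero) (sum-zero (e ∘ suc))) (+-identityˡ _)

sum-single : ∀ {n} (t : Fin n → ℚ[ X ]) i → (∀ j → j ≢ i → t j ≈ con 0ℚ) → sum t ≈ t i
sum-single {n = suc n} t zero    e = ≈-trans (+-congʳ (sum-zero λ j → e (suc j) λ ())) (P.+-identityʳ _)
sum-single {n = suc n} t (suc i) e = ≈-trans (+-cong (e zero λ ())
  (sum-single (t ∘ suc) i λ j j≢i → e (suc j) (j≢i ∘ Fin.suc-injective))) (+-identityˡ _)

sum-+ : ∀ {n} (t t′ : Fin n → ℚ[ X ]) → sum (λ i → t i + t′ i) ≈ sum t + sum t′
sum-+ {n = zero}  t t′ = ≈-sym (+-identityˡ _)
sum-+ {n = suc n} t t′ = ≈-trans (+-congʳ (sum-+ (t ∘ suc) (t′ ∘ suc))) (P.+-interchange _ _ _ _)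

sum-map : ∀ {n} {φ : ℚ[ X ] → ℚ[ Y ]} → Linear φ → ∀ (t : Fin n → ℚ[ X ]) → φ (sum t) ≈ sum (φ ∘ t)
sum-map {n = zero}  φ t = 0-homo φ
sum-map {n = suc n} φ t = ≈-trans (+-homo φ _ _) (+-congʳ (sum-map φ (t ∘ suc)))

module Coordinates {d} (t : Fin d → ℚ[ X ]) where

  ∑ : (Fin d → ℚ) → ℚ[ X ]
  ∑ c = sum (λ i → c i · t i)

  HasCoordinates : ℚ[ X ] → Set
  HasCoordinates f = ∃ λ c → f ≈ ∑ c

  coordinates-0 : HasCoordinates (con 0ℚ)
  coordinates-0 = (λ _ → 0ℚ) , ≈-sym (sum-zero λ i → P.zeroˡ (t i))

  coordinates-basis : ∀ i → HasCoordinates (t i)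
  coordinates-basis i = δᵢ , ≈-sym (≈-trans
    (sum-single (λ j → δᵢ j · t j) i λ j j≢i →
      ≈-trans (*-congˡ (≡⇒≈ (≡.cong indicator (dec-false (j Fin.≟ i) j≢i)))) (P.zeroˡ _))
    (≈-trans (*-congˡ (≡⇒≈ (≡.cong indicator (dec-true (i Fin.≟ i) refl)))) (*-identityˡ _)))
    where
    indicator = λ b → con {X} (if b then 1ℚ else 0ℚ)
    δᵢ : Fin d → ℚ
    δᵢ j = if does (j Fin.≟ i) then 1ℚ else 0ℚ

  coordinates-+ : ∀ {f g} → HasCoordinates f → HasCoordinates g → HasCoordinates (f + g)
  coordinates-+ (c , e) (c′ , e′) = (λ i → c i ℚ.+ c′ i) , ≈-trans (+-cong e e′)
    (≈-trans (≈-sym (sum-+ (λ i → c i · t i) (λ i → c′ i · t i)))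
             (sum-cong λ i → ≈-trans (≈-sym (P.distribʳ (t i) (con (c i)) (con (c′ i))))
                        (*-congˡ (≈-sym (con-+ (c i) (c′ i))))))

  coordinates-· : ∀ a {f} → HasCoordinates f → HasCoordinates (a · f)
  coordinates-· a (c , e) = (λ i → a ℚ.* c i) , ≈-trans (*-congʳ e)
    (≈-trans (sum-map (*-linear (con a)) (λ i → c i · t i))
             (sum-cong λ i → ≈-trans (≈-sym (*-assoc (con a) (con (c i)) (t i))) (*-congˡ (≈-sym (con-* a (c i))))))

  coordinates-eval : ∀ {I : Set} {g : I → ℚ[ X ]} → (∀ i → HasCoordinates (g i)) → ∀ L → HasCoordinates (eval g L)
  coordinates-eval e []            = coordinates-0
  coordinates-eval e ((c , i) ∷ L) = coordinates-+ (coordinates-· c (e i)) (coordinates-eval e L)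

eval-minus : ∀ {I : Set} (g g′ : I → ℚ[ X ]) L → eval (λ i → g i - g′ i) L ≈ eval g L - eval g′ L
eval-minus g g′ []            = ≈-sym (P.-‿inverseʳ _)
eval-minus g g′ ((c , i) ∷ L) = ≈-trans (+-congʳ (eval-minus g g′ L))
  (solve 5 (λ c a b p q → c :* (a :+ :- b) :+ (p :+ :- q) := (c :* a :+ p) :+ :- (c :* b :+ q))
    ≈-refl (con c) (g i) (g′ i) (eval g L) (eval g′ L))

-- Flattens Σ cᵢ (κᵢ - κ′ᵢ) into a formal combination, the form required by `monomials-independent`.
differences : ∀ {I : Set} {d} → (Fin d → ℚ) → (κ κ′ : Fin d → I) → Combination I
differences {d = zero}  c κ κ′ = []
differences {d = suc d} c κ κ′ =
  (c zero , κ zero) ∷ (ℚ.- c zero , κ′ zero) ∷ differences (c ∘ suc) (κ ∘ suc) (κ′ ∘ suc)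

eval-differences : ∀ {I : Set} {d} (g : I → ℚ[ X ]) (c : Fin d → ℚ) κ κ′ →
                   eval g (differences c κ κ′) ≈ sum (λ i → c i · (g (κ i) - g (κ′ i)))
eval-differences {d = zero}  g c κ κ′ = ≈-refl
eval-differences {d = suc d} g c κ κ′ = ≈-trans
  (+-congʳ (+-cong (*-congˡ (P.con-neg (c zero))) (eval-differences g (c ∘ suc) (κ ∘ suc) (κ′ ∘ suc))))
  (solve 4 (λ c a b s → c :* a :+ (:- c :* b :+ s) := c :* (a :+ :- b) :+ s)
    ≈-refl (con (c zero)) (g (κ zero)) (g (κ′ zero)) (sum (λ i → c (suc i) · (g (κ (suc i)) - g (κ′ (suc i))))))

-- The component of degree n = m + 1.

module Graded (ρ : Λ → End) (ρ-isAlgebraHomomorphism : IsAlgebraHomomorphism ρ)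
  (ρ-h : ∀ r → ρ (h r) ≈ᴱ 𝒢 r) (p : ℕ → Λ) (p-powerSum : ∀ m → 1 ≤ m → IsPowerSum m (p m)) (m : ℕ) where

  open Representation ρ ρ-isAlgebraHomomorphism ρ-h p p-powerSum
  open Hooks m

  Λₙ⇒p : ∀ {f} → Λ⟨ suc m ⟩ f → Span (PartitionProduct (suc m) p) f
  Λₙ⇒p Λf = weight⇒partition p (h⇒p p₊-newton (partition⇒weight h Λf))

  p⇒Λₙ : ∀ {f} → Span (MonomialOfWeight (suc m) p₊) f → Λ⟨ suc m ⟩ f
  p⇒Λₙ s = weight⇒partition h (p⇒h p₊-newton s)

  Λₙ⇒Combination : ∀ {f} → Λ⟨ suc m ⟩ f → ∃ λ L → f ≈ eval (mon p₊ ∘ indices {suc m}) L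
  Λₙ⇒Combination Λf = Span⇒Combination (λ (lam , e) → lam , ≡.trans e (⟦⟧≡mon p lam)) (Λₙ⇒p Λf)

  module HookCoordinates = Coordinates (mon p₊ ∘ hookAt)

  -- Each product of power sums is congruent to its hook, and congruent elements have the same image
  -- because the ideal lies in the kernel.
  Λₙ⇒hooks : ∀ {f} → Λ⟨ suc m ⟩ f → ∃ λ c → ρ f ≈ᴱ ρ (HookCoordinates.∑ c)
  Λₙ⇒hooks {f} Λf =
    let L , f≈L = Λₙ⇒Combination Λf
        c , e   = HookCoordinates.coordinates-eval hook-coordinates L
        congruent q = mod-trans (≈⇒mod f≈L) (mod-trans (eval-mod (mon≡hook p ∘ indices) L) (≈⇒mod e))
    in c , λ g → P.x∙y⁻¹≈ε⇒x≈y _ _ (≈-trans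
      (≈-sym (≈-trans (ρ-+ f _ g) (+-congʳ (ρ-neg (HookCoordinates.∑ c) g)))) (ideal⊆kernel q g))
    where
    hook-coordinates : ∀ lam → HookCoordinates.HasCoordinates (hook p₊ (sumLength (indices {suc m} lam)))
    hook-coordinates lam =
      let i , e = hookAt-complete (indices lam) (weight-indices lam)
      in ≡.subst HookCoordinates.HasCoordinates (≡.cong (mon p₊) (≡.sym e)) (HookCoordinates.coordinates-basis i)

  hooks∈Λₙ : ∀ c → Λ⟨ suc m ⟩ (HookCoordinates.∑ c)
  hooks∈Λₙ c = p⇒Λₙ (Span-sum λ i → c i ·∈ gen (hookAt i , weight-hookAt i , refl))
    where
    Span-sum : ∀ {S n} {t : Fin n → Λ} → (∀ i → Span S (t i)) → Span S (sum t)
    Span-sum {n = zero}  s = 0∈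
    Span-sum {n = suc n} s = s zero +∈ Span-sum (s ∘ suc)

  -- Zero if `rs` is itself a hook; the remaining ones form the basis.
  kernelElement : List ℕ → Λ
  kernelElement rs = mon p₊ rs - hook p₊ (sumLength rs)

  kernelElement∈Λₙ : ∀ rs → weight rs ≡ suc m → Λ⟨ suc m ⟩ (kernelElement rs)
  kernelElement∈Λₙ rs e = p⇒Λₙ (gen (rs , e , refl) +∈
    Span-neg (gen (hookIndices (sumLength rs) , ≡.trans (weight-hookIndices rs) e , refl)))

  ρ-kernelElement : ∀ rs → ρ (kernelElement rs) ≈ᴱ 0ᴱ
  ρ-kernelElement rs = ideal⊆kernel (difference (mon≡hook p rs))
    where open _≡_mod_

  Kernel : Λ → Set
  Kernel f = Λ⟨ suc m ⟩ f × (ρ f ≈ᴱ 0ᴱ)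

  basisIndices : Fin (length nonHooks) → List ℕ
  basisIndices k = indices (lookup nonHooks k)

  basis : Fin (length nonHooks) → Λ
  basis = kernelElement ∘ basisIndices

  -- Test with the indicator `G` of the k-th non-hook. No hook `κ′ j` lies in its class, and
  -- distinct non-hooks lie in distinct classes, so only `c k` survives.
  basis-independent : ∀ c → sum (λ k → c k · basis k) ≈ con 0ℚ → ∀ k → c k ≡ 0ℚ
  basis-independent c e k = con-injective {Fin 0} (begin
    con (c k)
      ≈⟨ P.*-identityʳ _ ⟨
    c k · con 1ℚ
      ≈⟨ *-congʳ G-k ⟨
    c k · (G (basisIndices k) - G (κ′ k))
      ≈⟨ sum-single (λ j → c j · (G (basisIndices j) - G (κ′ j))) k
           (λ j j≢k → ≈-trans (*-congʳ (G-j j j≢k)) (P.zeroʳ _)) ⟨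
    sum (λ j → c j · (G (basisIndices j) - G (κ′ j)))
      ≈⟨ eval-differences G c basisIndices κ′ ⟨
    eval G L
      ≈⟨ monomials-independent p₊-powerSums L
           (λ N → substitute-cong _ (≈-trans (eval-differences (mon p₊) c basisIndices κ′) e)) G G-↭ ⟩
    con 0ℚ ∎)
    where
    κ′ : Fin (length nonHooks) → List ℕ
    κ′ = hookIndices ∘ sumLength ∘ basisIndices
    L = differences c basisIndices κ′

    G : List ℕ → ℚ[ Fin 0 ]
    G rs = con (if does (basisIndices k ↭? rs) then 1ℚ else 0ℚ)

    G-yes : ∀ {rs} → basisIndices k ↭ rs → G rs ≈ con 1ℚ
    G-yes {rs} q = ≡⇒≈ (≡.cong (λ b → con (if b then 1ℚ else 0ℚ)) (dec-true (basisIndices k ↭? rs) q))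

    G-no : ∀ {rs} → ¬ (basisIndices k ↭ rs) → G rs ≈ con 0ℚ
    G-no {rs} q = ≡⇒≈ (≡.cong (λ b → con (if b then 1ℚ else 0ℚ)) (dec-false (basisIndices k ↭? rs) q))

    G-↭ : ∀ {rs ss} → rs ↭ ss → G rs ≈ G ss
    G-↭ {rs} {ss} q = by-cases (basisIndices k ↭? rs)
      where
      by-cases : Dec (basisIndices k ↭ rs) → G rs ≈ G ss
      by-cases (yes r) = ≈-trans (G-yes r) (≈-sym (G-yes (↭-trans r q)))
      by-cases (no ¬r) = ≈-trans (G-no ¬r) (≈-sym (G-no (λ s → ¬r (↭-trans s (↭-sym q)))))

    G-κ′ : ∀ j → G (κ′ j) ≈ con 0ℚ
    G-κ′ j = G-no λ q → nonHooks-∉ (∈.∈-lookup k) (↭hook⇒∈hooks {mu = lookup nonHooks j} q)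

    G-k : G (basisIndices k) - G (κ′ k) ≈ con 1ℚ
    G-k = ≈-trans (+-cong (G-yes ↭-refl) (-‿cong (G-κ′ k))) (solve 0 (:con 1ℚ :+ :- :con 0ℚ := :con 1ℚ) ≈-refl)

    G-j : ∀ j → j ≢ k → G (basisIndices j) - G (κ′ j) ≈ con 0ℚ
    G-j j j≢k = ≈-trans
      (+-cong (G-no λ q → j≢k (lookup-injective nonHooks-unique j k (≡.sym (indices-injective q)))) (-‿cong (G-κ′ j)))
      (P.-‿inverseʳ _)

  module BasisCoordinates = Coordinates basis

  -- For `f` in the kernel the combination obtained by replacing every product by its hook is zero.
  -- Subtracting it from `f` leaves the same combination of kernel elements.
  basis-spans : ∀ f → Kernel f → BasisCoordinates.HasCoordinates f
  basis-spans f (Λf , ρf≈0) =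
    let L , f≈L = Λₙ⇒Combination Λf
        hooks≈0 = hook-vanishes (reindex indices L) λ g → ≈-trans
          (ρ-cong (≈-trans (≡⇒≈ (eval-reindex indices (mon p₊) L)) (≈-sym f≈L)) g) (ρf≈0 g)
        c , e = BasisCoordinates.coordinates-eval kernelElement-coordinates L
    in c , (begin
      f
        ≈⟨ f≈L ⟩
      eval (mon p₊ ∘ indices) L
        ≈⟨ solve 1 (λ a → a := a :+ :- :con 0ℚ) ≈-refl _ ⟩
      eval (mon p₊ ∘ indices) L - con 0ℚ
        ≈⟨ +-congʳ (-‿cong (≈-trans (≡⇒≈ (≡.sym (eval-reindex indices (hook p₊ ∘ sumLength) L))) hooks≈0)) ⟨
      eval (mon p₊ ∘ indices) L - eval (hook p₊ ∘ sumLength ∘ indices) L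
        ≈⟨ eval-minus (mon p₊ ∘ indices) (hook p₊ ∘ sumLength ∘ indices) L ⟨
      eval (kernelElement ∘ indices) L
        ≈⟨ e ⟩
      BasisCoordinates.∑ c ∎)
    where
    kernelElement-coordinates : ∀ lam → BasisCoordinates.HasCoordinates (kernelElement (indices {suc m} lam))
    kernelElement-coordinates lam with ∈-allPartitions lam
    ... | inj₁ lam∈ = let c , e = BasisCoordinates.coordinates-0 in c , ≈-trans
      (≈-trans (+-congˡ (mon-↭ p₊ (hook-indices lam∈))) (P.-‿inverseʳ _)) e
    ... | inj₂ lam∈ = ≡.subst (BasisCoordinates.HasCoordinates ∘ kernelElement ∘ indices)
      (≡.sym (Any.lookup-index lam∈)) (BasisCoordinates.coordinates-basis (Any.index lam∈))

  kernel-dimension : HasDimension Kernel (length nonHooks)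
  kernel-dimension = basis , record
    { member      = λ k → kernelElement∈Λₙ (basisIndices k) (weight-indices (lookup nonHooks k)) ,
                      ρ-kernelElement (basisIndices k)
    ; independent = basis-independent
    ; spanning    = basis-spans }

-- Passage to operators on ℚ(x, y).

≐-resp : ∀ {S T : End} {Φ} → S ≈ᴱ T → T ≐ Φ → S ≐ Φ
≐-resp {S} {T} {Φ} e t f = ≈ᶠ-trans {ι (apply S f)} {ι (apply T f)} {Φ (ι f)} (*-congˡ (e f)) (t f)

module _ {E : ℚ⟨x,y⟩ → ℚ⟨x,y⟩} (E-isDerivation : IsDerivation E)
  (E-δ : E (ι δ) ≈ᶠ ι (con 0ℚ)) (E-u : E u ≈ᶠ u) where

  private
    module E-Fraction = Fraction E-isDerivation E-δ E-u

  δᵏAˡ-≐ : ∀ {T k l n} → (∀ f → apply T f ≈ δᵏAˡ k l f) → k ℕ.+ l ≡ n → T ≐ δ^ n ⟨ E ⟩^ l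
  δᵏAˡ-≐ {T} {k} {l} e refl f = ≈ᶠ-trans {ι (apply T f)} {ι (δᵏAˡ k l f)} {(δ^ (k ℕ.+ l) ⟨ E ⟩^ l) (ι f)}
    (*-congˡ (e f)) (E-Fraction.ι-δᵏAˡ k l f)

  sum-≐ : ∀ {T : End} {n} (c : Fin n → ℚ) (t : Fin n → End) →
          (∀ f → apply T f ≈ sum (λ i → c i · apply (t i) f)) →
          (∀ i → t i ≐ δ^ n ⟨ E ⟩^ suc (toℕ i)) → T ≐ δ^ n ∑[ c ] E
  sum-≐ {T} {n} c t e t-≐ f =
    ≈ᶠ-trans {ι (apply T f)} {ι (sum (λ i → c i · apply (t i) f))} {(δ^ n ∑[ c ] E) (ι f)} (*-congˡ (e f))
      (E-Fraction.ι-sum (δ ^ n) c (λ i → apply (t i) f) (λ i → fold (ι f) E (suc (toℕ i))) (λ i → t-≐ i f))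

proposition16 : ∀ (ρ : Λ → End) → IsAlgebraHomomorphism ρ → (∀ r → ρ (h r) ≈ᴱ 𝒢 r) →
    ∀ (p : ℕ → Λ) → (∀ m → 1 ≤ m → IsPowerSum m (p m)) →
    ∀ (E : ℚ⟨x,y⟩ → ℚ⟨x,y⟩) → IsDerivation E → E (ι δ) ≈ᶠ ι (con 0ℚ) → E u ≈ᶠ u →
    (∀ m → 1 ≤ m →
    (ρ (p m) ≐ δ^ m ⟨ E ⟩^ 1) × (mul (δ ^ (m ∸ 1)) ∘ᴱ 𝒢 1 ≐ δ^ m ⟨ E ⟩^ 1))
    × (∀ n (lam : Partition n) → ρ (p ⟦ lam ⟧) ≐ δ^ n ⟨ E ⟩^ ℓ lam)
    × (∀ f → (ρ f ≈ᴱ 0ᴱ) ⇔ Ideal (Relation p) f)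
    × (∀ n → 1 ≤ n →
    (∀ f → Λ⟨ n ⟩ f → ∃ λ (c : Fin n → ℚ) → ρ f ≐ δ^ n ∑[ c ] E)
    × (∀ (c : Fin n → ℚ) → ∃ λ f → Λ⟨ n ⟩ f × (ρ f ≐ δ^ n ∑[ c ] E))
    × (∃₂ λ N d → (Fin N ↔ Partition n)
    × HasDimension (λ f → Λ⟨ n ⟩ f × (ρ f ≈ᴱ 0ᴱ)) d
    × d ℕ.+ n ≡ N))
proposition16 ρ ρ-isAlgebraHomomorphism ρ-h p p-powerSum E E-isDerivation E-δ E-u =
  power-sums , partition-products , (λ f → mk⇔ (kernel⊆ideal f) ideal⊆kernel) , graded
  where
  open Representation ρ ρ-isAlgebraHomomorphism ρ-h p p-powerSum

  power-sums : ∀ m → 1 ≤ m → (ρ (p m) ≐ δ^ m ⟨ E ⟩^ 1) × (mul (δ ^ (m ∸ 1)) ∘ᴱ 𝒢 1 ≐ δ^ m ⟨ E ⟩^ 1)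
  power-sums (suc r) _ =
    δᵏAˡ-≐ E-isDerivation E-δ E-u {ρ (p₊ r)} {r} (ρ-p r) (ℕ.+-comm r 1) ,
    δᵏAˡ-≐ E-isDerivation E-δ E-u {mul (δ ^ r) ∘ᴱ 𝒢 1} {r} (λ f → *-congʳ (𝒢₁≈A f)) (ℕ.+-comm r 1)

  -- The exponent of δ is the weight: `ρ-mon` provides the sum of the indices, and each A = δE one
  -- more.
  mon-≐ : ∀ {n l} rs → weight rs ≡ n → length rs ≡ l → ρ (mon p₊ rs) ≐ δ^ n ⟨ E ⟩^ l
  mon-≐ rs e refl = δᵏAˡ-≐ E-isDerivation E-δ E-u {ρ (mon p₊ rs)} {ListAction.sum rs}
    (ρ-mon rs) (≡.trans (≡.sym (weight≡sum+length rs)) e)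

  partition-products : ∀ n (lam : Partition n) → ρ (p ⟦ lam ⟧) ≐ δ^ n ⟨ E ⟩^ ℓ lam
  partition-products n lam = ≡.subst (λ g → ρ g ≐ δ^ n ⟨ E ⟩^ ℓ lam) (≡.sym (⟦⟧≡mon p lam))
    (mon-≐ (indices lam) (weight-indices lam) (length-indices lam))

  graded : ∀ n → 1 ≤ n →
    (∀ f → Λ⟨ n ⟩ f → ∃ λ (c : Fin n → ℚ) → ρ f ≐ δ^ n ∑[ c ] E)
    × (∀ (c : Fin n → ℚ) → ∃ λ f → Λ⟨ n ⟩ f × (ρ f ≐ δ^ n ∑[ c ] E))
    × (∃₂ λ N d → (Fin N ↔ Partition n)
    × HasDimension (λ f → Λ⟨ n ⟩ f × (ρ f ≈ᴱ 0ᴱ)) d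
    × d ℕ.+ n ≡ N)
  graded (suc m) _ =
    (λ f Λf → let c , e = Λₙ⇒hooks Λf in c , ≐-resp {ρ f} {ρ (∑ c)} {δ^ suc m ∑[ c ] E} e (hooks-≐ c)) ,
    (λ c → ∑ c , hooks∈Λₙ c , hooks-≐ c) ,
    length allPartitions , length nonHooks , Fin↔Partition , kernel-dimension , length-allPartitions
    where
    open Hooks m
    open Graded ρ ρ-isAlgebraHomomorphism ρ-h p p-powerSum m
    open HookCoordinates using (∑)
    hooks-≐ : ∀ c → ρ (∑ c) ≐ δ^ suc m ∑[ c ] E
    hooks-≐ c = sum-≐ E-isDerivation E-δ E-u {ρ (∑ c)} c (ρ ∘ mon p₊ ∘ hookAt)
      (λ f → ≈-trans (sum-map (evalAt-linear f) (λ i → c i · mon p₊ (hookAt i)))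
                     (sum-cong λ i → ρ-· (c i) (mon p₊ (hookAt i)) f))
      (λ i → mon-≐ (hookAt i) (weight-hookAt i) (≡.cong suc (List.length-replicate (toℕ i))))
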